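{- Given a non-canceling arithmetic circuit $C$ computing a polynomial $f\in\mathbb Z[X_1,\ldots,X_n]$, the problem $(r,k)$-Monomial Detection can be solved by a deterministic algorithm in time $$O\left(|C|\cdot r^{12k/r+o(k/r)}\cdot 2^{O(k/r)}\cdot k^{O(1)}\cdot n^3\cdot\log n\right).$$
   Context: $(r,k)$-Monomial Detection: given an arithmetic circuit $C$ computing an $n$-variate polynomial $f\in\mathbb Z[X_1,\ldots,X_n]$ and positive integers $r,k$, determine whether $f$ contains (with nonzero coefficient) a monomial of total degree $k$ in which every variable has individual degree at most $r$. An arithmetic circuit is non-canceling if it has only variables at its leaves (no constants) and only addition and multiplication gates (no subtractions). $|C|$ denotes the size of the circuit. Here $o(k/r)$ denotes $(k/r)\cdot o(1)$, where the $o(1)$ term is independent of $n$ and tends to $0$ as $k\to\infty$; the constants hidden in the $O(\cdot)$'s are absolute. -}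

module Defs where

open import Data.Fin.Base using (Fin; toℕ)
open import Data.Integer.Base using (ℤ; 0ℤ; 1ℤ; ∣_∣)
import Data.Integer.Base as ℤ
open import Data.List.Base using (List; []; _∷_; _++_; cartesianProductWith)
import Data.List.Base as List
open import Data.List.NonEmpty.Base using (List⁺; toList; foldr₁)
import Data.List.NonEmpty.Base as List⁺
open import Data.Nat.Base
  using (ℕ; zero; suc; _+_; _*_; _∸_; _/_; _^_; _⊔_; _≤_; _≡ᵇ_)
open import Data.Nat.Logarithm using (⌊log₂_⌋)
open import Data.Nat.Properties using (_≟_)
open import Data.Product.Base using (_×_; _,_; ∃-syntax)
open import Data.Bool.Base using (if_then_else_)
open import Data.Rational.Base using (ℚ; 0ℚ; ↥_; ↧ₙ_)
import Data.Rational.Base as ℚ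
open import Data.Sum.Base using (_⊎_)
open import Data.Vec.Base using (Vec; []; _∷ʳ_; lookup; last; replicate; zipWith; sum; _[_]≔_)
open import Data.Vec.Properties using (≡-dec)
open import Data.Vec.Relation.Unary.All using (All)
open import Relation.Binary.PropositionalEquality using (_≡_; _≢_)
open import Relation.Nullary using (¬_; does)

------------------------------------------------------------------------
-- Polynomials in ℤ[X₁,…,Xₙ]

-- Exponent vectors.
Monomial : ℕ → Set
Monomial n = Vec ℕ n

-- Formal sums of terms. They are not normalised (a monomial may occur in
-- several terms, or with coefficient 0): the polynomial denoted is
-- determined by `coeff`, which collects equal monomials.
Poly : ℕ → Set
Poly n = List (ℤ × Monomial n)

coeff : ∀ {n} → Poly n → Monomial n → ℤ
coeff []            μ = 0ℤ
coeff ((a , ν) ∷ f) μ =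
  if does (≡-dec _≟_ ν μ) then a ℤ.+ coeff f μ else coeff f μ

X : ∀ {n} → Fin n → Poly n
X {n} i = (1ℤ , replicate n 0 [ i ]≔ 1) ∷ []

infixl 6 _⊞_
infixl 7 _⊠_

_⊞_ : ∀ {n} → Poly n → Poly n → Poly n
_⊞_ = _++_

_⊠_ : ∀ {n} → Poly n → Poly n → Poly n
_⊠_ = cartesianProductWith λ { (a , μ) (b , ν) → a ℤ.* b , zipWith _+_ μ ν }

MonomialDetection : ∀ {n} → Poly n → (r k : ℕ) → Set
MonomialDetection {n} f r k =
  ∃[ μ ] coeff f μ ≢ 0ℤ × sum μ ≡ k × All (_≤ r) μ

------------------------------------------------------------------------
-- Non-canceling arithmetic circuits

-- A gate of a circuit over n variables, whose operands are among m earlier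
-- gates. Fan-in is arbitrary but nonzero: an empty sum or product would be
-- a constant.
data Gate (n m : ℕ) : Set where
  var : Fin n         → Gate n m
  add : List⁺ (Fin m) → Gate n m
  mul : List⁺ (Fin m) → Gate n m

infixl 5 _▷_

-- Directed acyclic graphs of m gates, listed in topological order; the
-- operand i refers to the i-th gate counted from the start.
data Gates (n : ℕ) : ℕ → Set where
  ∅   : Gates n 0
  _▷_ : ∀ {m} → Gates n m → Gate n m → Gates n (suc m)

record NonCancelingCircuit (n : ℕ) : Set where
  constructor circuit
  field
    {inner} : ℕ
    gates   : Gates n (suc inner)  -- the output is the last gate

open NonCancelingCircuit public

⟦_⟧gate : ∀ {n m} → Gate n m → Vec (Poly n) m → Poly n
⟦ var i  ⟧gate fs = X i
⟦ add is ⟧gate fs = foldr₁ _⊞_ (List⁺.map (lookup fs) is)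
⟦ mul is ⟧gate fs = foldr₁ _⊠_ (List⁺.map (lookup fs) is)

⟦_⟧gates : ∀ {n m} → Gates n m → Vec (Poly n) m
⟦ ∅      ⟧gates = []
⟦ gs ▷ g ⟧gates = ⟦ gs ⟧gates ∷ʳ ⟦ g ⟧gate ⟦ gs ⟧gates

⟦_⟧ : ∀ {n} → NonCancelingCircuit n → Poly n
⟦ C ⟧ = last ⟦ gates C ⟧gates

fanIn : ∀ {n m} → Gate n m → ℕ
fanIn (var _)  = 0
fanIn (add is) = List⁺.length is
fanIn (mul is) = List⁺.length is

-- Number of gates plus number of wires.
gatesSize : ∀ {n m} → Gates n m → ℕ
gatesSize ∅        = 0
gatesSize (gs ▷ g) = gatesSize gs + suc (fanIn g)

size : ∀ {n} → NonCancelingCircuit n → ℕ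
size C = gatesSize (gates C)

------------------------------------------------------------------------
-- Deterministic random access machines

-- A unit-cost RAM with structured control flow. Each memory cell holds a
-- natural number; the cost model is completed by `WordsFit` below, which
-- limits the numbers to O(log (input + time)) bits, so that unit cost is
-- not a way to get arithmetic on long numbers for free.

Memory : Set
Memory = ℕ → ℕ

infixl 6 _⊕_ _⊖_
infixl 7 _⊗_ _⊘_

data Exp : Set where
  lit             : ℕ → Exp
  mem             : Exp → Exp          -- contents of the addressed cell
  _⊕_ _⊖_ _⊗_ _⊘_ : Exp → Exp → Exp

-- Division by zero yields zero.
_div_ : ℕ → ℕ → ℕ
a div zero  = 0
a div suc b = a / suc b

⟦_⟧exp : Exp → Memory → ℕ
⟦ lit a ⟧exp   σ = a
⟦ mem e ⟧exp   σ = σ (⟦ e ⟧exp σ)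
⟦ e₁ ⊕ e₂ ⟧exp σ = ⟦ e₁ ⟧exp σ + ⟦ e₂ ⟧exp σ
⟦ e₁ ⊖ e₂ ⟧exp σ = ⟦ e₁ ⟧exp σ ∸ ⟦ e₂ ⟧exp σ
⟦ e₁ ⊗ e₂ ⟧exp σ = ⟦ e₁ ⟧exp σ * ⟦ e₂ ⟧exp σ
⟦ e₁ ⊘ e₂ ⟧exp σ = ⟦ e₁ ⟧exp σ div ⟦ e₂ ⟧exp σ

-- Number of operations performed to evaluate an expression.
cost : Exp → ℕ
cost (lit _)   = 1
cost (mem e)   = suc (cost e)
cost (e₁ ⊕ e₂) = suc (cost e₁ + cost e₂)
cost (e₁ ⊖ e₂) = suc (cost e₁ + cost e₂)
cost (e₁ ⊗ e₂) = suc (cost e₁ + cost e₂)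
cost (e₁ ⊘ e₂) = suc (cost e₁ + cost e₂)

-- Largest value, including addresses, met while evaluating an expression.
peak : Exp → Memory → ℕ
peak e@(lit _)   σ = ⟦ e ⟧exp σ
peak e@(mem e₁)  σ = ⟦ e ⟧exp σ ⊔ peak e₁ σ
peak e@(e₁ ⊕ e₂) σ = ⟦ e ⟧exp σ ⊔ (peak e₁ σ ⊔ peak e₂ σ)
peak e@(e₁ ⊖ e₂) σ = ⟦ e ⟧exp σ ⊔ (peak e₁ σ ⊔ peak e₂ σ)
peak e@(e₁ ⊗ e₂) σ = ⟦ e ⟧exp σ ⊔ (peak e₁ σ ⊔ peak e₂ σ)
peak e@(e₁ ⊘ e₂) σ = ⟦ e ⟧exp σ ⊔ (peak e₁ σ ⊔ peak e₂ σ)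

infix  4 _≔_
infixr 3 _⨾_

-- Conditions are true when nonzero; `e₁ ≔ e₂` stores the value of e₂ at the
-- address given by e₁.
data Program : Set where
  skip  : Program
  _≔_   : Exp → Exp → Program
  _⨾_   : Program → Program → Program
  cond  : Exp → Program → Program → Program
  while : Exp → Program → Program

_[_↦_] : Memory → ℕ → ℕ → Memory
(σ [ a ↦ v ]) b = if b ≡ᵇ a then v else σ b

infix 2 _,_⇓_[_,_]

-- P , σ ⇓ σ′ [ t , w ]: started in σ, P halts in σ′ after t steps, and w is
-- the largest number it handled on the way.
data _,_⇓_[_,_] : Program → Memory → Memory → ℕ → ℕ → Set where
  skip : ∀ {σ} → skip , σ ⇓ σ [ 1 , 0 ]
  assign : ∀ {e₁ e₂ σ} →
    (e₁ ≔ e₂) , σ ⇓ σ [ ⟦ e₁ ⟧exp σ ↦ ⟦ e₂ ⟧exp σ ]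
      [ suc (cost e₁ + cost e₂) , peak e₁ σ ⊔ peak e₂ σ ]
  seq : ∀ {P Q σ σ′ σ″ t t′ w w′} →
    P , σ ⇓ σ′ [ t , w ] → Q , σ′ ⇓ σ″ [ t′ , w′ ] →
    (P ⨾ Q) , σ ⇓ σ″ [ t + t′ , w ⊔ w′ ]
  cond-true : ∀ {e P Q σ σ′ t w} → ⟦ e ⟧exp σ ≢ 0 →
    P , σ ⇓ σ′ [ t , w ] →
    cond e P Q , σ ⇓ σ′ [ suc (cost e + t) , peak e σ ⊔ w ]
  cond-false : ∀ {e P Q σ σ′ t w} → ⟦ e ⟧exp σ ≡ 0 →
    Q , σ ⇓ σ′ [ t , w ] →
    cond e P Q , σ ⇓ σ′ [ suc (cost e + t) , peak e σ ⊔ w ]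
  while-true : ∀ {e P σ σ′ σ″ t t′ w w′} → ⟦ e ⟧exp σ ≢ 0 →
    P , σ ⇓ σ′ [ t , w ] → while e P , σ′ ⇓ σ″ [ t′ , w′ ] →
    while e P , σ ⇓ σ″ [ suc (cost e + (t + t′)) , peak e σ ⊔ (w ⊔ w′) ]
  while-false : ∀ {e P σ} → ⟦ e ⟧exp σ ≡ 0 →
    while e P , σ ⇓ σ [ suc (cost e) , peak e σ ]

-- The answer is left in cell 0: 1 for yes, 0 for no.
_Decides_from_[_,_] : Program → Set → Memory → ℕ → ℕ → Set
P Decides Q from σ [ t , w ] =
  ∃[ σ′ ] (P , σ ⇓ σ′ [ t , w ]) × ((σ′ 0 ≡ 1 × Q) ⊎ (σ′ 0 ≡ 0 × ¬ Q))

------------------------------------------------------------------------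
-- Input format

encodeGate : ∀ {n m} → Gate n m → List ℕ
encodeGate (var i)  = 0 ∷ toℕ i ∷ []
encodeGate (add is) = 1 ∷ List⁺.length is ∷ List.map toℕ (toList is)
encodeGate (mul is) = 2 ∷ List⁺.length is ∷ List.map toℕ (toList is)

encodeGates : ∀ {n m} → Gates n m → List ℕ
encodeGates ∅        = []
encodeGates (gs ▷ g) = encodeGates gs ++ encodeGate g

-- The list occupies the cells from address 0 on; all others hold 0.
load : List ℕ → Memory
load []       _       = 0
load (x ∷ _)  zero    = x
load (_ ∷ xs) (suc a) = load xs a

input : ∀ {n} → NonCancelingCircuit n → (r k : ℕ) → Memory
input {n} C r k = load (n ∷ r ∷ k ∷ suc (inner C) ∷ encodeGates (gates C))

------------------------------------------------------------------------
-- Resource bounds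

-- Numbers up to w have O(log (input + t)) bits.
WordsFit : ∀ {n} → (e : ℕ) → NonCancelingCircuit n → (r k t w : ℕ) → Set
WordsFit {n} e C r k t w = w ≤ (size C + n + r + k + t) ^ e

-- ε(k) is o(1) as k → ∞. As it serves in upper bounds only, it may be taken
-- nonnegative and rational.
IsLittleO1 : (ℕ → ℚ) → Set
IsLittleO1 ε =
  (∀ k → 0ℚ ℚ.≤ ε k) ×
  (∀ δ → 0ℚ ℚ.< δ → ∃[ K ] ∀ k → K ≤ k → ε k ℚ.< δ)

-- With ε(k) = p / q, this is the inequality
--
--   t ≤ A · |C| · r^((12 + p/q) k/r) · 2^(c k/r) · k^d · n³ · (1 + ⌊log₂ n⌋)
--
-- between real numbers, with both sides raised to the power r q. The 1 +
-- keeps the last factor from vanishing at n = 1.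
TimeBound : (A c d : ℕ) (ε : ℕ → ℚ) →
            ∀ {n} → NonCancelingCircuit n → (r k t : ℕ) → Set
TimeBound A c d ε {n} C r k t =
  t ^ (r * q) ≤
    (A * size C * k ^ d * n ^ 3 * suc ⌊log₂ n ⌋) ^ (r * q)
      * r ^ ((12 * q + p) * k)
      * 2 ^ (c * k * q)
  where
  p = ∣ ↥ ε k ∣
  q = ↧ₙ ε k

{-# OPTIONS --safe #-}

-- Let β = r + 1. If the variables are distributed to D + 1 bins such that
-- every bin gets total degree at most r, then a monomial of degree k has
-- the weight k β^(D+1) + Σ (load of b) β^b, where the loads are the digits
-- of the second summand u, so that u has digit sum k. Conversely, a weight
-- k β^(D+1) + u with u < β^(D+1) of digit sum k can only come from a
-- monomial of degree k in which all exponents are at most r. The weights of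
-- the monomials of a non-canceling circuit are found by dynamic programming:
-- sums of polynomials are unions of sets of weights, products are sumsets.
--
-- It remains to find the bins among few candidates. The variables are first
-- hashed injectively (on the support) into O(k²) keys, by one of n O(k²)
-- functions. Then, in rounds, the keys are hashed into O(K) cells, where K
-- bounds the degree that is left; for some hash function only degree K/4
-- falls into overloaded cells. The other cells are merged into bins,
-- greedily from left to right; describing this takes O(K/r) symbols from an
-- alphabet of size O(r). As K decreases geometrically, there are
-- D = 3 k/r + O(log (k/r)) symbols in all, hence r^D 2^O(k/r) candidates,
-- besides the k^O(log (k/r)) choices of hash functions, and each is tested
-- in time |C| r^(2D) up to factors k^O(1) 2^O(k/r). This is within the
-- bound even for ε = 0.
module Submission where

open import Defs
open import Data.Bool.Base using (Bool; true; false; if_then_else_; _∨_)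
import Data.Bool.Base as Bool
open import Data.Empty using (⊥; ⊥-elim)
open import Data.Fin using (#_)
open import Data.Fin.Base using (Fin; toℕ; inject₁; fromℕ)
import Data.Fin.Base as Fin
open import Data.Fin.Properties using (toℕ<n; toℕ-inject₁; toℕ-fromℕ)
open import Data.Integer.Base using (ℤ; 0ℤ)
import Data.Integer.Base as ℤ
open import Data.List.Base using (List; []; _∷_; _++_; length)
import Data.List.Base as List
open import Data.List.Membership.Propositional using (_∈_)
open import Data.List.Membership.Propositional.Properties
  using (∈-++⁺ˡ; ∈-++⁺ʳ; ∈-++⁻; ∈-cartesianProductWith⁺; ∈-cartesianProductWith⁻)
open import Data.List.NonEmpty.Base using (foldr₁) renaming (_∷_ to _∷⁺_)
import Data.List.NonEmpty.Base as List⁺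
open import Data.List.Properties using (length-++; length-map)
import Data.List.Relation.Unary.All as ListAll
open import Data.List.Relation.Unary.All.Properties using (++⁺; map⁺)
open import Data.List.Relation.Unary.Any using (Any; here; there)
open import Data.Nat.Base
open import Data.Nat.DivMod using (m≡m%n+[m/n]*n; m%n<n; m/n≤m)
open import Data.Nat.Logarithm using (⌊log₂_⌋)
open import Data.Nat.Properties
open import Data.Nat.Tactic.RingSolver using (solve-∀)
open import Data.Product.Base
open import Data.Rational.Base using (ℚ; 0ℚ)
import Data.Rational.Properties as ℚ
open import Data.Sum.Base using (_⊎_; inj₁; inj₂)
import Data.Sum.Base as ⊎
open import Data.Unit.Base using (⊤; tt)
open import Data.Vec.Base
  using (Vec; []; _∷_; _∷ʳ_; initLast; lookup; last; replicate; zipWith; sum; _[_]≔_)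
open import Data.Vec.Properties using (≡-dec)
open import Data.Vec.Relation.Unary.All using (All; []; _∷_)
open import Function.Base using (_∘_; _$_; case_of_; id)
open import Relation.Binary.Definitions using (tri<; tri≈; tri>)
open import Relation.Binary.PropositionalEquality
open import Relation.Nullary
open import Relation.Nullary.Decidable using (_×-dec_; ¬?)
open ListAll using ([]; _∷_)

-- A variable of exponent above r can imitate an admissible weight only through a carry, and a carry
-- lowers the digit sum by r while the degree stays. Hence no seed gives a false positive, and it is
-- enough that one good seed exists. Every round chooses a hash function, so a family whose size
-- depends on n would cost n to the power of the number R of rounds; the preliminary hashing
-- confines n to single factors. A pair of items collides under at most a fraction 6/m of the
-- functions into m cells. With m = 24 K, some function leaves at most K/4 in overloaded cells. A
-- round uses 2 K/r symbols for the weight and K/(4 r) for the cells, as 24 K cells are covered by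
-- intervals of up to 96 r cells; the geometric sum is (9/4) (4/3) K/r = 3 K/r. Candidates and naive
-- sumsets together cost r^(3 D), that is r^(9 k/r + O(R)). The gap between 9 and 12 pays for
-- r^O(R), because R is logarithmic in k/r; this is why ε = 0 suffices. A factor k^O(R) would not be
-- polynomial in k, so it is rewritten with k ≤ r 4^R, and 2^O(R²) is 2^O(k/r).

-- Finite sums and weighted indicators.

∑ : ℕ → (ℕ → ℕ) → ℕ
∑ zero    f = 0
∑ (suc n) f = f 0 + ∑ n (f ∘ suc)

∑-mono : ∀ n {f g} → (∀ i → i < n → f i ≤ g i) → ∑ n f ≤ ∑ n g
∑-mono zero    h = z≤n
∑-mono (suc n) h = +-mono-≤ (h 0 z<s) (∑-mono n λ i i<n → h (suc i) (s<s i<n))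

∑-cong : ∀ n {f g} → (∀ i → i < n → f i ≡ g i) → ∑ n f ≡ ∑ n g
∑-cong zero    h = refl
∑-cong (suc n) h = cong₂ _+_ (h 0 z<s) (∑-cong n λ i i<n → h (suc i) (s<s i<n))

∑-+ : ∀ n f g → ∑ n (λ i → f i + g i) ≡ ∑ n f + ∑ n g
∑-+ zero    f g = refl
∑-+ (suc n) f g rewrite ∑-+ n (f ∘ suc) (g ∘ suc) = lem (f 0) (g 0) _ _
  where
  lem : ∀ a b c d → a + b + (c + d) ≡ a + c + (b + d)
  lem = solve-∀

∑-* : ∀ n c f → ∑ n (λ i → c * f i) ≡ c * ∑ n f
∑-* zero    c f = sym (*-zeroʳ c)
∑-* (suc n) c f rewrite ∑-* n c (f ∘ suc) = sym (*-distribˡ-+ c (f 0) _)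

∑-const : ∀ n c → ∑ n (λ _ → c) ≡ n * c
∑-const zero    c = refl
∑-const (suc n) c = cong (c +_) (∑-const n c)

∑-0 : ∀ n → ∑ n (λ _ → 0) ≡ 0
∑-0 n = trans (∑-const n 0) (*-zeroʳ n)

∑-swap : ∀ n m (f : ℕ → ℕ → ℕ) → ∑ n (λ i → ∑ m (f i)) ≡ ∑ m (λ j → ∑ n (λ i → f i j))
∑-swap zero    m f = sym (∑-0 m)
∑-swap (suc n) m f rewrite ∑-swap n m (f ∘ suc) = sym (∑-+ m (f 0) _)

∑-last : ∀ n f → ∑ (suc n) f ≡ ∑ n f + f n
∑-last zero    f = +-identityʳ (f 0)
∑-last (suc n) f rewrite ∑-last n (f ∘ suc) = sym (+-assoc (f 0) _ _)

∑-term : ∀ {n i} f → i < n → f i ≤ ∑ n f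
∑-term {suc n} {zero}  f _         = m≤m+n (f 0) _
∑-term {suc n} {suc i} f (s≤s i<n) = ≤-trans (∑-term (f ∘ suc) i<n) (m≤n+m _ (f 0))

∑-average : ∀ n f → 0 < n → ∃[ i ] i < n × n * f i ≤ ∑ n f
∑-average (suc zero)    f _ = 0 , z<s , ≤-refl
∑-average (suc (suc n)) f _ with ∑-average (suc n) (f ∘ suc) z<s
... | i , i<n , le with ≤-total (f 0) (f (suc i))
...   | inj₁ p = 0 , z<s , +-monoʳ-≤ (f 0) (≤-trans (*-monoʳ-≤ (suc n) p) le)
...   | inj₂ p = suc i , s<s i<n , +-mono-≤ p le

χ : {P : Set} → Dec P → ℕ → ℕ
χ (yes _) v = v
χ (no  _) v = 0

χ-yes : ∀ {P : Set} (d : Dec P) v → P → χ d v ≡ v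
χ-yes (yes _) v p = refl
χ-yes (no ¬p) v p = ⊥-elim (¬p p)

χ-no : ∀ {P : Set} (d : Dec P) v → ¬ P → χ d v ≡ 0
χ-no (yes p) v ¬p = ⊥-elim (¬p p)
χ-no (no _)  v ¬p = refl

χ≤ : ∀ {P : Set} (d : Dec P) v → χ d v ≤ v
χ≤ (yes _) v = ≤-refl
χ≤ (no _)  v = z≤n

χ-mono : ∀ {P Q : Set} (d : Dec P) (e : Dec Q) {v w} → (P → Q) → v ≤ w → χ d v ≤ χ e w
χ-mono (yes p) e {v} {w} h v≤w rewrite χ-yes e w (h p) = v≤w
χ-mono (no _)  e h v≤w = z≤n

χ-⊎ : ∀ {P Q R : Set} (d : Dec P) (e : Dec Q) (f : Dec R) {v} → (P → Q ⊎ R) → χ d v ≤ χ e v + χ f v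
χ-⊎ (no _)  e f h = z≤n
χ-⊎ (yes p) e f {v} h with h p
... | inj₁ q rewrite χ-yes e v q = m≤m+n v _
... | inj₂ r rewrite χ-yes f v r = m≤n+m v _

χ-disjoint : ∀ {P Q R : Set} (d : Dec P) (e : Dec Q) (f : Dec R) {v} →
  (P → R) → (Q → R) → (P → ¬ Q) → χ d v + χ e v ≤ χ f v
χ-disjoint (no _)  e f {v} g h k = χ-mono e f h ≤-refl
χ-disjoint (yes p) e f {v} g h k rewrite χ-yes f v (g p) | χ-no e v (k p) = ≤-reflexive (+-identityʳ v)

χ-* : ∀ {P : Set} (d : Dec P) v → χ d v ≡ v * χ d 1
χ-* (yes _) v = sym (*-identityʳ v)
χ-* (no _)  v = sym (*-zeroʳ v)

∑-χ≡ : ∀ n (f : ℕ → ℕ) i → ∑ n (λ j → χ (i ≟ j) (f j)) ≤ f i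
∑-χ≡ zero    f i = z≤n
∑-χ≡ (suc n) f zero = begin
  f 0 + ∑ n (λ j → χ (0 ≟ suc j) (f (suc j))) ≡⟨ cong (f 0 +_) (∑-cong n λ j _ → χ-no (0 ≟ suc j) (f (suc j)) λ ()) ⟩
  f 0 + ∑ n (λ _ → 0) ≡⟨ cong (f 0 +_) (∑-0 n) ⟩
  f 0 + 0 ≡⟨ +-identityʳ _ ⟩
  f 0 ∎
  where open ≤-Reasoning
∑-χ≡ (suc n) f (suc i) = begin
  χ (suc i ≟ 0) (f 0) + ∑ n (λ j → χ (suc i ≟ suc j) (f (suc j)))
    ≡⟨ cong (_+ ∑ n (λ j → χ (suc i ≟ suc j) (f (suc j)))) (χ-no (suc i ≟ 0) (f 0) λ ()) ⟩
  ∑ n (λ j → χ (suc i ≟ suc j) (f (suc j)))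
    ≤⟨ ∑-mono n (λ j _ → χ-mono (suc i ≟ suc j) (i ≟ j) suc-injective ≤-refl) ⟩
  ∑ n (λ j → χ (i ≟ j) (f (suc j)))
    ≤⟨ ∑-χ≡ n (f ∘ suc) i ⟩
  f (suc i) ∎
  where open ≤-Reasoning

-- Division with remainder.

infixl 7 _mod_

-- Built from `div`, `*` and `∸`, the operations of the machine, so that `_%ᵗ_` evaluates to it
-- definitionally.
_mod_ : ℕ → ℕ → ℕ
a mod b = a ∸ (a div b) * b

divmod : ∀ a {b} → 0 < b → a ≡ a mod b + (a div b) * b × a mod b < b
divmod a {suc b} _ = trans eq (cong (_+ (a / suc b) * suc b) (sym mod≡%)) , subst (_< suc b) (sym mod≡%) (m%n<n a (suc b))
  where
  eq = m≡m%n+[m/n]*n a (suc b)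
  mod≡% : a mod suc b ≡ a % suc b
  mod≡% = trans (cong (_∸ (a / suc b) * suc b) eq) (m+n∸n≡m (a % suc b) ((a / suc b) * suc b))

div-unique : ∀ {a b r q} → r < b → a ≡ r + q * b → a div b ≡ q
div-unique {a} {b} {r} {q} r<b eq with divmod a {b} (≤-<-trans z≤n r<b)
... | eq′ , r′<b with <-cmp (a div b) q
...   | tri≈ _ e _ = e
...   | tri< l _ _ = ⊥-elim (<-irrefl refl (begin-strict
  a                         ≡⟨ eq′ ⟩
  a mod b + (a div b) * b   <⟨ +-monoˡ-< _ r′<b ⟩
  suc (a div b) * b         ≤⟨ *-monoˡ-≤ b l ⟩
  q * b                     ≤⟨ m≤n+m _ r ⟩
  r + q * b                 ≡⟨ eq ⟨
  a ∎))
  where open ≤-Reasoning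
...   | tri> _ _ l = ⊥-elim (<-irrefl refl (begin-strict
  a                         ≡⟨ eq ⟩
  r + q * b                 <⟨ +-monoˡ-< _ r<b ⟩
  suc q * b                 ≤⟨ *-monoˡ-≤ b l ⟩
  (a div b) * b             ≤⟨ m≤n+m _ (a mod b) ⟩
  a mod b + (a div b) * b   ≡⟨ eq′ ⟨
  a ∎))
  where open ≤-Reasoning

mod-unique : ∀ {a b r q} → r < b → a ≡ r + q * b → a mod b ≡ r
mod-unique {a} {b} {r} {q} r<b eq rewrite div-unique {a} {b} {r} {q} r<b eq | eq = m+n∸n≡m r (q * b)

div<  : ∀ {a b c} → a < c * b → a div b < c
div< {a} {b} {c} a<cb with a div b <? c
... | yes p = p
... | no ¬p = ⊥-elim (<-irrefl refl (begin-strict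
  a                        <⟨ a<cb ⟩
  c * b                    ≤⟨ *-monoˡ-≤ b (≮⇒≥ ¬p) ⟩
  (a div b) * b            ≤⟨ m≤n+m _ (a mod b) ⟩
  a mod b + (a div b) * b  ≡⟨ proj₁ (divmod a 0<b) ⟨
  a ∎))
  where
  open ≤-Reasoning
  pos : ∀ b → a < c * b → 0 < b
  pos zero    l = ⊥-elim (n≮0 (subst (a <_) (*-zeroʳ c) l))
  pos (suc _) _ = z<s
  0<b = pos b a<cb

-- A nearly universal hash family and its collisions.

-- The keys are below U; the cells, below m, are the blocks of length U in
-- a circle of circumference U m.
hash : (U m a x : ℕ) → ℕ
hash U m a x = ((a * x) mod (U * m)) div U

window : (u w c d a : ℕ) → Dec (u ≤ a * d + c × a * d + c < u + w)
window u w c d a = (u ≤? a * d + c) ×-dec (a * d + c <? u + w)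

window-count′ : ∀ u w c d n → ∑ n (λ a → χ (window u w c d a) d) ≤ (n * d + c) ∸ u
window-count′ u w c d zero    = z≤n
window-count′ u w c d (suc n) rewrite ∑-last n (λ a → χ (window u w c d a) d) with window u w c d n
... | no _ rewrite +-identityʳ (∑ n (λ a → χ (window u w c d a) d)) =
  ≤-trans (window-count′ u w c d n) (∸-monoˡ-≤ u (+-monoˡ-≤ c (m≤n+m (n * d) d)))
... | yes (p , _) = begin
  ∑ n (λ a → χ (window u w c d a) d) + d  ≤⟨ +-monoˡ-≤ d (window-count′ u w c d n) ⟩
  (n * d + c) ∸ u + d                     ≡⟨ +-comm _ d ⟩
  d + ((n * d + c) ∸ u)                   ≡⟨ +-∸-assoc d p ⟨
  (d + (n * d + c)) ∸ u                   ≡⟨ cong (_∸ u) (sym (+-assoc d _ c)) ⟩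
  (suc n * d + c) ∸ u ∎
  where open ≤-Reasoning

-- The points `a * d + c` are `d` apart. For the last one in the window, the earlier ones from `u`
-- on weigh at most its distance to `u`, which is below `w`; that point itself adds `d`.
window-count : ∀ u w c d n → ∑ n (λ a → χ (window u w c d a) d) ≤ w + d
window-count u w c d zero    = z≤n
window-count u w c d (suc n) rewrite ∑-last n (λ a → χ (window u w c d a) d) with window u w c d n
... | no _ rewrite +-identityʳ (∑ n (λ a → χ (window u w c d a) d)) = window-count u w c d n
... | yes (p , q) = +-monoˡ-≤ d (begin
  ∑ n (λ a → χ (window u w c d a) d)  ≤⟨ window-count′ u w c d n ⟩
  (n * d + c) ∸ u                     ≤⟨ ∸-monoˡ-≤ u (<⇒≤ q) ⟩
  (u + w) ∸ u                         ≡⟨ m+n∸m≡n u w ⟩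
  w ∎)
  where open ≤-Reasoning

module _ {U m : ℕ} (0<U : 0 < U) (0<m : 0 < m) where

  private
    W : ℕ
    W = U * m

    0<W : 0 < W
    0<W = *-mono-≤ 0<U 0<m

    U≤W : U ≤ W
    U≤W = subst (_≤ W) (*-identityʳ U) (*-monoʳ-≤ U 0<m)

  -- Residues in the same block of length `U` differ by less than `U`, so `a * d` lies within `U` of
  -- a multiple of `W`; adding `U` keeps the window in ℕ. As `a < W`, only the multiples with
  -- `q ≤ d` are possible.
  collision-window : ∀ {a y d} → a < W → hash U m a (y + d) ≡ hash U m a y →
    ∃[ q ] q < suc d × (q * W ≤ a * d + U × a * d + U < q * W + (U + U))
  collision-window {a} {y} {d} a<W eq = q , q≤d , lower , upper
    where
    open ≤-Reasoning
    u  = (a * (y + d)) mod W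
    v  = (a * y) mod W
    q₁ = (a * (y + d)) div W
    q₂ = (a * y) div W
    c  = v div U
    u′ = u mod U
    v′ = v mod U
    eu : a * (y + d) ≡ u + q₁ * W
    eu = proj₁ (divmod (a * (y + d)) 0<W)
    ev : a * y ≡ v + q₂ * W
    ev = proj₁ (divmod (a * y) 0<W)
    eu′ : u ≡ u′ + c * U
    eu′ = trans (proj₁ (divmod u 0<U)) (cong (λ z → u′ + z * U) eq)
    ev′ : v ≡ v′ + c * U
    ev′ = proj₁ (divmod v 0<U)
    u′<U = proj₂ (divmod u 0<U)
    v′<U = proj₂ (divmod v 0<U)
    bal : a * d + (v′ + q₂ * W) ≡ u′ + q₁ * W
    bal = +-cancelʳ-≡ (c * U) _ _ (begin-equality
      a * d + (v′ + q₂ * W) + c * U  ≡⟨ l₁ (a * d) v′ (q₂ * W) (c * U) ⟩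
      a * d + (v′ + c * U + q₂ * W)  ≡⟨ cong (λ z → a * d + (z + q₂ * W)) ev′ ⟨
      a * d + (v + q₂ * W)           ≡⟨ cong (a * d +_) ev ⟨
      a * d + a * y                  ≡⟨ l₂ a d y ⟩
      a * (y + d)                    ≡⟨ eu ⟩
      u + q₁ * W                     ≡⟨ cong (_+ q₁ * W) eu′ ⟩
      u′ + c * U + q₁ * W            ≡⟨ l₃ u′ (c * U) (q₁ * W) ⟩
      u′ + q₁ * W + c * U ∎)
      where
      l₁ : ∀ p q r s → p + (q + r) + s ≡ p + (q + s + r)
      l₁ = solve-∀
      l₂ : ∀ a d y → a * d + a * y ≡ a * (y + d)
      l₂ = solve-∀
      l₃ : ∀ p q r → p + q + r ≡ p + r + q
      l₃ = solve-∀
    q₂≤q₁ : q₂ ≤ q₁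
    q₂≤q₁ = ≮⇒≥ λ q₁<q₂ → <-irrefl refl (begin-strict
      a * d + (v′ + q₂ * W)  ≡⟨ bal ⟩
      u′ + q₁ * W            <⟨ +-monoˡ-< (q₁ * W) u′<U ⟩
      U + q₁ * W             ≤⟨ +-monoˡ-≤ (q₁ * W) U≤W ⟩
      suc q₁ * W             ≤⟨ *-monoˡ-≤ W q₁<q₂ ⟩
      q₂ * W                 ≤⟨ m≤n+m (q₂ * W) v′ ⟩
      v′ + q₂ * W            ≤⟨ m≤n+m _ (a * d) ⟩
      a * d + (v′ + q₂ * W) ∎)
    q = q₁ ∸ q₂
    bal′ : a * d + v′ ≡ u′ + q * W
    bal′ = +-cancelʳ-≡ (q₂ * W) _ _ (begin-equality
      a * d + v′ + q₂ * W          ≡⟨ +-assoc (a * d) v′ _ ⟩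
      a * d + (v′ + q₂ * W)        ≡⟨ bal ⟩
      u′ + q₁ * W                  ≡⟨ cong (λ z → u′ + z * W) (sym (m∸n+n≡m q₂≤q₁)) ⟩
      u′ + (q + q₂) * W            ≡⟨ cong (u′ +_) (*-distribʳ-+ W q q₂) ⟩
      u′ + (q * W + q₂ * W)        ≡⟨ +-assoc u′ _ _ ⟨
      u′ + q * W + q₂ * W ∎)
    lower : q * W ≤ a * d + U
    lower = begin
      q * W        ≤⟨ m≤n+m _ u′ ⟩
      u′ + q * W   ≡⟨ bal′ ⟨
      a * d + v′   ≤⟨ +-monoʳ-≤ (a * d) (<⇒≤ v′<U) ⟩
      a * d + U ∎
    upper : a * d + U < q * W + (U + U)
    upper = begin-strict
      a * d + U         ≤⟨ +-monoˡ-≤ U (m≤m+n (a * d) v′) ⟩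
      a * d + v′ + U    ≡⟨ cong (_+ U) bal′ ⟩
      u′ + q * W + U    <⟨ +-monoˡ-< U (+-monoˡ-< (q * W) u′<U) ⟩
      U + q * W + U     ≡⟨ l U (q * W) ⟩
      q * W + (U + U) ∎
      where
      l : ∀ x y → x + y + x ≡ y + (x + x)
      l = solve-∀
    q≤d : q < suc d
    q≤d = *-cancelʳ-< W q (suc d) (begin-strict
      q * W          ≤⟨ m≤n+m _ u′ ⟩
      u′ + q * W     ≡⟨ bal′ ⟨
      a * d + v′     <⟨ +-monoʳ-< (a * d) (<-≤-trans v′<U U≤W) ⟩
      a * d + W      ≤⟨ +-monoˡ-≤ W (*-monoˡ-≤ d (<⇒≤ a<W)) ⟩
      W * d + W      ≡⟨ l W d ⟩
      suc d * W ∎)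
      where
      l : ∀ w d → w * d + w ≡ suc d * w
      l = solve-∀

  -- There are `d + 1` windows of length `2 * U`, each of weight at most `2 * U + d`, and
  -- `(d + 1) * (2 * U + d) ≤ 2 * d * (3 * U)`. Over the `U * m` multipliers this is a collision
  -- rate of 6/m for every modulus, so no prime has to be found.
  collisions-shift : ∀ y d → 0 < d → d < U →
    ∑ W (λ a → χ (hash U m a (y + d) ≟ hash U m a y) 1) ≤ 6 * U
  collisions-shift y (suc d′) 0<d d<U = *-cancelˡ-≤ d (begin
    d * ∑ W (λ a → χ (hash U m a (y + d) ≟ hash U m a y) 1)
      ≡⟨ ∑-* W d _ ⟨
    ∑ W (λ a → d * χ (hash U m a (y + d) ≟ hash U m a y) 1)
      ≡⟨ ∑-cong W (λ a _ → sym (χ-* (hash U m a (y + d) ≟ hash U m a y) d)) ⟩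
    ∑ W (λ a → χ (hash U m a (y + d) ≟ hash U m a y) d)
      ≤⟨ ∑-mono W pointwise ⟩
    ∑ W (λ a → ∑ (suc d) (λ q → χ (window (q * W) (U + U) U d a) d))
      ≡⟨ ∑-swap W (suc d) (λ a q → χ (window (q * W) (U + U) U d a) d) ⟩
    ∑ (suc d) (λ q → ∑ W (λ a → χ (window (q * W) (U + U) U d a) d))
      ≤⟨ ∑-mono (suc d) (λ q _ → window-count (q * W) (U + U) U d W) ⟩
    ∑ (suc d) (λ q → U + U + d)
      ≡⟨ ∑-const (suc d) (U + U + d) ⟩
    suc d * (U + U + d)
      ≤⟨ *-mono-≤ (+-mono-≤ 0<d (≤-refl {d})) (+-monoʳ-≤ (U + U) (<⇒≤ d<U)) ⟩
    (d + d) * (U + U + U)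
      ≡⟨ l d U ⟩
    d * (6 * U) ∎)
    where
    open ≤-Reasoning
    d = suc d′
    l : ∀ d u → (d + d) * (u + u + u) ≡ d * (6 * u)
    l = solve-∀
    pointwise : ∀ a → a < W → χ (hash U m a (y + d) ≟ hash U m a y) d ≤ ∑ (suc d) (λ q → χ (window (q * W) (U + U) U d a) d)
    pointwise a a<W with hash U m a (y + d) ≟ hash U m a y
    ... | no _   = z≤n
    ... | yes eq = let q , q<d , win = collision-window {a} {y} {d} a<W eq in
      ≤-trans (≤-reflexive (sym (χ-yes (window (q * W) (U + U) U d a) d win)))
              (∑-term (λ q → χ (window (q * W) (U + U) U d a) d) q<d)

  collisions : ∀ {x y} → x < U → y < U → x ≢ y →
    ∑ W (λ a → χ (hash U m a x ≟ hash U m a y) 1) ≤ 6 * U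
  collisions {x} {y} x<U y<U x≢y with <-cmp x y
  ... | tri≈ _ e _ = ⊥-elim (x≢y e)
  ... | tri> _ _ y<x = subst (λ z → ∑ W (λ a → χ (hash U m a z ≟ hash U m a y) 1) ≤ 6 * U)
          (m+[n∸m]≡n (<⇒≤ y<x)) (collisions-shift y (x ∸ y) (m<n⇒0<n∸m y<x) (≤-<-trans (m∸n≤m x y) x<U))
  ... | tri< x<y _ _ = ≤-trans
          (∑-mono W λ a _ → χ-mono (hash U m a x ≟ hash U m a y) (hash U m a y ≟ hash U m a x) sym ≤-refl)
          (subst (λ z → ∑ W (λ a → χ (hash U m a z ≟ hash U m a x) 1) ≤ 6 * U)
             (m+[n∸m]≡n (<⇒≤ x<y)) (collisions-shift x (y ∸ x) (m<n⇒0<n∸m x<y) (≤-<-trans (m∸n≤m y x) y<U)))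

  module _ (n : ℕ) (ν key : ℕ → ℕ)
    (key<U : ∀ i → i < n → key i < U)
    (key-inj : ∀ i j → i < n → j < n → ν i ≢ 0 → ν j ≢ 0 → i ≢ j → key i ≢ key j) where

    private
      clash : ∀ a i j → Dec (i ≢ j × hash U m a (key i) ≡ hash U m a (key j))
      clash a i j = ¬? (i ≟ j) ×-dec (hash U m a (key i) ≟ hash U m a (key j))

    collisionWeight : ℕ → ℕ
    collisionWeight a = ∑ n λ i → ∑ n λ j → ν i * ν j * χ (clash a i j) 1

    pairCollisions : ∀ i j → i < n → j < n → ∑ W (λ a → ν i * ν j * χ (clash a i j) 1) ≤ ν i * ν j * (6 * U)
    pairCollisions i j i<n j<n rewrite ∑-* W (ν i * ν j) (λ a → χ (clash a i j) 1) with ν i * ν j ≟ 0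
    -- Keys are distinct on the support only; off the support the pair has weight 0.
    ... | yes e rewrite e = z≤n
    ... | no ≢0 = *-monoʳ-≤ (ν i * ν j) bound
      where
      νi≢0 : ν i ≢ 0
      νi≢0 e = ≢0 (cong (_* ν j) e)
      νj≢0 : ν j ≢ 0
      νj≢0 e = ≢0 (trans (cong (ν i *_) e) (*-zeroʳ (ν i)))
      bound : ∑ W (λ a → χ (clash a i j) 1) ≤ 6 * U
      bound with i ≟ j
      ... | yes _  = ≤-trans (≤-reflexive (∑-0 W)) z≤n
      ... | no i≢j = ≤-trans
        (∑-mono W (λ a _ → χ-mono (yes i≢j ×-dec (hash U m a (key i) ≟ hash U m a (key j)))
                                  (hash U m a (key i) ≟ hash U m a (key j)) proj₂ ≤-refl))
        (collisions (key<U i i<n) (key<U j j<n) (key-inj i j i<n j<n νi≢0 νj≢0 i≢j))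

    -- Averaging over all multipliers: each pair contributes its weight product to at most `6 * U`
    -- of the `U * m` functions.
    goodHash : ∃[ a ] a < W × m * collisionWeight a ≤ 6 * (∑ n ν * ∑ n ν)
    goodHash with ∑-average W collisionWeight 0<W
    ... | a , a<W , le = a , a<W , *-cancelˡ-≤ U {{>-nonZero 0<U}} (begin
      U * (m * collisionWeight a)  ≡⟨ *-assoc U m _ ⟨
      W * collisionWeight a        ≤⟨ le ⟩
      ∑ W collisionWeight          ≡⟨ ∑-swap W n _ ⟩
      ∑ n (λ i → ∑ W (λ a → ∑ n (λ j → ν i * ν j * χ (clash a i j) 1)))
        ≡⟨ ∑-cong n (λ i _ → ∑-swap W n _) ⟩
      ∑ n (λ i → ∑ n (λ j → ∑ W (λ a → ν i * ν j * χ (clash a i j) 1)))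
        ≤⟨ ∑-mono n (λ i i<n → ∑-mono n (λ j j<n → pairCollisions i j i<n j<n)) ⟩
      ∑ n (λ i → ∑ n (λ j → ν i * ν j * (6 * U)))
        ≡⟨ ∑-cong n (λ i _ → trans (∑-cong n (λ j _ → l₁ (ν i) (ν j) U)) (∑-* n (ν i * (6 * U)) ν)) ⟩
      ∑ n (λ i → ν i * (6 * U) * ∑ n ν)
        ≡⟨ trans (∑-cong n (λ i _ → l₂ (ν i) U (∑ n ν))) (∑-* n (6 * U * ∑ n ν) ν) ⟩
      6 * U * ∑ n ν * ∑ n ν
        ≡⟨ l₃ U (∑ n ν) ⟩
      U * (6 * (∑ n ν * ∑ n ν)) ∎)
      where
      open ≤-Reasoning
      l₁ : ∀ x y u → x * y * (6 * u) ≡ x * (6 * u) * y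
      l₁ = solve-∀
      l₂ : ∀ x u s → x * (6 * u) * s ≡ 6 * u * s * x
      l₂ = solve-∀
      l₃ : ∀ u s → 6 * u * s * s ≡ u * (6 * (s * s))
      l₃ = solve-∀

    -- A cell of load above r ≥ ν i contains another item besides i.
    overload≤collisions : ∀ r a → (∀ i → i < n → ν i ≤ r) →
      ∑ n (λ i → χ (r <? ∑ n (λ j → χ (hash U m a (key i) ≟ hash U m a (key j)) (ν j))) (ν i)) ≤ collisionWeight a
    overload≤collisions r a ν≤r = ∑-mono n λ i i<n → lem i i<n
      where
      open ≤-Reasoning
      lem : ∀ i → i < n → χ (r <? ∑ n (λ j → χ (hash U m a (key i) ≟ hash U m a (key j)) (ν j))) (ν i)
                        ≤ ∑ n (λ j → ν i * ν j * χ (clash a i j) 1)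
      lem i i<n with r <? ∑ n (λ j → χ (hash U m a (key i) ≟ hash U m a (key j)) (ν j))
      ... | no _ = z≤n
      ... | yes r<l = begin
        ν i                                          ≡⟨ *-identityʳ (ν i) ⟨
        ν i * 1                                      ≤⟨ *-monoʳ-≤ (ν i) others ⟩
        ν i * ∑ n (λ j → χ (clash a i j) (ν j))      ≡⟨ ∑-* n (ν i) _ ⟨
        ∑ n (λ j → ν i * χ (clash a i j) (ν j))
          ≡⟨ ∑-cong n (λ j _ → trans (cong (ν i *_) (χ-* (clash a i j) (ν j))) (sym (*-assoc (ν i) (ν j) _))) ⟩
        ∑ n (λ j → ν i * ν j * χ (clash a i j) 1) ∎
        where
        others : 1 ≤ ∑ n (λ j → χ (clash a i j) (ν j))
        others = +-cancelˡ-≤ r _ _ (begin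
          r + 1  ≡⟨ +-comm r 1 ⟩
          suc r  ≤⟨ r<l ⟩
          ∑ n (λ j → χ (hash U m a (key i) ≟ hash U m a (key j)) (ν j))
            ≤⟨ ∑-mono n (λ j _ → χ-⊎ (hash U m a (key i) ≟ hash U m a (key j)) (i ≟ j) (clash a i j)
                 λ e → case i ≟ j of λ { (yes i≡j) → inj₁ i≡j ; (no i≢j) → inj₂ (i≢j , e) }) ⟩
          ∑ n (λ j → χ (i ≟ j) (ν j) + χ (clash a i j) (ν j))
            ≡⟨ ∑-+ n _ _ ⟩
          ∑ n (λ j → χ (i ≟ j) (ν j)) + ∑ n (λ j → χ (clash a i j) (ν j))
            ≤⟨ +-monoˡ-≤ _ (≤-trans (∑-χ≡ n ν i) (ν≤r i i<n)) ⟩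
          r + ∑ n (λ j → χ (clash a i j) (ν j)) ∎)

-- Decoding a seed into bins.

if0 : ℕ → ℕ → ℕ → ℕ
if0 zero    x y = x
if0 (suc _) x y = y

module Run (N Hc Gb : ℕ) where

  cellOf : (K A y : ℕ) → ℕ
  cellOf K A y = hash N (K * 24) (A mod Hc) y

  -- Vanishes exactly if `pos ≤ c < pos + g`. It is an arithmetic expression because it is also the
  -- branching condition of `symbolStep`.
  outside : (pos g c : ℕ) → ℕ
  outside pos g c = (pos ∸ c) + (suc c ∸ (pos + g))

  -- Reads f symbols, the digits of B in base Gb, for an item of key y. A
  -- symbol (0 , g) puts the next g cells into bin b and moves on to bin
  -- b + 1, (1 , g) skips g cells, and (2 , g) rehashes the items that have
  -- no bin yet with a new hash function, the next digit of A in base Hc.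
  -- What is left in the end goes into the last bin.
  run  : (f pos K A B b y : ℕ) → ℕ
  obey : (f lab g B pos K A b y : ℕ) → ℕ

  run zero    pos K A B b y = b
  run (suc f) pos K A B b y = obey f ((B mod Gb) mod 3) ((B mod Gb) div 3) (B div Gb) pos K A b y

  obey f 0             g B pos K A b y = if0 (outside pos g (cellOf K A y)) b (run f (pos + g) K A B (suc b) y)
  obey f 1             g B pos K A b y = run f (pos + g) K A B b y
  obey f (suc (suc _)) g B pos K A b y = run f 0 (K div 4) (A div Hc) B b y

  run-≥  : ∀ f pos K A B b y → b ≤ run f pos K A B b y
  obey-≥ : ∀ f lab g B pos K A b y → b ≤ obey f lab g B pos K A b y
  run-≥ zero    pos K A B b y = ≤-refl
  run-≥ (suc f) pos K A B b y = obey-≥ f ((B mod Gb) mod 3) ((B mod Gb) div 3) (B div Gb) pos K A b y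
  obey-≥ f 1             g B pos K A b y = run-≥ f _ _ _ _ b y
  obey-≥ f (suc (suc _)) g B pos K A b y = run-≥ f _ _ _ _ b y
  obey-≥ f 0             g B pos K A b y with outside pos g (cellOf K A y)
  ... | zero  = ≤-refl
  ... | suc _ = ≤-trans (n≤1+n b) (run-≥ f _ _ _ _ (suc b) y)

  run-≤  : ∀ f pos K A B b y → run f pos K A B b y ≤ b + f
  obey-≤ : ∀ f lab g B pos K A b y → obey f lab g B pos K A b y ≤ b + suc f
  run-≤ zero    pos K A B b y = ≤-reflexive (sym (+-identityʳ b))
  run-≤ (suc f) pos K A B b y = obey-≤ f ((B mod Gb) mod 3) ((B mod Gb) div 3) (B div Gb) pos K A b y
  obey-≤ f 1             g B pos K A b y = ≤-trans (run-≤ f _ _ _ _ b y) (+-monoʳ-≤ b (n≤1+n f))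
  obey-≤ f (suc (suc _)) g B pos K A b y = ≤-trans (run-≤ f _ _ _ _ b y) (+-monoʳ-≤ b (n≤1+n f))
  obey-≤ f 0             g B pos K A b y with outside pos g (cellOf K A y)
  ... | zero  = m≤m+n b _
  ... | suc _ = ≤-trans (run-≤ f _ _ _ _ (suc b) y) (≤-reflexive (sym (+-suc b f)))

interval : (lo g c : ℕ) → Dec (lo ≤ c × c < lo + g)
interval lo g c = (lo ≤? c) ×-dec (c <? lo + g)

div-digit : ∀ {d b} q → d < b → (d + q * b) div b ≡ q
div-digit {d} q d<b = div-unique {q = q} d<b refl

mod-digit : ∀ {d b} q → d < b → (d + q * b) mod b ≡ d
mod-digit {d} q d<b = mod-unique {q = q} d<b refl

digit-bound : ∀ {d b q e} → d < b → q < b ^ e → d + q * b < b ^ suc e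
digit-bound {d} {b} {q} {e} d<b q<b^e = begin-strict
  d + q * b   <⟨ +-monoˡ-< (q * b) d<b ⟩
  suc q * b   ≤⟨ *-monoˡ-≤ b q<b^e ⟩
  b ^ e * b   ≡⟨ *-comm (b ^ e) b ⟩
  b * b ^ e ∎
  where open ≤-Reasoning

-- Amortised accounting: a fund of `f` symbols at price `c` that covers `c + x` contains one symbol
-- to spend now, and what remains still covers `x`.
spend : ∀ {c x f} → 0 < c → c + x ≤ f * c → ∃[ f′ ] f ≡ suc f′ × x ≤ f′ * c
spend {c} {x} {zero}  0<c h = ⊥-elim (<-irrefl refl (≤-trans 0<c (≤-trans (m≤m+n c x) h)))
spend {c} {x} {suc f} 0<c h = f , refl , +-cancelˡ-≤ c x (f * c) h

-- Existence of a seed with balanced bins.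

module Assign (N Hc G r n : ℕ) (key : ℕ → ℕ) (0<N : 0 < N) (0<r : 0 < r) (2≤G : 2 ≤ G)
  (key<N : ∀ i → i < n → key i < N) where

  Gb : ℕ
  Gb = suc G * 3

  open Run N Hc Gb

  symbol : (lab g : ℕ) → ℕ
  symbol lab g = lab + g * 3

  symbol< : ∀ {lab g} → lab < 3 → g ≤ G → symbol lab g < Gb
  symbol< {lab} {g} l<3 g≤G = begin-strict
    lab + g * 3  <⟨ +-monoˡ-< (g * 3) l<3 ⟩
    suc g * 3    ≤⟨ *-monoˡ-≤ 3 (s≤s g≤G) ⟩
    Gb ∎
    where open ≤-Reasoning

  -- All `n` items are decoded at every stage; those that already have a bin are discounted by
  -- giving them weight 0 in `ν`.
  Balanced : (f pos K A B b : ℕ) (ν : ℕ → ℕ) → Set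
  Balanced f pos K A B b ν = ∀ b′ → ∑ n (λ i → χ (run f pos K A B b (key i) ≟ b′) (ν i)) ≤ r

  outside-in : ∀ {pos g c} → pos ≤ c → c < pos + g → outside pos g c ≡ 0
  outside-in p q = cong₂ _+_ (m≤n⇒m∸n≡0 p) (m≤n⇒m∸n≡0 q)

  outside-0 : ∀ {pos g c} → outside pos g c ≡ 0 → pos ≤ c × c < pos + g
  outside-0 {pos} {g} {c} e = m∸n≡0⇒m≤n (m+n≡0⇒m≡0 (pos ∸ c) e) , m∸n≡0⇒m≤n (m+n≡0⇒n≡0 (pos ∸ c) e)

  module _ {lab g B : ℕ} (l<3 : lab < 3) (g≤G : g ≤ G) where
    readB : (symbol lab g + B * Gb) div Gb ≡ B
    readB = div-digit B (symbol< l<3 g≤G)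
    readLab : ((symbol lab g + B * Gb) mod Gb) mod 3 ≡ lab
    readLab rewrite mod-digit B (symbol< l<3 g≤G) = mod-digit g l<3
    readG : ((symbol lab g + B * Gb) mod Gb) div 3 ≡ g
    readG rewrite mod-digit B (symbol< l<3 g≤G) = div-digit g l<3

  read : ∀ {lab g} f pos K A B b y → lab < 3 → g ≤ G →
    run (suc f) pos K A (symbol lab g + B * Gb) b y ≡ obey f lab g B pos K A b y
  read {lab} {g} f pos K A B b y l<3 g≤G =
    lem (readLab {lab} {g} {B} l<3 g≤G) (readG {lab} {g} {B} l<3 g≤G) (readB {lab} {g} {B} l<3 g≤G)
    where
    lem : ∀ {l l′ g g′ B B′} → l ≡ l′ → g ≡ g′ → B ≡ B′ → obey f l g B pos K A b y ≡ obey f l′ g′ B′ pos K A b y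
    lem refl refl refl = refl

  run-keep : ∀ {g} f pos K A B b y → g ≤ G → run (suc f) pos K A (symbol 0 g + B * Gb) b y ≡
    if0 (outside pos g (cellOf K A y)) b (run f (pos + g) K A B (suc b) y)
  run-keep f pos K A B b y g≤G = read f pos K A B b y (s≤s z≤n) g≤G

  run-skip : ∀ {g} f pos K A B b y → g ≤ G → run (suc f) pos K A (symbol 1 g + B * Gb) b y ≡
    run f (pos + g) K A B b y
  run-skip f pos K A B b y g≤G = read f pos K A B b y (s≤s (s≤s z≤n)) g≤G

  run-next : ∀ f pos K A B b y → run (suc f) pos K A (symbol 2 0 + B * Gb) b y ≡
    run f 0 (K div 4) (A div Hc) B b y
  run-next f pos K A B b y = read f pos K A B b y ≤-refl z≤n

  without : (lo g : ℕ) (c : ℕ → ℕ) (ν : ℕ → ℕ) → ℕ → ℕ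
  without lo g c ν i = χ (¬? (interval lo g (c i))) (ν i)

  -- Decoding goes on from bin `suc b` and bins never decrease, so bin `b` receives this interval
  -- alone. For any other bin the interval counts as weight 0.
  keep : ∀ {f pos K A B b g} ν → g ≤ G →
    ∑ n (λ i → χ (interval pos g (cellOf K A (key i))) (ν i)) ≤ r →
    Balanced f (pos + g) K A B (suc b) (without pos g (cellOf K A ∘ key) ν) →
    Balanced (suc f) pos K A (symbol 0 g + B * Gb) b ν
  keep {f} {pos} {K} {A} {B} {b} {g} ν g≤G load bal b′ with b ≟ b′
  ... | yes refl = ≤-trans (∑-mono n λ i _ → χ-mono (_ ≟ b) (interval pos g (cellOf K A (key i))) (lem i) ≤-refl) load
    where
    lem : ∀ i → run (suc f) pos K A (symbol 0 g + B * Gb) b (key i) ≡ b → pos ≤ cellOf K A (key i) × cellOf K A (key i) < pos + g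
    lem i e rewrite run-keep {g} f pos K A B b (key i) g≤G with outside pos g (cellOf K A (key i)) in eq
    ... | zero  = outside-0 {pos} {g} eq
    ... | suc _ = ⊥-elim (<-irrefl (sym e) (run-≥ f _ _ _ _ (suc b) (key i)))
  ... | no b≢b′ = ≤-trans (∑-mono n λ i _ → lem i) (bal b′)
    where
    lem : ∀ i → χ (run (suc f) pos K A (symbol 0 g + B * Gb) b (key i) ≟ b′) (ν i) ≤
                χ (run f (pos + g) K A B (suc b) (key i) ≟ b′) (without pos g (cellOf K A ∘ key) ν i)
    lem i rewrite run-keep {g} f pos K A B b (key i) g≤G with outside pos g (cellOf K A (key i)) in eq
    ... | zero  = ≤-trans (≤-reflexive (χ-no (b ≟ b′) (ν i) b≢b′)) z≤n
    ... | suc _ = χ-mono (run f (pos + g) K A B (suc b) (key i) ≟ b′) (_ ≟ b′) (λ e → e)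
                    (≤-reflexive (sym (χ-yes (¬? (interval pos g (cellOf K A (key i)))) (ν i)
                       λ (p , q) → case trans (sym eq) (outside-in {pos} {g} p q) of λ ())))

  skip-over : ∀ {f pos K A B b g} ν → g ≤ G →
    Balanced f (pos + g) K A B b ν → Balanced (suc f) pos K A (symbol 1 g + B * Gb) b ν
  skip-over {f} {pos} {K} {A} {B} {b} {g} ν g≤G bal b′ = ≤-trans
    (∑-mono n λ i _ → χ-mono (_ ≟ b′) (_ ≟ b′) (trans (sym (run-skip {g} f pos K A B b (key i) g≤G))) ≤-refl) (bal b′)

  next : ∀ {f pos K A B b} ν →
    Balanced f 0 (K div 4) (A div Hc) B b ν → Balanced (suc f) pos K A (symbol 2 0 + B * Gb) b ν
  next {f} {pos} {K} {A} {B} {b} ν bal b′ = ≤-trans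
    (∑-mono n λ i _ → χ-mono (_ ≟ b′) (_ ≟ b′) (trans (sym (run-next f pos K A B b (key i)))) ≤-refl) (bal b′)

  record Seeds (ρ f pos K b : ℕ) (ν : ℕ → ℕ) : Set where
    constructor seeds
    field
      {A B} : ℕ
      A< : A < Hc ^ ρ
      B< : B < Gb ^ f
      balanced : Balanced f pos K A B b ν

  -- A total of at most `r` fits into one bin. Skipping 0 cells has no effect, which pads the string
  -- to exactly `f` symbols.
  seeds-rest : ∀ ρ f pos K b ν → 0 < Hc → ∑ n ν ≤ r → Seeds ρ f pos K b ν
  seeds-rest ρ zero pos K b ν 0<H le = seeds {A = 0} {0} (m^n>0 Hc {{>-nonZero 0<H}} ρ) z<s λ b′ →
    ≤-trans (∑-mono n λ i _ → χ≤ (b ≟ b′) (ν i)) le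
  seeds-rest ρ (suc f) pos K b ν 0<H le with seeds-rest ρ f (pos + 0) K b ν 0<H le
  ... | seeds A< B< bal = seeds A< (digit-bound {e = f} (symbol< {1} {0} (s≤s (s≤s z≤n)) z≤n) B<) (skip-over {f} ν z≤n bal)

  -- One round, with the hash function a: the cells are cut greedily into
  -- intervals of load ≤ r to be kept, and overloaded single cells to be
  -- skipped. Every symbol costs r G; it is paid for by 2 G for each unit of
  -- weight and r for each cell, where an open interval retains a credit of
  -- G for each unit of its load and r for each of its cells.
  module Round (a K ρ : ℕ) (ν₀ : ℕ → ℕ) (a<Hc : a < Hc)
    (c<m : ∀ i → i < n → hash N (K * 24) a (key i) < K * 24)
    (rest : ∀ f b ν → (∀ i → ν i ≤ ν₀ i) → ∑ n ν ≤ K div 4 → 3 * (K div 4) + 2 * r * ρ ≤ f * r →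
            Seeds ρ f 0 (K div 4) b ν) where

    c : ℕ → ℕ
    c i = hash N (K * 24) a (key i)

    ℓ₀ : ℕ → ℕ
    ℓ₀ x = ∑ n (λ i → χ (x ≟ c i) (ν₀ i))

    -- `Seeds` in the midst of a round: the lowest digit of the hash code is fixed to `a`, and the
    -- scan has reached cell `pos`.
    record Seeds₁ (f pos b : ℕ) (ν : ℕ → ℕ) : Set where
      constructor seeds₁
      field
        {A B} : ℕ
        A< : A < Hc ^ ρ
        B< : B < Gb ^ f
        balanced : Balanced f pos K (a + A * Hc) B b ν

    cell≡ : ∀ A i → cellOf K (a + A * Hc) (key i) ≡ c i
    cell≡ A i = cong (λ z → hash N (K * 24) z (key i)) (mod-digit A a<Hc)

    keep₁ : ∀ {f pos b g} ν → g ≤ G → ∑ n (λ i → χ (interval pos g (c i)) (ν i)) ≤ r →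
      Seeds₁ f (pos + g) (suc b) (without pos g c ν) → Seeds₁ (suc f) pos b ν
    keep₁ {f} {pos} {b} {g} ν g≤G load (seeds₁ {A} A< B< bal) =
      seeds₁ A< (digit-bound {e = f} (symbol< {0} {g} (s≤s z≤n) g≤G) B<)
        (keep {f} {pos} {K} {a + A * Hc} {_} {b} {g} ν g≤G
          (≤-trans (∑-mono n λ i _ → χ-mono (interval pos g (cellOf K (a + A * Hc) (key i))) (interval pos g (c i))
             (subst (λ z → pos ≤ z × z < pos + g) (cell≡ A i)) ≤-refl) load)
          λ b′ → ≤-trans (∑-mono n λ i _ → χ-mono (run f (pos + g) K (a + A * Hc) _ (suc b) (key i) ≟ b′)
             (run f (pos + g) K (a + A * Hc) _ (suc b) (key i) ≟ b′) (λ e → e)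
             (χ-mono (¬? (interval pos g (cellOf K (a + A * Hc) (key i)))) (¬? (interval pos g (c i)))
               (λ ¬i j → ¬i (subst (λ z → pos ≤ z × z < pos + g) (sym (cell≡ A i)) j)) ≤-refl)) (bal b′))

    skip₁ : ∀ {f pos b} ν → Seeds₁ f (pos + 1) b ν → Seeds₁ (suc f) pos b ν
    skip₁ {f} ν (seeds₁ A< B< bal) = seeds₁ A<
      (digit-bound {e = f} (symbol< {1} {1} (s≤s (s≤s z≤n)) (≤-trans (n≤1+n 1) 2≤G)) B<)
      (skip-over {f} ν (≤-trans (n≤1+n 1) 2≤G) bal)

    next₁ : ∀ {f pos b} ν → Seeds ρ f 0 (K div 4) b ν → Seeds₁ (suc f) pos b ν
    next₁ {f} ν (seeds {A} A< B< bal) = seeds₁ A< (digit-bound {e = f} (symbol< {2} {0} ≤-refl z≤n) B<)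
      (next {f} ν (subst (λ z → Balanced f 0 (K div 4) z _ _ ν) (sym (div-digit A a<Hc)) bal))

    heavyRest : ℕ → ℕ
    heavyRest pos = ∑ n (λ i → χ ((pos ≤? c i) ×-dec (r <? ℓ₀ (c i))) (ν₀ i))

    -- The open interval starts at cell `p` and has `g` cells. What is unplaced below `p` lies in
    -- skipped cells; `skipped` adds to it the overloaded cells still ahead, so that the bound
    -- `K div 4` on all overload serves as an invariant.
    record State (p g q : ℕ) (ν : ℕ → ℕ) : Set where
      field
        below   : ∀ i → ν i ≤ ν₀ i
        same    : ∀ i → p + g ≤ c i → ν i ≡ ν₀ i
        load≤q  : ∑ n (λ i → χ (interval p g (c i)) (ν i)) ≤ q
        skipped : ∑ n (λ i → χ (c i <? p) (ν i)) + heavyRest (p + g) ≤ K div 4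

    open State

    after : ℕ → (ℕ → ℕ) → ℕ
    after pos ν = ∑ n (λ i → χ (pos ≤? c i) (ν i))

    without-≤ : ∀ p g ν i → without p g c ν i ≤ ν i
    without-≤ p g ν i = χ≤ (¬? (interval p g (c i))) (ν i)

    closed-state : ∀ {p g q ν} → State p g q ν → State (p + g) 0 0 (without p g c ν)
    closed-state {p} {g} {q} {ν} s = record
      { below   = λ i → ≤-trans (without-≤ p g ν i) (below s i)
      ; same    = λ i le → trans
          (χ-yes (¬? (interval p g (c i))) (ν i) λ (_ , l) → <⇒≱ l (subst (_≤ c i) (+-identityʳ (p + g)) le))
          (same s i (subst (_≤ c i) (+-identityʳ (p + g)) le))
      ; load≤q  = ≤-reflexive (trans (∑-cong n λ i _ → χ-no (interval (p + g) 0 (c i)) _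
          λ (x , y) → <⇒≱ y (subst (_≤ c i) (sym (+-identityʳ (p + g))) x)) (∑-0 n))
      ; skipped = ≤-trans (+-mono-≤ (∑-mono n λ i _ → lem i)
          (≤-reflexive (cong heavyRest (+-identityʳ (p + g))))) (skipped s)
      }
      where
      lem : ∀ i → χ (c i <? p + g) (without p g c ν i) ≤ χ (c i <? p) (ν i)
      lem i with interval p g (c i)
      ... | yes _ = ≤-trans (χ≤ (c i <? p + g) 0) z≤n
      ... | no ¬j = χ-mono (c i <? p + g) (c i <? p) (λ l → ≰⇒> λ p≤c → ¬j (p≤c , l)) ≤-refl

    cellLoad : ℕ → (ℕ → ℕ) → ℕ
    cellLoad x ν = ∑ n (λ i → χ (x ≟ c i) (ν i))

    extended-state : ∀ {p g q ν} → State p g q ν → State p (suc g) (q + cellLoad (p + g) ν) ν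
    extended-state {p} {g} {q} {ν} s = record
      { below   = below s
      ; same    = λ i le → same s i (≤-trans (+-monoʳ-≤ p (n≤1+n g)) le)
      ; load≤q  = ≤-trans
          (∑-mono n λ i _ → χ-⊎ (interval p (suc g) (c i)) (interval p g (c i)) (p + g ≟ c i)
            λ (x , y) → case m≤n⇒m<n∨m≡n (≤-pred (subst (c i <_) (+-suc p g) y)) of λ
              { (inj₁ l) → inj₁ (x , l) ; (inj₂ e) → inj₂ (sym e) })
          (≤-trans (≤-reflexive (∑-+ n _ _)) (+-monoˡ-≤ _ (load≤q s)))
      ; skipped = ≤-trans (+-monoʳ-≤ _ (∑-mono n λ i _ →
          χ-mono ((p + suc g ≤? c i) ×-dec (r <? ℓ₀ (c i))) ((p + g ≤? c i) ×-dec (r <? ℓ₀ (c i)))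
            (λ (x , y) → ≤-trans (+-monoʳ-≤ p (n≤1+n g)) x , y) ≤-refl)) (skipped s)
      }

    skipped-state : ∀ {p ν} → r < ℓ₀ p → State p 0 0 ν → State (p + 1) 0 0 ν
    skipped-state {p} {ν} heavy s = record
      { below   = below s
      ; same    = λ i le → same s i (≤-trans (≤-trans (+-monoʳ-≤ p z≤n) (m≤m+n (p + 1) 0)) le)
      ; load≤q  = ≤-reflexive (trans (∑-cong n λ i _ → χ-no (interval (p + 1) 0 (c i)) _
          λ (x , y) → <⇒≱ y (subst (_≤ c i) (sym (+-identityʳ (p + 1))) x)) (∑-0 n))
      ; skipped = begin
          ∑ n (λ i → χ (c i <? p + 1) (ν i)) + heavyRest (p + 1 + 0)
            ≤⟨ +-monoˡ-≤ _ (∑-mono n λ i _ → χ-⊎ (c i <? p + 1) (c i <? p) (p ≟ c i)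
                 λ l → case m≤n⇒m<n∨m≡n (≤-pred (subst (c i <_) (+-comm p 1) l)) of λ
                   { (inj₁ l) → inj₁ l ; (inj₂ e) → inj₂ (sym e) }) ⟩
          ∑ n (λ i → χ (c i <? p) (ν i) + χ (p ≟ c i) (ν i)) + heavyRest (p + 1 + 0)
            ≡⟨ cong (_+ heavyRest (p + 1 + 0)) (∑-+ n _ _) ⟩
          ∑ n (λ i → χ (c i <? p) (ν i)) + ∑ n (λ i → χ (p ≟ c i) (ν i)) + heavyRest (p + 1 + 0)
            ≡⟨ +-assoc (∑ n (λ i → χ (c i <? p) (ν i))) _ _ ⟩
          ∑ n (λ i → χ (c i <? p) (ν i)) + (∑ n (λ i → χ (p ≟ c i) (ν i)) + heavyRest (p + 1 + 0))
            ≡⟨ cong (∑ n (λ i → χ (c i <? p) (ν i)) +_) (∑-+ n _ _) ⟨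
          ∑ n (λ i → χ (c i <? p) (ν i)) + ∑ n (λ i → χ (p ≟ c i) (ν i) + χ ((p + 1 + 0 ≤? c i) ×-dec (r <? ℓ₀ (c i))) (ν₀ i))
            ≤⟨ +-monoʳ-≤ (∑ n (λ i → χ (c i <? p) (ν i))) (∑-mono n λ i _ → ≤-trans
                 (+-monoˡ-≤ _ (χ-mono (p ≟ c i) (p ≟ c i) (λ e → e) (below s i)))
                 (χ-disjoint (p ≟ c i) ((p + 1 + 0 ≤? c i) ×-dec (r <? ℓ₀ (c i))) ((p + 0 ≤? c i) ×-dec (r <? ℓ₀ (c i)))
                   (λ e → ≤-reflexive (trans (+-identityʳ p) e) , subst (λ z → r < ℓ₀ z) e heavy)
                   (λ (x , y) → ≤-trans (≤-trans (+-monoʳ-≤ p z≤n) (m≤m+n (p + 1) 0)) x , y)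
                   (λ e (x , _) → <⇒≱ (subst (_< p + 1 + 0) e (subst (p <_) (sym (+-identityʳ (p + 1))) (subst (p <_) (+-comm 1 p) ≤-refl))) x))) ⟩
          ∑ n (λ i → χ (c i <? p) (ν i)) + heavyRest (p + 0)
            ≤⟨ skipped s ⟩
          K div 4 ∎
      }
      where open ≤-Reasoning

    after-split : ∀ pos ν → cellLoad pos ν + after (pos + 1) ν ≤ after pos ν
    after-split pos ν = ≤-trans (≤-reflexive (sym (∑-+ n _ _))) (∑-mono n λ i _ →
      χ-disjoint (pos ≟ c i) (pos + 1 ≤? c i) (pos ≤? c i) ≤-reflexive (≤-trans (m≤m+n pos 1))
        λ e l → <⇒≱ (subst (_< pos + 1) e (subst (pos <_) (+-comm 1 pos) ≤-refl)) l)

    after-without : ∀ pos p g ν → after pos (without p g c ν) ≤ after pos ν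
    after-without pos p g ν = ∑-mono n λ i _ → χ-mono (pos ≤? c i) (pos ≤? c i) (λ e → e) (without-≤ p g ν i)

    -- Reserved for the end of the round: `2 * (r * G)` buys the last interval and the rehashing
    -- symbol; the rest is the budget of the next round, scaled by `G` since a symbol costs `r`
    -- there and `r * G` here.
    E : ℕ
    E = 2 * (r * G) + G * (3 * (K div 4) + 2 * r * ρ)

    needed : (p g q : ℕ) (ν : ℕ → ℕ) (left : ℕ) → ℕ
    needed p g q ν left = 2 * G * after (p + g) ν + r * left + (q * G + r * g) + E

    private
      0<rG : 0 < r * G
      0<rG = *-mono-≤ 0<r (≤-trans (n≤1+n 1) 2≤G)

    -- A unit of weight pays `G` twice: once for closing the interval before its cell and once as
    -- credit of the interval that contains it.
    greedy : ∀ left f p g q b ν → p + g + left ≡ K * 24 → g < G → q ≤ r → State p g q ν →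
      needed p g q ν left ≤ f * (r * G) → Seeds₁ f p b ν

    finish : ∀ f p g q b ν → p + g ≡ K * 24 → g < G → q ≤ r → State p g q ν →
      E ≤ f * (r * G) → Seeds₁ f p b ν
    finish f p g q b ν end g<G q≤r s cnt
      with spend {f = f} 0<rG (≤-trans (≤-reflexive (l (r * G) _)) cnt)
      where
      l : ∀ x y → x + (x + y) ≡ 2 * x + y
      l = solve-∀
    ... | f₁ , refl , cnt₁ with spend {f = f₁} 0<rG cnt₁
    ...   | f₂ , refl , cnt₂ = keep₁ {suc f₂} ν (<⇒≤ g<G) (≤-trans (load≤q s) q≤r)
      (next₁ {f₂} _ (rest f₂ (suc b) _ (λ i → ≤-trans (without-≤ p g ν i) (below s i))
        (≤-trans (∑-mono n λ i i<n → small i i<n) (≤-trans (m≤m+n _ _) (skipped s)))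
        (*-cancelˡ-≤ G {{>-nonZero (≤-trans (n≤1+n 1) 2≤G)}} (≤-trans cnt₂ (≤-reflexive (l f₂ r G))))))
      where
      l : ∀ f r g → f * (r * g) ≡ g * (f * r)
      l = solve-∀
      small : ∀ i → i < n → without p g c ν i ≤ χ (c i <? p) (ν i)
      small i i<n with interval p g (c i)
      ... | yes _ = z≤n
      ... | no ¬j = ≤-reflexive (sym (χ-yes (c i <? p) (ν i) (≰⇒> λ p≤c → ¬j (p≤c , subst (c i <_) (sym end) (c<m i i<n)))))

    greedy zero f p g q b ν end g<G q≤r s cnt =
      finish f p g q b ν (trans (sym (+-identityʳ (p + g))) end) g<G q≤r s (≤-trans (m≤n+m E (2 * G * after (p + g) ν + r * 0 + (q * G + r * g))) cnt)
    greedy (suc left) f p g q b ν end g<G q≤r s cnt = go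
      where
      open ≤-Reasoning
      x   = p + g
      ℓ   = cellLoad x ν
      end′ : x + 1 + left ≡ K * 24
      end′ = trans (trans (+-assoc x 1 left) refl) end
      end″ : p + suc g + left ≡ K * 24
      end″ = trans (cong (_+ left) (trans (+-suc p g) (+-comm 1 x))) end′
      rest-cnt = after (x + 1) ν
      cnt′ : 2 * G * (ℓ + rest-cnt) + r * suc left + (q * G + r * g) + E ≤ f * (r * G)
      cnt′ = ≤-trans (+-monoˡ-≤ E (+-monoˡ-≤ _ (+-monoˡ-≤ _ (*-monoʳ-≤ (2 * G) (after-split x ν))))) cnt
      ℓ≤ℓ₀ : ℓ ≤ ℓ₀ x
      ℓ≤ℓ₀ = ∑-mono n λ i _ → χ-mono (x ≟ c i) (x ≟ c i) (λ e → e) (below s i)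

      -- Two symbols, one to close the interval and one to skip the cell. The cell is still
      -- untouched, so its load is at least `r` and its payment `2 * G * ℓ` covers both.
      heavy-case : r < ℓ₀ x → Seeds₁ f p b ν
      heavy-case h with spend {x = r * G + (2 * G * rest-cnt + r * left + E)} {f = f} 0<rG (≤-trans le cnt′)
        where
        r<ℓ : r ≤ ℓ
        r<ℓ = ≤-trans (<⇒≤ h) (∑-mono n λ i _ → lem i)
          where
          lem : ∀ i → χ (x ≟ c i) (ν₀ i) ≤ χ (x ≟ c i) (ν i)
          lem i with x ≟ c i
          ... | yes e = ≤-reflexive (sym (same s i (≤-reflexive e)))
          ... | no _  = z≤n
        l₁ : ∀ r G a left E → r * G + (r * G + (2 * G * a + r * left + E)) ≡ 2 * G * (r + a) + r * left + E
        l₁ = solve-∀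
        le : r * G + (r * G + (2 * G * rest-cnt + r * left + E)) ≤ 2 * G * (ℓ + rest-cnt) + r * suc left + (q * G + r * g) + E
        le = begin
          r * G + (r * G + (2 * G * rest-cnt + r * left + E)) ≡⟨ l₁ r G rest-cnt left E ⟩
          2 * G * (r + rest-cnt) + r * left + E
            ≤⟨ +-monoˡ-≤ E (≤-trans (+-mono-≤ (*-monoʳ-≤ (2 * G) (+-monoˡ-≤ rest-cnt r<ℓ)) (*-monoʳ-≤ r (n≤1+n left))) (m≤m+n _ _)) ⟩
          2 * G * (ℓ + rest-cnt) + r * suc left + (q * G + r * g) + E ∎
      ... | f₁ , refl , cnt₁ with spend {f = f₁} 0<rG cnt₁
      ...   | f₂ , refl , cnt₂ = keep₁ {suc f₂} ν (<⇒≤ g<G) (≤-trans (load≤q s) q≤r)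
        (skip₁ {f₂} _ (greedy left f₂ (x + 1) 0 0 (suc b) _ (trans (cong (_+ left) (+-identityʳ (x + 1))) end′)
          (≤-trans (s≤s z≤n) 2≤G) z≤n (skipped-state h (closed-state s))
          (≤-trans (begin
            2 * G * after (x + 1 + 0) (without p g c ν) + r * left + (0 * G + r * 0) + E
              ≡⟨ cong₂ (λ u v → 2 * G * after u (without p g c ν) + r * left + v + E) (+-identityʳ (x + 1)) (*-zeroʳ r) ⟩
            2 * G * after (x + 1) (without p g c ν) + r * left + 0 + E
              ≡⟨ cong (_+ E) (+-identityʳ (2 * G * after (x + 1) (without p g c ν) + r * left)) ⟩
            2 * G * after (x + 1) (without p g c ν) + r * left + E
              ≤⟨ +-monoˡ-≤ E (+-monoˡ-≤ (r * left) (*-monoʳ-≤ (2 * G) (after-without (x + 1) p g ν))) ⟩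
            2 * G * rest-cnt + r * left + E ∎) cnt₂)))

      extend : q + ℓ ≤ r → suc g < G → Seeds₁ f p b ν
      extend q′≤r sg<G = greedy left f p (suc g) (q + ℓ) b ν end″ sg<G q′≤r (extended-state s) (≤-trans (begin
          2 * G * after (p + suc g) ν + r * left + ((q + ℓ) * G + r * suc g) + E
            ≡⟨ cong (λ z → 2 * G * after z ν + r * left + ((q + ℓ) * G + r * suc g) + E) (trans (+-suc p g) (+-comm 1 x)) ⟩
          2 * G * rest-cnt + r * left + ((q + ℓ) * G + r * suc g) + E
            ≤⟨ m≤m+n _ (G * ℓ) ⟩
          2 * G * rest-cnt + r * left + ((q + ℓ) * G + r * suc g) + E + G * ℓ
            ≡⟨ l₁ G rest-cnt r left q ℓ g E ⟩
          2 * G * (ℓ + rest-cnt) + r * suc left + (q * G + r * g) + E ∎) cnt′)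
        where
        l₁ : ∀ G a r left q ℓ g E → 2 * G * a + r * left + ((q + ℓ) * G + r * suc g) + E + G * ℓ
             ≡ 2 * G * (ℓ + a) + r * suc left + (q * G + r * g) + E
        l₁ = solve-∀

      -- The interval has reached the maximal length, and its `G` cells at `r` each pay for the
      -- symbol.
      fill : q + ℓ ≤ r → suc g ≡ G → Seeds₁ f p b ν
      fill q′≤r sg≡G = continue (spend {x = 2 * G * rest-cnt + r * left + E} {f = f} 0<rG (≤-trans le cnt′))
        where
        l₁ : ∀ G a r left q ℓ g E → r * suc g + (2 * G * a + r * left + E) + (2 * G * ℓ + q * G) ≡ 2 * G * (ℓ + a) + r * suc left + (q * G + r * g) + E
        l₁ = solve-∀
        le : r * G + (2 * G * rest-cnt + r * left + E) ≤ 2 * G * (ℓ + rest-cnt) + r * suc left + (q * G + r * g) + E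
        le = begin
          r * G + (2 * G * rest-cnt + r * left + E) ≡⟨ cong (λ z → r * z + (2 * G * rest-cnt + r * left + E)) (sym sg≡G) ⟩
          r * suc g + (2 * G * rest-cnt + r * left + E) ≤⟨ m≤m+n _ (2 * G * ℓ + q * G) ⟩
          r * suc g + (2 * G * rest-cnt + r * left + E) + (2 * G * ℓ + q * G) ≡⟨ l₁ G rest-cnt r left q ℓ g E ⟩
          2 * G * (ℓ + rest-cnt) + r * suc left + (q * G + r * g) + E ∎
        continue : ∃[ f′ ] f ≡ suc f′ × 2 * G * rest-cnt + r * left + E ≤ f′ * (r * G) → Seeds₁ f p b ν
        continue (f₁ , f≡ , cnt₁) = subst (λ f → Seeds₁ f p b ν) (sym f≡) (keep₁ {f₁} ν g<G (≤-trans (load≤q (extended-state s)) q′≤r)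
          (greedy left f₁ (p + suc g) 0 0 (suc b) _ (trans (cong (_+ left) (+-identityʳ (p + suc g))) end″) (≤-trans (s≤s z≤n) 2≤G) z≤n
            (closed-state (extended-state s))
            (≤-trans (begin
              2 * G * after (p + suc g + 0) (without p (suc g) c ν) + r * left + (0 * G + r * 0) + E
                ≡⟨ cong₂ (λ u v → 2 * G * after u (without p (suc g) c ν) + r * left + v + E)
                     (trans (+-identityʳ (p + suc g)) (trans (+-suc p g) (+-comm 1 x))) (*-zeroʳ r) ⟩
              2 * G * after (x + 1) (without p (suc g) c ν) + r * left + 0 + E
                ≡⟨ cong (_+ E) (+-identityʳ (2 * G * after (x + 1) (without p (suc g) c ν) + r * left)) ⟩
              2 * G * after (x + 1) (without p (suc g) c ν) + r * left + E
                ≤⟨ +-monoˡ-≤ E (+-monoˡ-≤ (r * left) (*-monoʳ-≤ (2 * G) (after-without (x + 1) p (suc g) ν))) ⟩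
              2 * G * rest-cnt + r * left + E ∎) cnt₁)))

      extend-case : q + ℓ ≤ r → Seeds₁ f p b ν
      extend-case q′≤r = case m≤n⇒m<n∨m≡n g<G of λ { (inj₁ sg<G) → extend q′≤r sg<G ; (inj₂ sg≡G) → fill q′≤r sg≡G }

      -- Since `r < q + ℓ`, the symbol is paid by the credit `q * G` and half of the payment
      -- `2 * G * ℓ` of the new cell; the other half becomes the credit of the interval that opens
      -- with this cell.
      close-case : ℓ₀ x ≤ r → r < q + ℓ → Seeds₁ f p b ν
      close-case light h = continue (spend {x = 2 * G * rest-cnt + r * left + (ℓ * G + r * 1) + E} {f = f} 0<rG (≤-trans le cnt′))
        where
        l₁ : ∀ G a r left q ℓ g E → (q + ℓ) * G + (2 * G * a + r * left + (ℓ * G + r * 1) + E) + r * g ≡ 2 * G * (ℓ + a) + r * suc left + (q * G + r * g) + E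
        l₁ = solve-∀
        le : r * G + (2 * G * rest-cnt + r * left + (ℓ * G + r * 1) + E) ≤ 2 * G * (ℓ + rest-cnt) + r * suc left + (q * G + r * g) + E
        le = begin
          r * G + (2 * G * rest-cnt + r * left + (ℓ * G + r * 1) + E) ≤⟨ +-monoˡ-≤ _ (*-monoˡ-≤ G (<⇒≤ h)) ⟩
          (q + ℓ) * G + (2 * G * rest-cnt + r * left + (ℓ * G + r * 1) + E) ≤⟨ m≤m+n _ (r * g) ⟩
          (q + ℓ) * G + (2 * G * rest-cnt + r * left + (ℓ * G + r * 1) + E) + r * g ≡⟨ l₁ G rest-cnt r left q ℓ g E ⟩
          2 * G * (ℓ + rest-cnt) + r * suc left + (q * G + r * g) + E ∎
        s′ = extended-state (closed-state s)
        x≡ : x + 0 ≡ x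
        x≡ = +-identityʳ x
        open-state : State x 1 ℓ (without p g c ν)
        open-state = record
          { below = below s′ ; same = same s′ ; skipped = skipped s′
          ; load≤q = ≤-trans (load≤q s′) (∑-mono n λ i _ →
              ≤-trans (χ-mono (x + 0 ≟ c i) (x ≟ c i) (trans (sym x≡)) (without-≤ p g ν i)) ≤-refl) }
        continue : ∃[ f′ ] f ≡ suc f′ × 2 * G * rest-cnt + r * left + (ℓ * G + r * 1) + E ≤ f′ * (r * G) → Seeds₁ f p b ν
        continue (f₁ , f≡ , cnt₁) = subst (λ f → Seeds₁ f p b ν) (sym f≡) (keep₁ {f₁} ν (<⇒≤ g<G) (≤-trans (load≤q s) q≤r)
          (greedy left f₁ x 1 ℓ (suc b) _ end′ 2≤G (≤-trans ℓ≤ℓ₀ light) open-state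
            (≤-trans (+-monoˡ-≤ E (+-monoˡ-≤ _ (+-monoˡ-≤ (r * left) (*-monoʳ-≤ (2 * G) (after-without (x + 1) p g ν))))) cnt₁)))

      go : Seeds₁ f p b ν
      go with r <? ℓ₀ x
      ... | yes h = heavy-case h
      ... | no ¬h with q + ℓ ≤? r
      ...   | yes le = extend-case le
      ...   | no ¬le = close-case (≮⇒≥ ¬h) (≰⇒> ¬le)

  KeysDistinct : (ℕ → ℕ) → Set
  KeysDistinct ν = ∀ i j → i < n → j < n → ν i ≢ 0 → ν j ≢ 0 → i ≢ j → key i ≢ key j

  -- Induction on the rounds left. As `K` shrinks by 4 each time, `K ≤ 4 ^ ρ * r` guarantees that
  -- with no round left everything fits into one bin.
  balancedSeeds : ∀ ρ f K b ν → 96 * r ≡ G → N * (K * 24) ≤ Hc → 0 < Hc → (∀ i → i < n → ν i ≤ r) → KeysDistinct ν →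
    ∑ n ν ≤ K → K ≤ 4 ^ ρ * r → 3 * K + 2 * r * ρ ≤ f * r → Seeds ρ f 0 K b ν
  balancedSeeds ρ f K b ν eqG Hc≥ 0<Hc ν≤r dist ∑≤K K≤ cnt with K ≤? r
  ... | yes K≤r = seeds-rest ρ f 0 K b ν 0<Hc (≤-trans ∑≤K K≤r)
  balancedSeeds zero f K b ν eqG Hc≥ 0<Hc ν≤r dist ∑≤K K≤ cnt | no K≰r =
    ⊥-elim (K≰r (≤-trans K≤ (≤-reflexive (+-identityʳ r))))
  balancedSeeds (suc ρ) f K b ν eqG Hc≥ 0<Hc ν≤r dist ∑≤K K≤ cnt | no K≰r = conclude (greedy (K * 24) f 0 0 0 b ν refl (≤-trans (s≤s z≤n) 2≤G) z≤n initial cnt′)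
    where
    open ≤-Reasoning
    0<K : 0 < K
    0<K = ≤-trans (s≤s z≤n) (≰⇒> K≰r)
    0<m : 0 < K * 24
    0<m = *-mono-≤ 0<K (s≤s {0} {23} z≤n)
    K′ = K div 4
    4K′≤K : 4 * K′ ≤ K
    4K′≤K = begin
      4 * K′          ≡⟨ *-comm 4 K′ ⟩
      K′ * 4          ≤⟨ m≤n+m _ (K mod 4) ⟩
      K mod 4 + K′ * 4 ≡⟨ proj₁ (divmod K {4} z<s) ⟨
      K ∎
    K′≤K : K′ ≤ K
    K′≤K = ≤-trans (m≤m+n K′ (3 * K′)) 4K′≤K
    gh = goodHash 0<N 0<m n ν key key<N dist
    a = proj₁ gh
    W = N * (K * 24)
    a<W : a < W
    a<W = proj₁ (proj₂ gh)
    cw = collisionWeight 0<N 0<m n ν key key<N dist a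
    cw-small : K * 24 * cw ≤ 6 * (∑ n ν * ∑ n ν)
    cw-small = proj₂ (proj₂ gh)
    -- The reason for 24 cells per unit of `K`: `24 * K * cw ≤ 6 * K * K` means `4 * cw ≤ K`.
    cw≤K′ : cw ≤ K′
    cw≤K′ = ≤-pred (*-cancelʳ-< 4 cw (suc K′) (begin-strict
      cw * 4                ≤⟨ *-cancelˡ-≤ (6 * K) {{>-nonZero (*-mono-≤ {1} {6} (s≤s z≤n) 0<K)}} (begin
        6 * K * (cw * 4)      ≡⟨ l K cw ⟩
        K * 24 * cw           ≤⟨ cw-small ⟩
        6 * (∑ n ν * ∑ n ν)   ≤⟨ *-monoʳ-≤ 6 (*-mono-≤ ∑≤K ∑≤K) ⟩
        6 * (K * K)           ≡⟨ *-assoc 6 K K ⟨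
        6 * K * K ∎) ⟩
      K                     ≡⟨ proj₁ (divmod K {4} z<s) ⟩
      K mod 4 + K′ * 4      <⟨ +-monoˡ-< (K′ * 4) (proj₂ (divmod K {4} z<s)) ⟩
      suc K′ * 4 ∎))
      where
      l : ∀ k c → 6 * k * (c * 4) ≡ k * 24 * c
      l = solve-∀
    c<m : ∀ i → i < n → hash N (K * 24) a (key i) < K * 24
    c<m i i<n = div< (≤-trans (proj₂ (divmod (a * key i) (*-mono-≤ 0<N 0<m))) (≤-reflexive (*-comm N (K * 24))))
    open Round a K ρ ν (≤-trans a<W Hc≥) c<m
      (λ f′ b′ ν′ le ∑≤ cnt → balancedSeeds ρ f′ K′ b′ ν′ eqG
        (≤-trans (*-monoʳ-≤ N (*-monoˡ-≤ 24 K′≤K)) Hc≥) 0<Hc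
        (λ i i<n → ≤-trans (le i) (ν≤r i i<n))
        (λ i j i<n j<n ≢i ≢j → dist i j i<n j<n
          (λ e → ≢i (n≤0⇒n≡0 (subst (ν′ i ≤_) e (le i)))) (λ e → ≢j (n≤0⇒n≡0 (subst (ν′ j ≤_) e (le j)))))
        ∑≤
        (*-cancelˡ-≤ 4 (≤-trans 4K′≤K (≤-trans K≤ (≤-reflexive (*-assoc 4 (4 ^ ρ) r)))))
        cnt)
    initial : State 0 0 0 ν
    initial = record
      { below = λ _ → ≤-refl ; same = λ _ _ → refl
      ; load≤q = ≤-reflexive (trans (∑-cong n λ i _ → χ-no (interval 0 0 (c i)) (ν i) λ ()) (∑-0 n))
      ; skipped = begin
          ∑ n (λ i → χ (c i <? 0) (ν i)) + heavyRest 0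
            ≡⟨ cong (_+ heavyRest 0) (trans (∑-cong n λ i _ → χ-no (c i <? 0) (ν i) λ ()) (∑-0 n)) ⟩
          heavyRest 0
            ≤⟨ ∑-mono n (λ i _ → χ-mono ((0 ≤? c i) ×-dec (r <? ℓ₀ (c i))) (r <? ℓ₀ (c i)) proj₂ ≤-refl) ⟩
          ∑ n (λ i → χ (r <? ℓ₀ (c i)) (ν i))
            ≤⟨ overload≤collisions 0<N 0<m n ν key key<N dist r a ν≤r ⟩
          cw
            ≤⟨ cw≤K′ ⟩
          K′ ∎
      }
    -- Per unit of `G * K`, the weight costs 2, the cells 1/4 because `r * 24` is a quarter of `G`,
    -- and the later rounds 3/4; the sum is the 3 of the hypothesis. Multiplying by 4 avoids the
    -- fractions.
    cnt′ : needed 0 0 0 ν (K * 24) ≤ f * (r * G)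
    cnt′ = begin
      2 * G * after 0 ν + r * (K * 24) + (0 + r * 0) + E
        ≤⟨ +-monoˡ-≤ E (+-mono-≤ (+-monoˡ-≤ _ (*-monoʳ-≤ (2 * G) (≤-trans (∑-mono n λ i _ → χ≤ (0 ≤? c i) (ν i)) ∑≤K)))
             (≤-reflexive (*-zeroʳ r))) ⟩
      2 * G * K + r * (K * 24) + 0 + (2 * (r * G) + G * (3 * K′ + 2 * r * ρ))
        ≤⟨ *-cancelˡ-≤ 4 (begin
             4 * (2 * G * K + r * (K * 24) + 0 + (2 * (r * G) + G * (3 * K′ + 2 * r * ρ)))
               ≡⟨ l₁ G K K′ r ρ ⟩
             8 * (G * K) + 96 * r * K + 3 * G * (4 * K′) + 4 * (G * (2 * r * suc ρ))
               ≡⟨ cong (λ z → 8 * (G * K) + z * K + 3 * G * (4 * K′) + 4 * (G * (2 * r * suc ρ))) eqG ⟩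
             8 * (G * K) + G * K + 3 * G * (4 * K′) + 4 * (G * (2 * r * suc ρ))
               ≤⟨ +-monoˡ-≤ _ (+-monoʳ-≤ (8 * (G * K) + G * K) (*-monoʳ-≤ (3 * G) 4K′≤K)) ⟩
             8 * (G * K) + G * K + 3 * G * K + 4 * (G * (2 * r * suc ρ))
               ≡⟨ l₂ G K r ρ ⟩
             4 * (G * (3 * K + 2 * r * suc ρ)) ∎) ⟩
      G * (3 * K + 2 * r * suc ρ)
        ≤⟨ *-monoʳ-≤ G cnt ⟩
      G * (f * r)
        ≡⟨ l₃ G f r ⟩
      f * (r * G) ∎
      where
      l₁ : ∀ G K K′ r ρ → 4 * (2 * G * K + r * (K * 24) + 0 + (2 * (r * G) + G * (3 * K′ + 2 * r * ρ)))
           ≡ 8 * (G * K) + 96 * r * K + 3 * G * (4 * K′) + 4 * (G * (2 * r * suc ρ))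
      l₁ = solve-∀
      l₂ : ∀ G K r ρ → 8 * (G * K) + G * K + 3 * G * K + 4 * (G * (2 * r * suc ρ)) ≡ 4 * (G * (3 * K + 2 * r * suc ρ))
      l₂ = solve-∀
      l₃ : ∀ G f r → G * (f * r) ≡ f * (r * G)
      l₃ = solve-∀
    conclude : Seeds₁ f 0 b ν → Seeds (suc ρ) f 0 K b ν
    conclude (seeds₁ A< B< bal) = seeds (digit-bound {e = ρ} (≤-trans a<W Hc≥) A<) B< bal

-- Monomials, weights and positivity of coefficients.

at : ∀ {n} → Vec ℕ n → ℕ → ℕ
at []       _       = 0
at (x ∷ _)  zero    = x
at (_ ∷ xs) (suc i) = at xs i

∑-at : ∀ {n} (μ : Vec ℕ n) → ∑ n (at μ) ≡ sum μ
∑-at []      = refl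
∑-at (x ∷ μ) = cong (_+_ x) (∑-at μ)

All-at : ∀ {n r} {μ : Vec ℕ n} → All (_≤ r) μ → ∀ i → at μ i ≤ r
All-at []       i       = z≤n
All-at (p ∷ ps) zero    = p
All-at (p ∷ ps) (suc i) = All-at ps i

at-All : ∀ {n r} {μ : Vec ℕ n} → (∀ i → i < n → at μ i ≤ r) → All (_≤ r) μ
at-All {μ = []}    h = []
at-All {μ = x ∷ μ} h = h 0 z<s ∷ at-All λ i i<n → h (suc i) (s<s i<n)

weight : ∀ {n} → Monomial n → (ℕ → ℕ) → ℕ
weight {n} μ v = ∑ n λ i → at μ i * v i

weight-var : ∀ {n} (i : Fin n) v → weight (replicate n 0 [ i ]≔ 1) v ≡ v (toℕ i)
weight-var {suc n} Fin.zero v = trans (cong (v 0 + 0 +_) (zeros n (v ∘ suc))) (trans (+-identityʳ _) (+-identityʳ (v 0)))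
  where
  zeros : ∀ n v → weight (replicate n 0) v ≡ 0
  zeros zero    v = refl
  zeros (suc n) v = zeros n (v ∘ suc)
weight-var {suc n} (Fin.suc i) v = weight-var i (v ∘ suc)

weight-* : ∀ {n} (μ ν : Monomial n) v → weight (zipWith _+_ μ ν) v ≡ weight μ v + weight ν v
weight-* []      []      v = refl
weight-* (x ∷ μ) (y ∷ ν) v rewrite weight-* μ ν (v ∘ suc) = l x y (v 0) _ _
  where
  l : ∀ x y v a b → (x + y) * v + (a + b) ≡ x * v + a + (y * v + b)
  l = solve-∀

Occurs : ∀ {n} → Poly n → Monomial n → Set
Occurs f μ = ∃[ a ] (a , μ) ∈ f

PositiveTerm : ∀ {n} → ℤ × Monomial n → Set
PositiveTerm (a , _) = ∃[ m ] a ≡ ℤ.+ suc m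

Positive : ∀ {n} → Poly n → Set
Positive f = ∀ {t} → t ∈ f → PositiveTerm t

-- Here non-cancellation enters: positive terms only add up, so a nonzero coefficient is the same as
-- an occurrence in the unnormalised list, and sets of weights can be computed term by term.
coeff-positive : ∀ {n} (f : Poly n) → Positive f → ∀ μ →
  ∃[ c ] coeff f μ ≡ ℤ.+ c × (Occurs f μ → c ≢ 0) × (c ≢ 0 → Occurs f μ)
coeff-positive []            pos μ = 0 , refl , (λ ()) , λ h → ⊥-elim (h refl)
coeff-positive ((a , ν) ∷ f) pos μ with coeff-positive f (pos ∘ there) μ | pos (here refl) | ≡-dec _≟_ ν μ
... | c , e , occ , nz | m , refl | yes refl rewrite e = suc m + c , refl , (λ _ ()) , λ _ → _ , here refl
... | c , e , occ , nz | m , refl | no ν≢μ = c , e ,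
  (λ { (_ , here refl) → ⊥-elim (ν≢μ refl) ; (_ , there p) → occ (_ , p) }) , λ h → let a , p = nz h in a , there p

coeff≢0 : ∀ {n} {f : Poly n} → Positive f → ∀ {μ} → Occurs f μ → coeff f μ ≢ 0ℤ
coeff≢0 {f = f} pos {μ} o e with coeff-positive f pos μ
... | c , eq , occ , _ = occ o (lem (trans (sym eq) e))
  where
  lem : ℤ.+ c ≡ ℤ.+ 0 → c ≡ 0
  lem refl = refl

occurs : ∀ {n} {f : Poly n} → Positive f → ∀ {μ} → coeff f μ ≢ 0ℤ → Occurs f μ
occurs {f = f} pos {μ} h with coeff-positive f pos μ
... | c , eq , _ , nz = nz λ { refl → h eq }

positive-X : ∀ {n} (i : Fin n) → Positive (X i)
positive-X i (here refl) = 0 , refl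

positive-⊞ : ∀ {n} (f g : Poly n) → Positive f → Positive g → Positive (f ⊞ g)
positive-⊞ f g p q t with ∈-++⁻ f t
... | inj₁ h = p h
... | inj₂ h = q h

positive-⊠ : ∀ {n} (f g : Poly n) → Positive f → Positive g → Positive (f ⊠ g)
positive-⊠ f g p q t with ∈-cartesianProductWith⁻ _ f g t
... | (a , μ) , (b , ν) , s , s′ , refl with p s | q s′
...   | x , refl | y , refl = _ , refl

foldr₁-preserves : ∀ {A B : Set} {P : B → Set} (h : A → B) (_∙_ : B → B → B) →
  (∀ x y → P x → P y → P (x ∙ y)) → (∀ a → P (h a)) → ∀ a as → P (foldr₁ _∙_ (List⁺.map h (a ∷⁺ as)))
foldr₁-preserves h _∙_ c p a []       = p a
foldr₁-preserves h _∙_ c p a (b ∷ as) = c _ _ (p a) (foldr₁-preserves h _∙_ c p b as)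

positive-gate : ∀ {n m} (g : Gate n m) fs → (∀ i → Positive (lookup fs i)) → Positive (⟦ g ⟧gate fs)
positive-gate (var i)  fs p = positive-X i
positive-gate (add (i ∷⁺ is)) fs p = foldr₁-preserves {P = Positive} (lookup fs) _⊞_ positive-⊞ p i is
positive-gate (mul (i ∷⁺ is)) fs p = foldr₁-preserves {P = Positive} (lookup fs) _⊠_ positive-⊠ p i is

-- Gates are appended with `_∷ʳ_`, so indices are analysed from the end.
data Snoc {m : ℕ} : Fin (suc m) → Set where
  oldIndex : (i : Fin m) → Snoc (inject₁ i)
  newIndex : Snoc (fromℕ m)

snoc : ∀ {m} (i : Fin (suc m)) → Snoc i
snoc {zero}  Fin.zero = newIndex
snoc {suc m} Fin.zero = oldIndex Fin.zero
snoc {suc m} (Fin.suc i) with snoc i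
... | oldIndex j = oldIndex (Fin.suc j)
... | newIndex  = newIndex

lookup-old : ∀ {A : Set} {m} (xs : Vec A m) x i → lookup (xs ∷ʳ x) (inject₁ i) ≡ lookup xs i
lookup-old (y ∷ xs) x Fin.zero    = refl
lookup-old (y ∷ xs) x (Fin.suc i) = lookup-old xs x i

lookup-new : ∀ {A : Set} {m} (xs : Vec A m) x → lookup (xs ∷ʳ x) (fromℕ m) ≡ x
lookup-new []       x = refl
lookup-new (y ∷ xs) x = lookup-new xs x

positive-gates : ∀ {n m} (gs : Gates n m) i → Positive (lookup ⟦ gs ⟧gates i)
positive-gates (gs ▷ g) i with snoc i
... | oldIndex j rewrite lookup-old ⟦ gs ⟧gates (⟦ g ⟧gate ⟦ gs ⟧gates) j = positive-gates gs j
... | newIndex  rewrite lookup-new ⟦ gs ⟧gates (⟦ g ⟧gate ⟦ gs ⟧gates)   = positive-gate g ⟦ gs ⟧gates (positive-gates gs)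

last≡lookup : ∀ {A : Set} {m} (xs : Vec A (suc m)) → last xs ≡ lookup xs (fromℕ m)
last≡lookup {m = m} xs with initLast xs
... | ys , y , refl = sym (lookup-new ys y)

-- Sets of weights of sums and products.

Hits : ∀ {n} → Poly n → (ℕ → ℕ) → ℕ → Set
Hits f v z = ∃[ μ ] Occurs f μ × weight μ v ≡ z

module _ {n : ℕ} (v : ℕ → ℕ) where

  hits-X : (i : Fin n) → Hits (X i) v (v (toℕ i))
  hits-X i = _ , (_ , here refl) , weight-var i v

  hits-X⁻ : (i : Fin n) → ∀ {z} → Hits (X i) v z → z ≡ v (toℕ i)
  hits-X⁻ i (_ , (_ , here refl) , e) = trans (sym e) (weight-var i v)

  hits-⊞⁻ : (f g : Poly n) → ∀ {z} → Hits (f ⊞ g) v z → Hits f v z ⊎ Hits g v z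
  hits-⊞⁻ f g (μ , (a , t) , e) with ∈-++⁻ f t
  ... | inj₁ t′ = inj₁ (μ , (a , t′) , e)
  ... | inj₂ t′ = inj₂ (μ , (a , t′) , e)

  hits-⊞ˡ : (f g : Poly n) → ∀ {z} → Hits f v z → Hits (f ⊞ g) v z
  hits-⊞ˡ f g (μ , (a , t) , e) = μ , (a , ∈-++⁺ˡ t) , e

  hits-⊞ʳ : (f g : Poly n) → ∀ {z} → Hits g v z → Hits (f ⊞ g) v z
  hits-⊞ʳ f g (μ , (a , t) , e) = μ , (a , ∈-++⁺ʳ f t) , e

  hits-⊠ : (f g : Poly n) → ∀ {x y} → Hits f v x → Hits g v y → Hits (f ⊠ g) v (x + y)
  hits-⊠ f g (μ , (a , t) , e) (ν , (b , t′) , e′) =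
    zipWith _+_ μ ν , (_ , ∈-cartesianProductWith⁺ _ t t′) , trans (weight-* μ ν v) (cong₂ _+_ e e′)

  hits-⊠⁻ : (f g : Poly n) → ∀ {z} → Hits (f ⊠ g) v z → ∃₂ λ x y → Hits f v x × Hits g v y × x + y ≡ z
  hits-⊠⁻ f g (_ , (_ , t) , e) with ∈-cartesianProductWith⁻ _ f g t
  ... | (a , μ) , (b , ν) , s , s′ , refl =
    _ , _ , (μ , (a , s) , refl) , (ν , (b , s′) , refl) , trans (sym (weight-* μ ν v)) e

  module _ {m : ℕ} (fs : Vec (Poly n) m) where

    Union : List (Fin m) → ℕ → Set
    Union is z = Any (λ i → Hits (lookup fs i) v z) is

    -- The empty sumset is the singleton of 0, the value with which the program sets up the row of a
    -- product.
    Sumset : List (Fin m) → ℕ → Set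
    Sumset []       z = z ≡ 0
    Sumset (i ∷ is) z = ∃₂ λ x y → Hits (lookup fs i) v x × Sumset is y × x + y ≡ z

    hits-add : ∀ i is {z} → Union (i ∷ is) z → Hits (⟦ add (i ∷⁺ is) ⟧gate fs) v z
    hits-add i []       (here h)  = h
    hits-add i (j ∷ is) (here h)  = hits-⊞ˡ (lookup fs i) _ h
    hits-add i (j ∷ is) (there h) = hits-⊞ʳ (lookup fs i) _ (hits-add j is h)

    hits-add⁻ : ∀ i is {z} → Hits (⟦ add (i ∷⁺ is) ⟧gate fs) v z → Union (i ∷ is) z
    hits-add⁻ i []       h = here h
    hits-add⁻ i (j ∷ is) h with hits-⊞⁻ (lookup fs i) _ h
    ... | inj₁ h′ = here h′
    ... | inj₂ h′ = there (hits-add⁻ j is h′)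

    hits-mul : ∀ i is {z} → Sumset (i ∷ is) z → Hits (⟦ mul (i ∷⁺ is) ⟧gate fs) v z
    hits-mul i []       (x , _ , h , refl , refl) = subst (Hits (lookup fs i) v) (sym (+-identityʳ x)) h
    hits-mul i (j ∷ is) (x , y , h , h′ , refl)   = hits-⊠ (lookup fs i) _ h (hits-mul j is h′)

    hits-mul⁻ : ∀ i is {z} → Hits (⟦ mul (i ∷⁺ is) ⟧gate fs) v z → Sumset (i ∷ is) z
    hits-mul⁻ i []       h = _ , 0 , h , refl , +-identityʳ _
    hits-mul⁻ i (j ∷ is) h with hits-⊠⁻ (lookup fs i) _ h
    ... | x , y , h₁ , h₂ , e = x , y , h₁ , hits-mul⁻ j is h₂ , e

-- Digit sums as a test for bounded exponents.

-- The digit at position e absorbs all higher ones.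
digitSum : (β e u : ℕ) → ℕ
digitSum β zero    u = u
digitSum β (suc e) u = u mod β + digitSum β e (u div β)

∑-mono-< : ∀ n {f g} i → i < n → (∀ j → j < n → f j ≤ g j) → f i < g i → ∑ n f < ∑ n g
∑-mono-< (suc n) zero    _         h l = +-mono-<-≤ l (∑-mono n λ j j<n → h (suc j) (s<s j<n))
∑-mono-< (suc n) (suc i) (s≤s i<n) h l = +-mono-≤-< (h 0 z<s) (∑-mono-< n i i<n (λ j j<n → h (suc j) (s<s j<n)) l)

module Digits (r : ℕ) (0<r : 0 < r) where

  β : ℕ
  β = suc r

  ds : ℕ → ℕ → ℕ
  ds = digitSum β

  ds-digit : ∀ e {d} q → d < β → ds (suc e) (d + q * β) ≡ d + ds e q
  ds-digit e q d<β = cong₂ _+_ (mod-digit q d<β) (cong (ds e) (div-digit q d<β))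

  ds-0 : ∀ e → ds e 0 ≡ 0
  ds-0 zero    = refl
  ds-0 (suc e) = trans (ds-digit e 0 z<s) (ds-0 e)

  ds-1 : ∀ e → ds e 1 ≤ 1
  ds-1 zero    = ≤-refl
  ds-1 (suc e) = ≤-reflexive (trans (ds-digit e 0 (s≤s 0<r)) (cong suc (ds-0 e)))

  -- A carry removes β from one digit and adds only 1 to the rest, which raises the digit sum of the
  -- rest by at most 1.
  ds-+ : ∀ e x y → ds e (x + y) ≤ ds e x + ds e y
  ds-+ zero    x y = ≤-refl
  ds-+ (suc e) x y = go
    where
    open ≤-Reasoning
    a = x mod β
    b = y mod β
    q = x div β
    p = y div β
    ex : x + y ≡ a + b + (q + p) * β
    ex = trans (cong₂ _+_ (proj₁ (divmod x {β} z<s)) (proj₁ (divmod y {β} z<s))) (l a b q p β)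
      where
      l : ∀ a b q p β → a + q * β + (b + p * β) ≡ a + b + (q + p) * β
      l = solve-∀
    l₁ : ∀ a b c d → a + b + (c + d) ≡ a + c + (b + d)
    l₁ = solve-∀
    go : ds (suc e) (x + y) ≤ ds (suc e) x + ds (suc e) y
    go with a + b <? β
    ... | yes a+b<β = begin
      ds (suc e) (x + y)                    ≡⟨ cong (ds (suc e)) ex ⟩
      ds (suc e) (a + b + (q + p) * β)      ≡⟨ ds-digit e (q + p) a+b<β ⟩
      a + b + ds e (q + p)                  ≤⟨ +-monoʳ-≤ (a + b) (ds-+ e q p) ⟩
      a + b + (ds e q + ds e p)             ≡⟨ l₁ a b _ _ ⟩
      ds (suc e) x + ds (suc e) y ∎
    ... | no ¬l = begin
      ds (suc e) (x + y)                    ≡⟨ cong (ds (suc e)) ex′ ⟩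
      ds (suc e) (c + (1 + (q + p)) * β)    ≡⟨ ds-digit e (1 + (q + p)) c<β ⟩
      c + ds e (1 + (q + p))                ≤⟨ +-monoʳ-≤ c (ds-+ e 1 (q + p)) ⟩
      c + (ds e 1 + ds e (q + p))           ≤⟨ +-monoʳ-≤ c (+-mono-≤ (ds-1 e) (ds-+ e q p)) ⟩
      c + (1 + (ds e q + ds e p))           ≡⟨ +-assoc c 1 _ ⟨
      c + 1 + (ds e q + ds e p)             ≤⟨ +-monoˡ-≤ _ (+-monoʳ-≤ c (s≤s z≤n)) ⟩
      c + β + (ds e q + ds e p)             ≡⟨ cong (_+ (ds e q + ds e p)) (m∸n+n≡m (≮⇒≥ ¬l)) ⟩
      a + b + (ds e q + ds e p)             ≡⟨ l₁ a b _ _ ⟩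
      ds (suc e) x + ds (suc e) y ∎
      where
      c = a + b ∸ β
      ex′ : x + y ≡ c + (1 + (q + p)) * β
      ex′ = trans ex (trans (cong (_+ (q + p) * β) (sym (m∸n+n≡m (≮⇒≥ ¬l)))) (+-assoc c β _))
      c<β : c < β
      c<β = +-cancelʳ-< β c β (begin-strict
        c + β  ≡⟨ m∸n+n≡m (≮⇒≥ ¬l) ⟩
        a + b  <⟨ +-mono-<-≤ (proj₂ (divmod x {β} z<s)) (<⇒≤ (proj₂ (divmod y {β} z<s))) ⟩
        β + β ∎)

  ds-∑ : ∀ e n f → ds e (∑ n f) ≤ ∑ n (ds e ∘ f)
  ds-∑ e zero    f = ≤-reflexive (ds-0 e)
  ds-∑ e (suc n) f = ≤-trans (ds-+ e (f 0) _) (+-monoʳ-≤ _ (ds-∑ e n (f ∘ suc)))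

  ds-* : ∀ e c x → ds e (c * x) ≤ c * ds e x
  ds-* e zero    x = ≤-reflexive (ds-0 e)
  ds-* e (suc c) x = ≤-trans (ds-+ e x (c * x)) (+-monoʳ-≤ _ (ds-* e c x))

  ds-^ : ∀ e b → b ≤ e → ds e (β ^ b) ≤ 1
  ds-^ e       zero    _       = ds-1 e
  ds-^ (suc e) (suc b) (s≤s l) = begin
    ds (suc e) (β * β ^ b)       ≡⟨ cong (ds (suc e)) (*-comm β (β ^ b)) ⟩
    ds (suc e) (0 + β ^ b * β)   ≡⟨ ds-digit e (β ^ b) z<s ⟩
    ds e (β ^ b)                 ≤⟨ ds-^ e b l ⟩
    1 ∎
    where open ≤-Reasoning

  ds-*^ : ∀ e c b → b ≤ e → ds e (c * β ^ b) ≤ c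
  ds-*^ e c b l = ≤-trans (ds-* e c (β ^ b)) (≤-trans (*-monoʳ-≤ c (ds-^ e b l)) (≤-reflexive (*-identityʳ c)))

  -- The top digit is not reduced modulo β, so it takes up `q` in full.
  ds-top : ∀ e u q → u < β ^ e → ds e (u + q * β ^ e) ≡ ds e u + q
  ds-top zero    u q _ = cong (u +_) (*-identityʳ q)
  ds-top (suc e) u q u< = begin-equality
    ds (suc e) (u + q * (β * β ^ e))
      ≡⟨ cong (ds (suc e)) (trans (cong (_+ q * (β * β ^ e)) eu) (l (u mod β) (u div β) β q (β ^ e))) ⟩
    ds (suc e) (u mod β + (u div β + q * β ^ e) * β)
      ≡⟨ ds-digit e _ (proj₂ (divmod u {β} z<s)) ⟩
    u mod β + ds e (u div β + q * β ^ e)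
      ≡⟨ cong (u mod β +_) (ds-top e (u div β) q (div< (≤-trans u< (≤-reflexive (*-comm β (β ^ e)))))) ⟩
    u mod β + (ds e (u div β) + q)
      ≡⟨ +-assoc (u mod β) _ q ⟨
    ds (suc e) u + q ∎
    where
    open ≤-Reasoning
    eu = proj₁ (divmod u {β} z<s)
    l : ∀ a d β q t → a + d * β + q * (β * t) ≡ a + (d + q * t) * β
    l = solve-∀

  module _ (n k e : ℕ) (bin : ℕ → ℕ) where

    itemWeight : ℕ → ℕ
    itemWeight i = β ^ e + β ^ bin i

    weight-split : (μ : Monomial n) → weight μ itemWeight ≡ ∑ n (at μ) * β ^ e + ∑ n (λ i → at μ i * β ^ bin i)
    weight-split μ = trans (∑-cong n λ i _ → trans (*-distribˡ-+ (at μ i) (β ^ e) _) (cong (_+ at μ i * β ^ bin i) (*-comm (at μ i) (β ^ e))))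
      (trans (∑-+ n _ _) (cong (_+ ∑ n (λ i → at μ i * β ^ bin i)) (trans (∑-* n (β ^ e) (at μ)) (*-comm (β ^ e) _))))

    -- A variable of degree at least β = r + 1 would allow to trade β copies
    -- of β ^ b for β ^ (b + 1), so that the digit sum is less than the degree.
    digitSum-sound : (∀ i → i < n → bin i < e) → (μ : Monomial n) → ∀ {u} → u < β ^ e → ds e u ≡ k →
      weight μ itemWeight ≡ k * β ^ e + u → sum μ ≡ k × All (_≤ r) μ
    digitSum-sound bin<e μ {u} u<T ds≡k eq = trans (sym (∑-at μ)) m≡k , at-All λ i i<n → ≮⇒≥ (small i i<n)
      where
      open ≤-Reasoning
      T = β ^ e
      m = ∑ n (at μ)
      U = ∑ n (λ i → at μ i * β ^ bin i)
      eq′ : m * T + U ≡ k * T + u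
      eq′ = trans (sym (weight-split μ)) eq
      m≤k : m ≤ k
      m≤k = ≮⇒≥ λ k<m → <-irrefl refl (begin-strict
        k * T + u   <⟨ +-monoʳ-< (k * T) u<T ⟩
        k * T + T   ≡⟨ +-comm (k * T) T ⟩
        suc k * T   ≤⟨ *-monoˡ-≤ T k<m ⟩
        m * T       ≤⟨ m≤m+n _ U ⟩
        m * T + U   ≡⟨ eq′ ⟩
        k * T + u ∎)
      -- A deficit of `q` in the degree would have to be made up by `q * T` in the bin part, raising
      -- its digit sum to `k + q`; but subadditivity bounds that digit sum by `m ≤ k`.
      q = k ∸ m
      m+q≡k : m + q ≡ k
      m+q≡k = m+[n∸m]≡n m≤k
      U≡ : U ≡ u + q * T
      U≡ = +-cancelˡ-≡ (m * T) _ _ (trans eq′ (trans (cong (λ z → z * T + u) (sym m+q≡k)) (l m q T u)))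
        where
        l : ∀ m q T u → (m + q) * T + u ≡ m * T + (u + q * T)
        l = solve-∀
      dsU : ds e U ≡ k + q
      dsU = trans (cong (ds e) U≡) (trans (ds-top e u q u<T) (cong (_+ q) ds≡k))
      dsTerms : ds e U ≤ ∑ n (λ i → ds e (at μ i * β ^ bin i))
      dsTerms = ds-∑ e n _
      term : ∀ i → i < n → ds e (at μ i * β ^ bin i) ≤ at μ i
      term i i<n = ds-*^ e (at μ i) (bin i) (<⇒≤ (bin<e i i<n))
      k≤m : k ≤ m
      k≤m = ≤-trans (m≤m+n k q) (≤-trans (≤-reflexive (sym dsU)) (≤-trans dsTerms (∑-mono n term)))
      m≡k = ≤-antisym m≤k k≤m
      small : ∀ i → i < n → ¬ (r < at μ i)
      small i i<n β≤ = <⇒≱ (begin-strict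
        ds e U                                    ≤⟨ dsTerms ⟩
        ∑ n (λ i → ds e (at μ i * β ^ bin i))     <⟨ ∑-mono-< n i i<n term drop ⟩
        m ∎) (≤-trans m≤k (≤-trans (m≤m+n k q) (≤-reflexive (sym dsU))))
        where
        c = at μ i ∸ β
        c+β : c + β ≡ at μ i
        c+β = m∸n+n≡m β≤
        drop : ds e (at μ i * β ^ bin i) < at μ i
        drop = begin-strict
          ds e (at μ i * β ^ bin i)                   ≡⟨ cong (λ z → ds e (z * β ^ bin i)) c+β ⟨
          ds e ((c + β) * β ^ bin i)                  ≡⟨ cong (ds e) (*-distribʳ-+ (β ^ bin i) c β) ⟩
          ds e (c * β ^ bin i + β * β ^ bin i)        ≤⟨ ds-+ e (c * β ^ bin i) _ ⟩
          ds e (c * β ^ bin i) + ds e (β ^ suc (bin i))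
            ≤⟨ +-mono-≤ (ds-*^ e c (bin i) (<⇒≤ (bin<e i i<n))) (ds-^ e (suc (bin i)) (bin<e i i<n)) ⟩
          c + 1                                       <⟨ +-monoʳ-< c (s≤s 0<r) ⟩
          c + β                                       ≡⟨ c+β ⟩
          at μ i ∎

  -- Loads at most `r` are digits in base β, so nothing is carried. The induction takes off bin 0 as
  -- the lowest digit and shifts the others down.
  digitSum-complete : ∀ n e (ν bin : ℕ → ℕ) → (∀ i → i < n → ν i ≢ 0 → bin i < e) →
    (∀ b → ∑ n (λ i → χ (bin i ≟ b) (ν i)) ≤ r) →
    ∑ n (λ i → ν i * β ^ bin i) < β ^ e × ds e (∑ n (λ i → ν i * β ^ bin i)) ≡ ∑ n ν
  digitSum-complete n zero ν bin bin<e load =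
    s≤s (≤-reflexive (zeros λ i i<n → cong (_* β ^ bin i) (ν≡0 i i<n))) ,
    trans (zeros λ i i<n → cong (_* β ^ bin i) (ν≡0 i i<n)) (sym (zeros ν≡0))
    where
    zeros : ∀ {f} → (∀ i → i < n → f i ≡ 0) → ∑ n f ≡ 0
    zeros h = trans (∑-cong n h) (∑-0 n)
    ν≡0 : ∀ i → i < n → ν i ≡ 0
    ν≡0 i i<n with ν i ≟ 0
    ... | yes e = e
    ... | no ≢0 = ⊥-elim (n≮0 (bin<e i i<n ≢0))
  digitSum-complete n (suc e) ν bin bin<e load = bound , total
    where
    open ≤-Reasoning
    ν′ : ℕ → ℕ
    ν′ i = χ (¬? (bin i ≟ 0)) (ν i)
    -- Items of bin 0 stay at 0 under truncated subtraction, but `ν′` gives them weight 0.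
    bin′ : ℕ → ℕ
    bin′ i = bin i ∸ 1
    ih = digitSum-complete n e ν′ bin′ bin′<e load′
      where
      bin′<e : ∀ i → i < n → ν′ i ≢ 0 → bin′ i < e
      bin′<e i i<n ≢0 with bin i in eq
      ... | zero  = ⊥-elim (≢0 refl)
      ... | suc b = ≤-pred (subst (_< suc e) eq (bin<e i i<n ≢0))
      load′ : ∀ b → ∑ n (λ i → χ (bin′ i ≟ b) (ν′ i)) ≤ r
      load′ b = ≤-trans (∑-mono n λ i _ → lem i) (load (suc b))
        where
        lem : ∀ i → χ (bin′ i ≟ b) (ν′ i) ≤ χ (bin i ≟ suc b) (ν i)
        lem i with bin i
        ... | zero  = ≤-trans (χ≤ (0 ≟ b) 0) z≤n
        ... | suc c = χ-mono (c ≟ b) (suc c ≟ suc b) (cong suc) ≤-refl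
    ℓ  = ∑ n (λ i → χ (bin i ≟ 0) (ν i))
    U′ = ∑ n (λ i → ν′ i * β ^ bin′ i)
    split : ∑ n (λ i → ν i * β ^ bin i) ≡ ℓ + U′ * β
    split = trans (∑-cong n λ i _ → lem i) (trans (∑-+ n _ _) (cong (ℓ +_) (trans (∑-* n β _) (*-comm β U′))))
      where
      lem : ∀ i → ν i * β ^ bin i ≡ χ (bin i ≟ 0) (ν i) + β * (ν′ i * β ^ bin′ i)
      lem i with bin i
      ... | zero  = trans (*-identityʳ (ν i)) (trans (sym (+-identityʳ (ν i))) (cong (ν i +_) (sym (*-zeroʳ β))))
      ... | suc c = l (ν i) β (β ^ c)
        where
        l : ∀ x b t → x * (b * t) ≡ 0 + b * (x * t)
        l = solve-∀
    bound : ∑ n (λ i → ν i * β ^ bin i) < β ^ suc e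
    bound = subst (_< β ^ suc e) (sym split) (digit-bound {e = e} (s≤s (load 0)) (proj₁ ih))
    total : ds (suc e) (∑ n (λ i → ν i * β ^ bin i)) ≡ ∑ n ν
    total = begin-equality
      ds (suc e) (∑ n (λ i → ν i * β ^ bin i))  ≡⟨ cong (ds (suc e)) split ⟩
      ds (suc e) (ℓ + U′ * β)                   ≡⟨ ds-digit e U′ (s≤s (load 0)) ⟩
      ℓ + ds e U′                               ≡⟨ cong (ℓ +_) (proj₂ ih) ⟩
      ℓ + ∑ n ν′                                ≡⟨ ∑-+ n _ _ ⟨
      ∑ n (λ i → χ (bin i ≟ 0) (ν i) + ν′ i)    ≡⟨ ∑-cong n (λ i _ → lem i) ⟩
      ∑ n ν ∎
      where
      lem : ∀ i → χ (bin i ≟ 0) (ν i) + ν′ i ≡ ν i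
      lem i with bin i
      ... | zero  = +-identityʳ (ν i)
      ... | suc _ = refl

-- The detection criterion and its correctness.

module Detect (n k r ρ D : ℕ) (0<n : 0 < n) (0<k : 0 < k) (0<r : 0 < r)
  (k≤ : k ≤ 4 ^ ρ * r) (D≥ : 3 * k + 2 * r * ρ ≤ D * r) where

  -- `N₀` exceeds `6 * k * k`, so the collision weight of a good hash function into `N₀` keys is
  -- below 1 and thus 0. `Hc` bounds the multipliers of all rounds, as `K ≤ k`. There are `suc D`
  -- bins, hence the exponent in `T`.
  N₀ Hc Gb T : ℕ
  N₀ = suc (k * k * 6)
  Hc = N₀ * (k * 24)
  Gb = suc (r * 96) * 3
  T  = suc r ^ suc D

  open Digits r 0<r using (digitSum-sound; digitSum-complete; weight-split; itemWeight)
  open Run N₀ Hc Gb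

  bin : (a₀ A B i : ℕ) → ℕ
  bin a₀ A B i = run D 0 k A B 0 (hash n N₀ a₀ i)

  itemWeightOf : (a₀ A B : ℕ) → ℕ → ℕ
  itemWeightOf a₀ A B i = T + suc r ^ bin a₀ A B i

  Accepts : (a₀ A B : ℕ) → Poly n → Set
  Accepts a₀ A B f = ∃[ u ] u < T × digitSum (suc r) (suc D) u ≡ k × Hits f (itemWeightOf a₀ A B) (k * T + u)

  -- Every seed puts every variable into one of the bins up to `D`, which is all that soundness
  -- requires; balance matters for completeness only.
  accepts-sound : ∀ {f} → Positive f → ∀ a₀ A B → Accepts a₀ A B f → MonomialDetection f r k
  accepts-sound pos a₀ A B (u , u<T , ds , μ , o , e) =
    μ , coeff≢0 pos o , digitSum-sound n k (suc D) (bin a₀ A B) (λ i _ → s≤s (run-≤ D 0 k A B 0 _)) μ u<T ds e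

  accepts-complete : ∀ {f} → Positive f → MonomialDetection f r k →
    ∃[ a₀ ] a₀ < n * N₀ × ∃[ A ] A < Hc ^ ρ × ∃[ B ] B < Gb ^ D × Accepts a₀ A B f
  accepts-complete {f} pos (μ , nz , deg , small) = a₀ , a₀< , _ , S.A< , _ , S.B< ,
    U , proj₁ digits , trans (proj₂ digits) ∑ν≡k , μ , occurs pos nz , wt
    where
    open ≤-Reasoning
    ν : ℕ → ℕ
    ν = at μ
    ∑ν≡k : ∑ n ν ≡ k
    ∑ν≡k = trans (∑-at μ) deg
    distinct : ∀ i j → i < n → j < n → ν i ≢ 0 → ν j ≢ 0 → i ≢ j → i ≢ j
    distinct _ _ _ _ _ _ i≢j = i≢j
    gh = goodHash {n} {N₀} 0<n z<s n ν id (λ _ i<n → i<n) distinct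
    a₀ = proj₁ gh
    a₀< : a₀ < n * N₀
    a₀< = proj₁ (proj₂ gh)
    cw = collisionWeight {n} {N₀} 0<n z<s n ν id (λ _ i<n → i<n) distinct a₀
    cw≡0 : cw ≡ 0
    cw≡0 = vanishes cw (k * k * 6) (≤-trans (proj₂ (proj₂ gh))
      (≤-reflexive (trans (cong (λ z → 6 * (z * z)) ∑ν≡k) (*-comm 6 (k * k)))))
      where
      vanishes : ∀ c b → suc b * c ≤ b → c ≡ 0
      vanishes zero    b _ = refl
      vanishes (suc c) b h = ⊥-elim (<-irrefl refl (≤-trans (m≤m*n (suc b) (suc c)) h))
    key : ℕ → ℕ
    key = hash n N₀ a₀
    key< : ∀ i → i < n → key i < N₀
    key< i _ = div< (≤-trans (proj₂ (divmod (a₀ * i) (*-mono-≤ 0<n (z<s {k * k * 6})))) (≤-reflexive (*-comm n N₀)))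
    open Assign N₀ Hc (r * 96) r n key z<s 0<r (≤-trans (s≤s (s≤s z≤n)) (*-monoˡ-≤ 96 0<r)) key<
    keys : KeysDistinct ν
    keys i j i<n j<n νi νj i≢j e = <⇒≱ (begin-strict
      0  <⟨ *-mono-≤ (n≢0⇒n>0 νi) (n≢0⇒n>0 νj) ⟩
      ν i * ν j ≡⟨ *-identityʳ _ ⟨
      ν i * ν j * 1 ≡⟨ cong (ν i * ν j *_) (χ-yes (¬? (i ≟ j) ×-dec (key i ≟ key j)) 1 (i≢j , e)) ⟨
      ν i * ν j * χ (¬? (i ≟ j) ×-dec (key i ≟ key j)) 1
        ≤⟨ ∑-term (λ j → ν i * ν j * χ (¬? (i ≟ j) ×-dec (key i ≟ key j)) 1) j<n ⟩
      ∑ n (λ j → ν i * ν j * χ (¬? (i ≟ j) ×-dec (key i ≟ key j)) 1)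
        ≤⟨ ∑-term (λ i → ∑ n (λ j → ν i * ν j * χ (¬? (i ≟ j) ×-dec (key i ≟ key j)) 1)) i<n ⟩
      cw ∎) (≤-reflexive cw≡0)
    module S = Seeds (balancedSeeds ρ D k 0 ν (*-comm 96 r) ≤-refl (*-mono-≤ (z<s {k * k * 6}) (*-mono-≤ 0<k (s≤s {0} {23} z≤n)))
      (λ i _ → All-at small i) keys (≤-reflexive ∑ν≡k) k≤ D≥)
    b = bin a₀ S.A S.B
    U = ∑ n (λ i → ν i * suc r ^ b i)
    digits = digitSum-complete n (suc D) ν b (λ i _ _ → s≤s (run-≤ D 0 k S.A S.B 0 _)) S.balanced
    wt : weight μ (itemWeightOf a₀ S.A S.B) ≡ k * T + U
    wt = trans (weight-split n k (suc D) b μ) (cong (λ z → z * T + U) ∑ν≡k)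

-- Memory updates and the size of numbers.

≡ᵇ-true : ∀ a → (a ≡ᵇ a) ≡ true
≡ᵇ-true zero    = refl
≡ᵇ-true (suc a) = ≡ᵇ-true a

≡ᵇ-false : ∀ {a b} → a ≢ b → (a ≡ᵇ b) ≡ false
≡ᵇ-false {a} {b} a≢b with a ≡ᵇ b in eq
... | true  = ⊥-elim (a≢b (≡ᵇ⇒≡ a b (subst Bool.T (sym eq) tt)))
... | false = refl

written : ∀ σ a v → (σ [ a ↦ v ]) a ≡ v
written σ a v rewrite ≡ᵇ-true a = refl

unwritten : ∀ σ {a v b} → b ≢ a → (σ [ a ↦ v ]) b ≡ σ b
unwritten σ b≢a rewrite ≡ᵇ-false b≢a = refl

Below : ℕ → Memory → Set
Below M σ = ∀ a → σ a ≤ M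

below-write : ∀ {M σ a v} → Below M σ → v ≤ M → Below M (σ [ a ↦ v ])
below-write {a = a} h v≤M b with b ≡ᵇ a
... | true  = v≤M
... | false = h b

-- If all cells are at most `M ≥ 2`, then `M ^ degree e` bounds every value met. This is crude, with
-- degree `a` for the literal `a`, but expressions are fixed and so the exponent is a constant.
degree : Exp → ℕ
degree (lit a)   = a
degree (mem e)   = suc (degree e)
degree (e₁ ⊕ e₂) = suc (degree e₁ + degree e₂)
degree (e₁ ⊖ e₂) = suc (degree e₁ + degree e₂)
degree (e₁ ⊗ e₂) = suc (degree e₁ + degree e₂)
degree (e₁ ⊘ e₂) = suc (degree e₁ + degree e₂)

div-≤ : ∀ a b → a div b ≤ a
div-≤ a zero    = z≤n
div-≤ a (suc b) = m/n≤m a (suc b)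

module Degree {M : ℕ} (2≤M : 2 ≤ M) {σ : Memory} (bd : Below M σ) where

  private
    0<M : 0 < M
    0<M = ≤-trans (s≤s z≤n) 2≤M

  pow-mono : ∀ {i j x} → i ≤ j → x ≤ M ^ i → x ≤ M ^ j
  pow-mono i≤j h = ≤-trans h (^-monoʳ-≤ M {{>-nonZero 0<M}} i≤j)

  pow-+ : ∀ {i j x y} → x ≤ M ^ i → y ≤ M ^ j → x + y ≤ M ^ suc (i + j)
  pow-+ {i} {j} {x} {y} p q = begin
    x + y                     ≤⟨ +-mono-≤ (pow-mono (m≤m+n i j) p) (pow-mono (m≤n+m j i) q) ⟩
    M ^ (i + j) + M ^ (i + j) ≡⟨ cong (M ^ (i + j) +_) (+-identityʳ _) ⟨
    2 * M ^ (i + j)           ≤⟨ *-monoˡ-≤ _ 2≤M ⟩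
    M ^ suc (i + j) ∎
    where open ≤-Reasoning

  pow-* : ∀ {i j x y} → x ≤ M ^ i → y ≤ M ^ j → x * y ≤ M ^ suc (i + j)
  pow-* {i} {j} p q = pow-mono (n≤1+n (i + j)) (≤-trans (*-mono-≤ p q) (≤-reflexive (sym (^-distribˡ-+-* M i j))))

  pow-ˡ : ∀ {i} j {x} → x ≤ M ^ i → x ≤ M ^ suc (i + j)
  pow-ˡ {i} j p = pow-mono (≤-trans (m≤m+n i j) (n≤1+n _)) p

  pow-ʳ : ∀ i {j} {x} → x ≤ M ^ j → x ≤ M ^ suc (i + j)
  pow-ʳ i {j} p = pow-mono (≤-trans (m≤n+m j i) (n≤1+n _)) p

  lit-≤ : ∀ a → a ≤ M ^ a
  lit-≤ zero    = z≤n
  lit-≤ (suc a) = ≤-trans (≤-trans (+-mono-≤ (m^n>0 M {{>-nonZero 0<M}} a) (lit-≤ a))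
    (≤-reflexive (cong (M ^ a +_) (sym (+-identityʳ _))))) (*-monoˡ-≤ (M ^ a) 2≤M)

  value-≤ : ∀ e → ⟦ e ⟧exp σ ≤ M ^ degree e
  value-≤ (lit a)   = lit-≤ a
  value-≤ (mem e)   = ≤-trans (bd _) (pow-mono {1} {degree (mem e)} (s≤s z≤n) (≤-reflexive (sym (*-identityʳ M))))
  value-≤ (e₁ ⊕ e₂) = pow-+ {degree e₁} (value-≤ e₁) (value-≤ e₂)
  value-≤ (e₁ ⊖ e₂) = pow-ˡ {degree e₁} (degree e₂) (≤-trans (m∸n≤m _ (⟦ e₂ ⟧exp σ)) (value-≤ e₁))
  value-≤ (e₁ ⊗ e₂) = pow-* {degree e₁} (value-≤ e₁) (value-≤ e₂)
  value-≤ (e₁ ⊘ e₂) = pow-ˡ {degree e₁} (degree e₂) (≤-trans (div-≤ _ (⟦ e₂ ⟧exp σ)) (value-≤ e₁))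

  peak-≤ : ∀ e → peak e σ ≤ M ^ degree e
  peak-≤ (lit a)     = lit-≤ a
  peak-≤ e@(mem e₁)  = ⊔-lub (value-≤ e) (pow-mono {degree e₁} {suc (degree e₁)} (n≤1+n _) (peak-≤ e₁))
  peak-≤ e@(e₁ ⊕ e₂) = ⊔-lub (value-≤ e) (⊔-lub (pow-ˡ {degree e₁} (degree e₂) (peak-≤ e₁)) (pow-ʳ (degree e₁) (peak-≤ e₂)))
  peak-≤ e@(e₁ ⊖ e₂) = ⊔-lub (value-≤ e) (⊔-lub (pow-ˡ {degree e₁} (degree e₂) (peak-≤ e₁)) (pow-ʳ (degree e₁) (peak-≤ e₂)))
  peak-≤ e@(e₁ ⊗ e₂) = ⊔-lub (value-≤ e) (⊔-lub (pow-ˡ {degree e₁} (degree e₂) (peak-≤ e₁)) (pow-ʳ (degree e₁) (peak-≤ e₂)))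
  peak-≤ e@(e₁ ⊘ e₂) = ⊔-lub (value-≤ e) (⊔-lub (pow-ˡ {degree e₁} (degree e₂) (peak-≤ e₁)) (pow-ʳ (degree e₁) (peak-≤ e₂)))

-- It bounds a maximum, so the body of a loop counts once however often it runs.
programDegree : Program → ℕ
programDegree skip         = 0
programDegree (e₁ ≔ e₂)    = suc (degree e₁ + degree e₂)
programDegree (P ⨾ Q)      = programDegree P + programDegree Q
programDegree (cond e P Q) = degree e + (programDegree P + programDegree Q)
programDegree (while e P)  = degree e + programDegree P

-- A language of arrays and bounded loops.

-- The first p variables are parameters; the remaining ones, up to d, are the
-- counters of the enclosing loops.
data Op : Set where
  plus minus times over : Op

⟦_⟧op : Op → ℕ → ℕ → ℕ
⟦ plus  ⟧op = _+_
⟦ minus ⟧op = _∸_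
⟦ times ⟧op = _*_
⟦ over  ⟧op = _div_

data Term (q d : ℕ) : Set where
  num : ℕ → Term q d
  var : Fin d → Term q d
  get : Fin q → Term q d → Term q d
  op  : Op → Term q d → Term q d → Term q d

infixr 3 _⨟_

-- Loop bounds are parameters, which no code can change. Termination is therefore evident, and the
-- time bound depends on the parameters but not on the store.
data Code (q p : ℕ) : ℕ → Set where
  nop  : ∀ {d} → Code q p d
  set  : ∀ {d} → Fin q → Term q d → Term q d → Code q p d
  _⨟_  : ∀ {d} → Code q p d → Code q p d → Code q p d
  when : ∀ {d} → Term q d → Code q p d → Code q p d → Code q p d
  for  : ∀ {d} → Fin p → Code q p (suc d) → Code q p d

Env : Set
Env = ℕ → ℕ

Store : ℕ → Set
Store q = Fin q → ℕ → ℕ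

-- Arrays are compared by `_≡ᵇ_` on their numbers, so that for concrete arrays a lookup after an
-- update reduces by computation.
_[_∙_↦_] : ∀ {q} → Store q → Fin q → ℕ → ℕ → Store q
(s [ x ∙ a ↦ v ]) y b = if toℕ y ≡ᵇ toℕ x then (if b ≡ᵇ a then v else s y b) else s y b

⟦_⟧term : ∀ {q d} → Term q d → Env → Store q → ℕ
⟦ num a ⟧term    ρ s = a
⟦ var i ⟧term    ρ s = ρ (toℕ i)
⟦ get x e ⟧term  ρ s = s x (⟦ e ⟧term ρ s)
⟦ op o a b ⟧term ρ s = ⟦ o ⟧op (⟦ a ⟧term ρ s) (⟦ b ⟧term ρ s)

wpLoop : ∀ {q} → (ℕ → Store q → (Store q → Set) → Set) → (j N : ℕ) → Store q → (Store q → Set) → Set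
wpLoop W j zero    s P = P s
wpLoop W j (suc N) s P = W j s λ s′ → wpLoop W (suc j) N s′ P

-- Weakest preconditions that also require every stored value to be at most `M`, which is what keeps
-- memory `Below M`.
WP : ∀ {q p d} → ℕ → Code q p d → Env → Store q → (Store q → Set) → Set
WP M nop ρ s P = P s
WP M (set x a e) ρ s P = ⟦ e ⟧term ρ s ≤ M × P (s [ x ∙ ⟦ a ⟧term ρ s ↦ ⟦ e ⟧term ρ s ])
WP M (c₁ ⨟ c₂) ρ s P = WP M c₁ ρ s λ s′ → WP M c₂ ρ s′ P
WP M (when e c₁ c₂) ρ s P = (⟦ e ⟧term ρ s ≢ 0 → WP M c₁ ρ s P) × (⟦ e ⟧term ρ s ≡ 0 → WP M c₂ ρ s P)
WP M (for {d} i c) ρ s P = wpLoop (λ j → WP M c (ρ [ d ↦ j ])) 0 (ρ (toℕ i)) s P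

wpLoop-mono : ∀ {q} {W : ℕ → Store q → (Store q → Set) → Set} →
  (∀ {j s P Q} → (∀ s → P s → Q s) → W j s P → W j s Q) →
  ∀ j N {s P Q} → (∀ s → P s → Q s) → wpLoop W j N s P → wpLoop W j N s Q
wpLoop-mono m j zero    h p = h _ p
wpLoop-mono m j (suc N) h p = m (λ s → wpLoop-mono m (suc j) N h) p

wp-mono : ∀ {q p d M} (c : Code q p d) {ρ s P Q} → (∀ s → P s → Q s) → WP M c ρ s P → WP M c ρ s Q
wp-mono nop            h p       = h _ p
wp-mono (set x a e)    h (l , p) = l , h _ p
wp-mono (c₁ ⨟ c₂)      h p       = wp-mono c₁ (λ s → wp-mono c₂ h) p
wp-mono (when e c₁ c₂) h (f , g) = (λ n → wp-mono c₁ h (f n)) , λ z → wp-mono c₂ h (g z)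
wp-mono (for i c) {ρ}  h p       = wpLoop-mono (wp-mono c) 0 (ρ (toℕ i)) h p

wpLoop-inv : ∀ {q} {W : ℕ → Store q → (Store q → Set) → Set} →
  (∀ {j s P Q} → (∀ s → P s → Q s) → W j s P → W j s Q) →
  (I : ℕ → Store q → Set) → ∀ j N {s} → (∀ i s → i < j + N → I i s → W i s (I (suc i))) → I j s → wpLoop W j N s (I (j + N))
wpLoop-inv m I j zero    h i = subst (λ z → I z _) (sym (+-identityʳ j)) i
wpLoop-inv {W = W} m I j (suc N) h i = m (λ s i′ → subst (λ z → wpLoop W (suc j) N s (I z)) (sym (+-suc j N))
  (wpLoop-inv m I (suc j) N (λ i s l → h i s (subst (i <_) (sym (+-suc j N)) l)) i′))
  (h j _ (m<m+n j z<s) i)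

wp-for : ∀ {q p d M} (i : Fin p) (c : Code q p (suc d)) {ρ s P} (I : ℕ → Store q → Set) →
  I 0 s → (∀ j s → j < ρ (toℕ i) → I j s → WP M c (ρ [ d ↦ j ]) s (I (suc j))) → (∀ s → I (ρ (toℕ i)) s → P s) →
  WP M (for i c) ρ s P
wp-for i c {ρ} I start step end =
  wpLoop-mono (wp-mono c) 0 (ρ (toℕ i)) end (wpLoop-inv (wp-mono c) I 0 (ρ (toℕ i)) step start)

writes : ∀ {q p d} → Code q p d → ℕ → Bool
writes nop            x = false
writes (set y a e)    x = x ≡ᵇ toℕ y
writes (c₁ ⨟ c₂)      x = writes c₁ x ∨ writes c₂ x
writes (when e c₁ c₂) x = writes c₁ x ∨ writes c₂ x
writes (for i c)      x = writes c x

∨-false : ∀ {a b} → a ∨ b ≡ false → a ≡ false × b ≡ false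
∨-false {false} e = refl , e

unset : ∀ {q} (s : Store q) {x y a v} → (toℕ x ≡ᵇ toℕ y) ≡ false → ∀ b → (s [ y ∙ a ↦ v ]) x b ≡ s x b
unset s e b rewrite e = refl

-- The side condition is a syntactic check that computes, hence `refl` for concrete code.
frame : ∀ {q p d M} (c : Code q p d) x → writes c (toℕ x) ≡ false → ∀ {ρ s P} →
  WP M c ρ s P → WP M c ρ s (λ s′ → P s′ × (∀ a → s′ x a ≡ s x a))
frame nop x w p = p , λ _ → refl
frame (set y a e) x w {ρ} {s} (l , p) = l , p , λ b → unset s w b
frame (c₁ ⨟ c₂) x w p with ∨-false {writes c₁ (toℕ x)} w
... | w₁ , w₂ = wp-mono c₁ (λ s (p , e) → wp-mono c₂ (λ s (p , e′) → p , λ a → trans (e′ a) (e a)) (frame c₂ x w₂ p)) (frame c₁ x w₁ p)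
frame (when e c₁ c₂) x w (f , g) with ∨-false {writes c₁ (toℕ x)} w
... | w₁ , w₂ = (λ n → frame c₁ x w₁ (f n)) , λ z → frame c₂ x w₂ (g z)
frame {M = M} (for {d} i c) x w {ρ} {s} {P} p = loop 0 (ρ (toℕ i)) p
  where
  loop : ∀ j N {s} → wpLoop (λ j → WP M c (ρ [ d ↦ j ])) j N s P →
    wpLoop (λ j → WP M c (ρ [ d ↦ j ])) j N s (λ s′ → P s′ × (∀ a → s′ x a ≡ s x a))
  loop j zero    p = p , λ _ → refl
  loop j (suc N) p = wp-mono c (λ s (p , e) → wpLoop-mono (wp-mono c) (suc j) N
    (λ s (p , e′) → p , λ a → trans (e′ a) (e a)) (loop (suc j) N p)) (frame c x w p)

-- Compilation to the machine.

-- Array x of the program is spread over the cells b + (1 + x) + a Q with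
-- Q = 1 + q; the variables occupy the cells b + i Q. The base address b is
-- kept in cell 3.
module Compile (q : ℕ) where

  Q : ℕ
  Q = suc q

  base : Exp
  base = mem (lit 3)

  varCell : ℕ → Exp
  varCell l = base ⊕ (lit 0 ⊕ lit l ⊗ lit Q)

  ⌜_⌝ : ∀ {d} → Term q d → Exp
  arrayCell : ∀ {d} → Fin q → Term q d → Exp
  ⌜ num a ⌝        = lit a
  ⌜ var i ⌝        = mem (varCell (toℕ i))
  ⌜ get x a ⌝      = mem (arrayCell x a)
  ⌜ op plus a b ⌝  = ⌜ a ⌝ ⊕ ⌜ b ⌝
  ⌜ op minus a b ⌝ = ⌜ a ⌝ ⊖ ⌜ b ⌝
  ⌜ op times a b ⌝ = ⌜ a ⌝ ⊗ ⌜ b ⌝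
  ⌜ op over a b ⌝  = ⌜ a ⌝ ⊘ ⌜ b ⌝
  arrayCell x a = base ⊕ (lit (suc (toℕ x)) ⊕ ⌜ a ⌝ ⊗ lit Q)

  loopTest : ∀ {p} → ℕ → Fin p → Exp
  loopTest d i = mem (varCell (toℕ i)) ⊖ mem (varCell d)

  increment : ℕ → Program
  increment d = varCell d ≔ mem (varCell d) ⊕ lit 1

  ⟪_⟫ : ∀ {p d} → Code q p d → Program
  ⟪ nop ⟫          = skip
  ⟪ set x a e ⟫    = arrayCell x a ≔ ⌜ e ⌝
  ⟪ c₁ ⨟ c₂ ⟫      = ⟪ c₁ ⟫ ⨾ ⟪ c₂ ⟫
  ⟪ when e c₁ c₂ ⟫ = cond ⌜ e ⌝ ⟪ c₁ ⟫ ⟪ c₂ ⟫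
  ⟪ for {d} i c ⟫  = (varCell d ≔ lit 0) ⨾ while (loopTest d i) (⟪ c ⟫ ⨾ increment d)

  costOf : Program → ℕ
  costOf (e₁ ≔ e₂) = suc (cost e₁ + cost e₂)
  costOf _         = 0

  -- An upper bound only: a conditional is charged for both branches.
  time : ∀ {p d} → Code q p d → Env → ℕ
  time nop            π = 1
  time c@(set x a e)  π = costOf ⟪ c ⟫
  time (c₁ ⨟ c₂)      π = time c₁ π + time c₂ π
  time (when e c₁ c₂) π = suc (cost ⌜ e ⌝ + (time c₁ π + time c₂ π))
  time (for {d} i c)  π = costOf (varCell d ≔ lit 0) + (suc (cost (loopTest d i)) +
    π (toℕ i) * suc (cost (loopTest d i) + (time c π + costOf (increment d))))

  -- A lower bound is needed for one idle loop only, so all other code may be given 0.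
  minTime : ∀ {p d} → Code q p d → Env → ℕ
  minTime (for i c) π = π (toℕ i)
  minTime _         π = 0

  cell : (b r a : ℕ) → ℕ
  cell b r a = b + (r + a * Q)

  cell-injective : ∀ {b r a r′ a′} → r < Q → r′ < Q → cell b r a ≡ cell b r′ a′ → r ≡ r′ × a ≡ a′
  cell-injective {b} {r} {a} {r′} {a′} r< r′< e =
    trans (sym (mod-digit a r<)) (trans (cong (_mod Q) e′) (mod-digit a′ r′<)) ,
    trans (sym (div-digit a r<)) (trans (cong (_div Q) e′) (div-digit a′ r′<))
    where
    e′ : r + a * Q ≡ r′ + a′ * Q
    e′ = +-cancelˡ-≡ b _ _ e

  -- `3 < b` protects cell 3, which holds the base address, from all writes of compiled code.
  record Represents (b d : ℕ) (σ : Memory) (ρ : Env) (s : Store q) : Set where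
    field
      3<b    : 3 < b
      atBase : σ 3 ≡ b
      vars   : ∀ l → l < d → σ (cell b 0 l) ≡ ρ l
      arrays : ∀ x a → σ (cell b (suc (toℕ x)) a) ≡ s x a

  open Represents public

  cell≢3 : ∀ {b} r a → 3 < b → 3 ≢ cell b r a
  cell≢3 r a 3<b e = <⇒≱ 3<b (≤-trans (m≤m+n _ _) (≤-reflexive (sym e)))

  set-var : ∀ {b d σ ρ s} v → Represents b d σ ρ s → Represents b (suc d) (σ [ cell b 0 d ↦ v ]) (ρ [ d ↦ v ]) s
  set-var {b} {d} {σ} {ρ} {s} v R = record
    { 3<b = 3<b R
    ; atBase = trans (unwritten σ (cell≢3 0 d (3<b R))) (atBase R)
    ; vars = vs
    ; arrays = λ x a → trans (unwritten σ λ e → case proj₁ (cell-injective {b} {suc (toℕ x)} {a} {0} {d} (s≤s (toℕ<n x)) z<s e) of λ ()) (arrays R x a)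
    }
    where
    vs : ∀ l → l < suc d → (σ [ cell b 0 d ↦ v ]) (cell b 0 l) ≡ (ρ [ d ↦ v ]) l
    vs l l≤d with m≤n⇒m<n∨m≡n (≤-pred l≤d)
    ... | inj₂ refl = trans (written σ _ v) (sym (written ρ d v))
    ... | inj₁ l<d  = trans (unwritten σ λ e → <⇒≢ l<d (proj₂ (cell-injective {b} {0} {l} {0} {d} z<s z<s e)))
                        (trans (vars R l l<d) (sym (unwritten ρ (<⇒≢ l<d))))

  forget : ∀ {b d σ ρ s v} → Represents b (suc d) σ (ρ [ d ↦ v ]) s → Represents b d σ ρ s
  forget {ρ = ρ} R = record
    { 3<b = 3<b R ; atBase = atBase R ; arrays = arrays R
    ; vars = λ l l<d → trans (vars R l (≤-trans l<d (n≤1+n _))) (unwritten ρ (<⇒≢ l<d)) }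

  set-array : ∀ {b d σ ρ s} x a v → Represents b d σ ρ s →
    Represents b d (σ [ cell b (suc (toℕ x)) a ↦ v ]) ρ (s [ x ∙ a ↦ v ])
  set-array {b} {d} {σ} {ρ} {s} x a v R = record
    { 3<b = 3<b R
    ; atBase = trans (unwritten σ (cell≢3 (suc (toℕ x)) a (3<b R))) (atBase R)
    ; vars = λ l l<d → trans (unwritten σ λ e → case proj₁ (cell-injective {b} {0} {l} {suc (toℕ x)} {a} z<s (s≤s (toℕ<n x)) e) of λ ()) (vars R l l<d)
    ; arrays = as
    }
    where
    as : ∀ y c → (σ [ cell b (suc (toℕ x)) a ↦ v ]) (cell b (suc (toℕ y)) c) ≡ (s [ x ∙ a ↦ v ]) y c
    as y c with toℕ y ≟ toℕ x
    ... | no y≢x rewrite ≡ᵇ-false y≢x = trans (unwritten σ λ e → y≢x (suc-injective (proj₁ (cell-injective {b} {suc (toℕ y)} {c} {suc (toℕ x)} {a} (s≤s (toℕ<n y)) (s≤s (toℕ<n x)) e)))) (arrays R y c)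
    ... | yes y≡x rewrite y≡x | ≡ᵇ-true (toℕ x) with c ≟ a
    ...   | yes refl rewrite ≡ᵇ-true c = written σ _ v
    ...   | no c≢a rewrite ≡ᵇ-false c≢a = trans (unwritten σ λ e → c≢a (proj₂ (cell-injective {b} {suc (toℕ x)} {c} {suc (toℕ x)} {a} (s≤s (toℕ<n x)) (s≤s (toℕ<n x)) e)))
              (trans (cong (λ z → σ (cell b (suc z) c)) (sym y≡x)) (arrays R y c))

  varCell-value : ∀ {b d σ ρ s} → Represents b d σ ρ s → ∀ l → ⟦ varCell l ⟧exp σ ≡ cell b 0 l
  varCell-value R l = cong (_+ (0 + l * Q)) (atBase R)

  term-value : ∀ {b d σ ρ s} → Represents b d σ ρ s → ∀ e → ⟦ ⌜ e ⌝ ⟧exp σ ≡ ⟦_⟧term {q} {d} e ρ s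
  arrayCell-value : ∀ {b d σ ρ s} → Represents b d σ ρ s → ∀ x a → ⟦ arrayCell x a ⟧exp σ ≡ cell b (suc (toℕ x)) (⟦_⟧term {q} {d} a ρ s)
  term-value R (num a)        = refl
  term-value {σ = σ} R (var i)        = trans (cong σ (varCell-value R (toℕ i))) (vars R (toℕ i) (toℕ<n i))
  term-value {σ = σ} R (get x a)      = trans (cong σ (arrayCell-value R x a)) (arrays R x _)
  term-value R (op plus a b)  = cong₂ _+_ (term-value R a) (term-value R b)
  term-value R (op minus a b) = cong₂ _∸_ (term-value R a) (term-value R b)
  term-value R (op times a b) = cong₂ _*_ (term-value R a) (term-value R b)
  term-value R (op over a b)  = cong₂ _div_ (term-value R a) (term-value R b)
  arrayCell-value R x a = cong₂ (λ u v → u + (suc (toℕ x) + v * Q)) (atBase R) (term-value R a)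

  module Simulate {M : ℕ} (2≤M : 2 ≤ M) where

    record Simulation (P : Program) (b d : ℕ) (σ : Memory) (ρ : Env) (lo hi : ℕ) (Post : Store q → Set) : Set where
      constructor simulation
      field
        {σ′} : Memory
        {s′} : Store q
        {t w} : ℕ
        run  : P , σ ⇓ σ′ [ t , w ]
        rep  : Represents b d σ′ ρ s′
        bd   : Below M σ′
        post : Post s′
        lo≤t : lo ≤ t
        t≤hi : t ≤ hi
        w≤   : w ≤ M ^ programDegree P

    private
      up : ∀ {i j x} → i ≤ j → x ≤ M ^ i → x ≤ M ^ j
      up i≤j h = ≤-trans h (^-monoʳ-≤ M {{>-nonZero (≤-trans (s≤s z≤n) 2≤M)}} i≤j)

    assign-peak : ∀ {σ} → Below M σ → ∀ e₁ e₂ → peak e₁ σ ⊔ peak e₂ σ ≤ M ^ programDegree (e₁ ≔ e₂)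
    assign-peak bd e₁ e₂ = ⊔-lub (pow-ˡ {degree e₁} (degree e₂) (peak-≤ e₁)) (pow-ʳ (degree e₁) (peak-≤ e₂))
      where open Degree 2≤M bd

    seq-peak : ∀ P Q {w w′} → w ≤ M ^ programDegree P → w′ ≤ M ^ programDegree Q → w ⊔ w′ ≤ M ^ programDegree (P ⨾ Q)
    seq-peak P Q h h′ = ⊔-lub (up (m≤m+n (programDegree P) _) h) (up (m≤n+m _ (programDegree P)) h′)

    assign-var : ∀ {b d σ ρ s} → Represents b d σ ρ s → Below M σ → ∀ e v → ⟦ e ⟧exp σ ≡ v → v ≤ M →
      Σ[ w ∈ ℕ ] ((varCell d ≔ e) , σ ⇓ σ [ cell b 0 d ↦ v ] [ costOf (varCell d ≔ e) , w ])
        × Represents b (suc d) (σ [ cell b 0 d ↦ v ]) (ρ [ d ↦ v ]) s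
        × Below M (σ [ cell b 0 d ↦ v ]) × w ≤ M ^ programDegree (varCell d ≔ e)
    assign-var {d = d} {σ} R bd e v refl v≤M = _ ,
      subst (λ z → (varCell d ≔ e) , σ ⇓ σ [ z ↦ v ] [ costOf (varCell d ≔ e) , peak (varCell d) σ ⊔ peak e σ ]) (varCell-value R d) assign ,
      set-var v R , below-write bd v≤M , assign-peak bd (varCell d) e

    -- `ρ` contains the loop counters as well, whereas `π` fixes only the parameters; so the time
    -- bound of a body is the same in all iterations.
    simulate : ∀ {p d b σ ρ s Post} (π : Env) (c : Code q p d) → p ≤ d → (∀ l → l < p → ρ l ≡ π l) →
      Represents b d σ ρ s → Below M σ → WP M c ρ s Post →
      Simulation ⟪ c ⟫ b d σ ρ (minTime c π) (time c π) Post

    simulateLoop : ∀ {p d b ρ Post} (π : Env) (i : Fin p) (c : Code q p (suc d)) → p ≤ d → (∀ l → l < p → ρ l ≡ π l) →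
      ∀ N j {σ s} → j + N ≡ ρ (toℕ i) → Represents b (suc d) σ (ρ [ d ↦ j ]) s → Below M σ →
      wpLoop (λ j → WP M c (ρ [ d ↦ j ])) j N s Post →
      Simulation (while (loopTest d i) (⟪ c ⟫ ⨾ increment d)) b d σ ρ N
        (suc (cost (loopTest d i)) + N * suc (cost (loopTest d i) + (time c π + costOf (increment d)))) Post
    simulateLoop {p} {d} {b} {ρ} {Post} π i c p≤d agree N j {σ} {s} end R bd wp = loop N wp end
      where
      test : ⟦ loopTest d i ⟧exp σ ≡ ρ (toℕ i) ∸ j
      test = cong₂ _∸_
        (trans (cong σ (varCell-value R (toℕ i))) (trans (vars R (toℕ i) (≤-trans i<d (n≤1+n d))) (unwritten ρ (<⇒≢ i<d))))
        (trans (cong σ (varCell-value R d)) (trans (vars R d ≤-refl) (written ρ d j)))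
        where
        i<d : toℕ i < d
        i<d = ≤-trans (toℕ<n i) p≤d
      P = ⟪ c ⟫ ⨾ increment d
      testPeak : peak (loopTest d i) σ ≤ M ^ programDegree (while (loopTest d i) P)
      testPeak = up (m≤m+n (degree (loopTest d i)) (programDegree P)) (Degree.peak-≤ 2≤M bd (loopTest d i))
      loop : ∀ N → wpLoop (λ j → WP M c (ρ [ d ↦ j ])) j N s Post → j + N ≡ ρ (toℕ i) →
        Simulation (while (loopTest d i) (⟪ c ⟫ ⨾ increment d)) b d σ ρ N
        (suc (cost (loopTest d i)) + N * suc (cost (loopTest d i) + (time c π + costOf (increment d)))) Post
      loop zero wp end = simulation
        (while-false (trans test (trans (cong (_∸ j) (trans (sym end) (+-identityʳ j))) (n∸n≡0 j))))
        (forget R) bd wp z≤n (m≤m+n _ 0) testPeak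
      loop (suc N) wp end
        with simulate π c (≤-trans p≤d (n≤1+n d)) (λ l l<p → trans (unwritten ρ (<⇒≢ (≤-trans l<p p≤d))) (agree l l<p)) R bd wp
      ... | simulation {σ₁} {s₁} {t₁} {w₁} run₁ R₁ bd₁ wp₁ lo₁ hi₁ w₁≤
        with assign-var (forget R₁) bd₁ (mem (varCell d) ⊕ lit 1) (suc j)
               (trans (cong (_+ 1) (trans (cong σ₁ (varCell-value R₁ d)) (trans (vars R₁ d ≤-refl) (written ρ d j)))) (+-comm j 1))
               -- The incremented counter is at most the loop bound, which itself occupies a memory
               -- cell and hence is at most `M`.
               (≤-trans (≤-trans (≤-trans (≤-reflexive (+-comm 1 j)) (+-monoʳ-≤ j (s≤s z≤n))) (≤-reflexive end))
                 (≤-trans (≤-reflexive (sym (trans (vars R (toℕ i) (≤-trans (≤-trans (toℕ<n i) p≤d) (n≤1+n d))) (unwritten ρ (<⇒≢ (≤-trans (toℕ<n i) p≤d)))))) (bd _)))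
      ... | w₂ , run₂ , R₂ , bd₂ , w₂≤
        with simulateLoop π i c p≤d agree N (suc j) (trans (sym (+-suc j N)) end) R₂ bd₂ wp₁
      ... | simulation {t = t₃} {w₃} run₃ R₃ bd₃ post₃ lo₃ hi₃ w₃≤ = simulation
        (while-true (λ e → case trans (sym e) (trans test (trans (cong (_∸ j) (sym end)) (m+n∸m≡n j (suc N)))) of λ ())
          (seq run₁ run₂) run₃)
        R₃ bd₃ post₃
        (s≤s (≤-trans lo₃ (≤-trans (m≤n+m t₃ _) (m≤n+m _ (cost (loopTest d i))))))
        (begin
          suc (ct + ((t₁ + inc) + t₃))
            ≤⟨ s≤s (+-monoʳ-≤ ct (+-mono-≤ (+-monoˡ-≤ inc hi₁) hi₃)) ⟩
          suc (ct + ((time c π + inc) + (suc ct + N * body)))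
            ≡⟨ l ct (time c π + inc) (N * body) ⟩
          suc ct + suc N * body ∎)
        (⊔-lub testPeak (⊔-lub (up (m≤n+m (programDegree P) (degree (loopTest d i))) (seq-peak ⟪ c ⟫ (increment d) w₁≤ w₂≤)) w₃≤))
        where
        open ≤-Reasoning
        ct = cost (loopTest d i)
        inc = costOf (increment d)
        body = suc (ct + (time c π + inc))
        l : ∀ a b n → suc (a + (b + (suc a + n))) ≡ suc a + (suc (a + b) + n)
        l = solve-∀

    simulate π nop p≤d agree R bd wp = simulation skip R bd wp z≤n ≤-refl z≤n
    simulate {σ = σ} {ρ} {s} π c@(set x a e) p≤d agree R bd (v≤M , post) = simulation
      (subst₂ (λ z v → ⟪ c ⟫ , σ ⇓ σ [ z ↦ v ] [ costOf ⟪ c ⟫ , peak (arrayCell x a) σ ⊔ peak ⌜ e ⌝ σ ])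
        (arrayCell-value R x a) (term-value R e) assign)
      (set-array x _ _ R) (below-write bd v≤M) post z≤n ≤-refl (assign-peak bd (arrayCell x a) ⌜ e ⌝)
    simulate π (c₁ ⨟ c₂) p≤d agree R bd wp with simulate π c₁ p≤d agree R bd wp
    ... | simulation run₁ R₁ bd₁ wp₁ lo₁ hi₁ w₁≤ with simulate π c₂ p≤d agree R₁ bd₁ wp₁
    ... | simulation run₂ R₂ bd₂ post lo₂ hi₂ w₂≤ =
      simulation (seq run₁ run₂) R₂ bd₂ post z≤n (+-mono-≤ hi₁ hi₂) (seq-peak ⟪ c₁ ⟫ ⟪ c₂ ⟫ w₁≤ w₂≤)
    simulate {σ = σ} {ρ} {s} π (when e c₁ c₂) p≤d agree R bd (f , g) with ⟦ e ⟧term ρ s ≟ 0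
    ... | yes e≡0 with simulate π c₂ p≤d agree R bd (g e≡0)
    ...   | simulation run₁ R₁ bd₁ post lo hi w≤ = simulation (cond-false (trans (term-value R e) e≡0) run₁) R₁ bd₁ post z≤n
      (s≤s (+-monoʳ-≤ (cost ⌜ e ⌝) (≤-trans hi (m≤n+m _ (time c₁ π)))))
      (⊔-lub (up (m≤m+n (degree ⌜ e ⌝) _) (Degree.peak-≤ 2≤M bd ⌜ e ⌝))
        (up (≤-trans (m≤n+m (programDegree ⟪ c₂ ⟫) (programDegree ⟪ c₁ ⟫)) (m≤n+m _ (degree ⌜ e ⌝))) w≤))
    simulate {σ = σ} {ρ} {s} π (when e c₁ c₂) p≤d agree R bd (f , g) | no e≢0 with simulate π c₁ p≤d agree R bd (f e≢0)
    ...   | simulation run₁ R₁ bd₁ post lo hi w≤ = simulation (cond-true (λ z → e≢0 (trans (sym (term-value R e)) z)) run₁) R₁ bd₁ post z≤n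
      (s≤s (+-monoʳ-≤ (cost ⌜ e ⌝) (≤-trans hi (m≤m+n _ (time c₂ π)))))
      (⊔-lub (up (m≤m+n (degree ⌜ e ⌝) _) (Degree.peak-≤ 2≤M bd ⌜ e ⌝))
        (up (≤-trans (m≤m+n (programDegree ⟪ c₁ ⟫) (programDegree ⟪ c₂ ⟫)) (m≤n+m _ (degree ⌜ e ⌝))) w≤))
    simulate {d = d} {ρ = ρ} π (for i c) p≤d agree R bd wp with assign-var R bd (lit 0) 0 refl z≤n
    ... | w₀ , run₀ , R₀ , bd₀ , w₀≤ with simulateLoop π i c p≤d agree (ρ (toℕ i)) 0 refl R₀ bd₀ wp
    ... | simulation {t = t₁} run₁ R₁ bd₁ post lo hi w≤ rewrite agree (toℕ i) (toℕ<n i) =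
      simulation (seq run₀ run₁) R₁ bd₁ post (≤-trans lo (m≤n+m t₁ _)) (+-monoʳ-≤ (costOf (varCell d ≔ lit 0)) hi)
        (seq-peak (varCell d ≔ lit 0) (while (loopTest d i) (⟪ c ⟫ ⨾ increment d)) w₀≤ w≤)

  -- Scripts: stages of code with computed parameters.

  -- Bounds such as `Hc ^ R` have to be computed before a loop can use them; `bind` turns a computed
  -- value into a parameter of all later stages.
  data Script : ℕ → Set where
    end   : ∀ {p} → Script p
    bind  : ∀ {p} → Term q p → Script (suc p) → Script p
    stage : ∀ {p} → Code q p p → Script p → Script p

  ⟪_⟫script : ∀ {p} → Script p → Program
  ⟪ end ⟫script          = skip
  ⟪ bind {p} e k ⟫script = (varCell p ≔ ⌜ e ⌝) ⨾ ⟪ k ⟫script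
  ⟪ stage c k ⟫script    = ⟪ c ⟫ ⨾ ⟪ k ⟫script

  -- The time is at most X up to the factor below, which depends on the code
  -- only.
  Fits : ∀ {p d} → Code q p d → Env → ℕ → Set
  Fits nop            π X = 1 ≤ X
  Fits (set x a e)    π X = 1 ≤ X
  Fits (c₁ ⨟ c₂)      π X = Fits c₁ π X × Fits c₂ π X
  Fits (when e c₁ c₂) π X = Fits c₁ π X × Fits c₂ π X
  Fits (for i c)      π X = 1 ≤ X × ∃[ Y ] Fits c π Y × π (toℕ i) * Y ≤ X

  factor : ∀ {p d} → Code q p d → ℕ
  factor nop            = 1
  factor c@(set x a e)  = costOf ⟪ c ⟫
  factor (c₁ ⨟ c₂)      = factor c₁ + factor c₂
  factor (when e c₁ c₂) = suc (cost ⌜ e ⌝ + (factor c₁ + factor c₂))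
  factor (for {d} i c)  = costOf (varCell d ≔ lit 0) + (suc (cost (loopTest d i)) +
    suc (cost (loopTest d i) + (factor c + costOf (increment d))))

  fits⇒1≤ : ∀ {p d} (c : Code q p d) {π X} → Fits c π X → 1 ≤ X
  fits⇒1≤ nop            h       = h
  fits⇒1≤ (set x a e)    h       = h
  fits⇒1≤ (c₁ ⨟ c₂)      (h , _) = fits⇒1≤ c₁ h
  fits⇒1≤ (when e c₁ c₂) (h , _) = fits⇒1≤ c₁ h
  fits⇒1≤ (for i c)      (h , _) = h

  private
    scale : ∀ a {X} → 1 ≤ X → a ≤ a * X
    scale a {X} 1≤X = m≤m*n a X {{>-nonZero 1≤X}}

  time-fits : ∀ {p d} (c : Code q p d) {π X} → Fits c π X → time c π ≤ factor c * X
  time-fits nop            h         = scale 1 h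
  time-fits c@(set x a e)  h         = scale (costOf ⟪ c ⟫) h
  time-fits (c₁ ⨟ c₂) {X = X} (h₁ , h₂) = ≤-trans (+-mono-≤ (time-fits c₁ h₁) (time-fits c₂ h₂))
    (≤-reflexive (sym (*-distribʳ-+ X (factor c₁) (factor c₂))))
  time-fits (when e c₁ c₂) {π} {X} (h₁ , h₂) = begin
    suc (cost ⌜ e ⌝) + (time c₁ π + time c₂ π)
      ≤⟨ +-mono-≤ (scale (suc (cost ⌜ e ⌝)) (fits⇒1≤ c₁ h₁)) (+-mono-≤ (time-fits c₁ h₁) (time-fits c₂ h₂)) ⟩
    suc (cost ⌜ e ⌝) * X + (factor c₁ * X + factor c₂ * X)
      ≡⟨ l (suc (cost ⌜ e ⌝)) (factor c₁) (factor c₂) X ⟩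
    (suc (cost ⌜ e ⌝) + (factor c₁ + factor c₂)) * X ∎
    where
    open ≤-Reasoning
    l : ∀ a b c x → a * x + (b * x + c * x) ≡ (a + (b + c)) * x
    l = solve-∀
  time-fits (for {d} i c) {π} {X} (1≤X , Y , h , iY≤X) = begin
    a + (b + π (toℕ i) * (b + (time c π + e)))
      ≤⟨ +-mono-≤ (scale a 1≤X) (+-mono-≤ (scale b 1≤X) (≤-trans
           (*-monoʳ-≤ (π (toℕ i)) (+-mono-≤ (scale b 1≤Y) (+-mono-≤ (time-fits c h) (scale e 1≤Y))))
           (≤-trans (≤-reflexive (l₁ (π (toℕ i)) b (factor c) e Y)) (*-monoʳ-≤ (b + (factor c + e)) iY≤X)))) ⟩
    a * X + (b * X + (b + (factor c + e)) * X)
      ≡⟨ l₂ a b (b + (factor c + e)) X ⟩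
    (a + (b + (b + (factor c + e)))) * X ∎
    where
    open ≤-Reasoning
    a = costOf (varCell d ≔ lit 0)
    b = suc (cost (loopTest d i))
    e = costOf (increment d)
    1≤Y = fits⇒1≤ c h
    l₁ : ∀ i b f e Y → i * (b * Y + (f * Y + e * Y)) ≡ (b + (f + e)) * (i * Y)
    l₁ = solve-∀
    l₂ : ∀ a b c X → a * X + (b * X + c * X) ≡ (a + (b + c)) * X
    l₂ = solve-∀

  scriptFactor : ∀ {p} → Script p → ℕ
  scriptFactor end            = 1
  scriptFactor (bind {p} e k) = costOf (varCell p ≔ ⌜ e ⌝) + scriptFactor k
  scriptFactor (stage c k)    = factor c + scriptFactor k

  -- The postcondition also receives a lower bound on the running time, which
  -- is needed since words may only be as long as the running time permits.
  WPScript : ∀ {p} → (M X : ℕ) → Script p → Env → Store q → (Store q → ℕ → Set) → Set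
  WPScript M X end            ρ s P = P s 0
  WPScript M X (bind {p} e k) ρ s P = ⟦ e ⟧term ρ s ≤ M × WPScript M X k (ρ [ p ↦ ⟦ e ⟧term ρ s ]) s P
  WPScript M X (stage c k)    ρ s P = Fits c ρ X × WP M c ρ s λ s′ →
    WPScript M X k ρ s′ λ s″ lo → P s″ (minTime c ρ + lo)

  -- As a record, so that comparing two such types does not unfold them.
  record Verified {p} (M X : ℕ) (k : Script p) (ρ : Env) (s : Store q) (P : Store q → ℕ → Set) : Set where
    constructor verified
    field wp : WPScript M X k ρ s P

  open Verified public

  verified-bind : ∀ {p M X} {e : Term q p} {k ρ s P} → ⟦ e ⟧term ρ s ≤ M →
    Verified M X k (ρ [ p ↦ ⟦ e ⟧term ρ s ]) s P → Verified M X (bind e k) ρ s P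
  verified-bind v≤M (verified h) = verified (v≤M , h)

  verified-stage : ∀ {p M X} {c : Code q p p} {k ρ s P} → Fits c ρ X →
    WP M c ρ s (λ s′ → Verified M X k ρ s′ (λ s″ lo → P s″ (minTime c ρ + lo))) → Verified M X (stage c k) ρ s P
  verified-stage {c = c} fit h = verified (fit , wp-mono c (λ _ → wp) h)

  module _ {M X : ℕ} (2≤M : 2 ≤ M) (1≤X : 1 ≤ X) where
    open Simulate 2≤M

    simulateScript : ∀ {p b σ ρ s} (k : Script p) {P : Store q → ℕ → Set} →
      Represents b p σ ρ s → Below M σ → WPScript M X k ρ s P →
      Σ[ σ′ ∈ Memory ] Σ[ s′ ∈ Store q ] Σ[ t ∈ ℕ ] Σ[ w ∈ ℕ ] Σ[ lo ∈ ℕ ]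
        (⟪ k ⟫script , σ ⇓ σ′ [ t , w ]) × (∃[ ρ′ ] Represents b 0 σ′ ρ′ s′) × Below M σ′ ×
        P s′ lo × lo ≤ t × t ≤ scriptFactor k * X × w ≤ M ^ programDegree ⟪ k ⟫script
    simulateScript {ρ = ρ} end R bd wp = _ , _ , 1 , 0 , 0 , skip ,
      (ρ , record { 3<b = 3<b R ; atBase = atBase R ; vars = λ _ () ; arrays = arrays R }) , bd , wp , z≤n , scale 1 1≤X , z≤n
    simulateScript {p} {b} {σ} (bind e k) R bd (v≤M , wp) with assign-var R bd ⌜ e ⌝ _ (term-value R e) v≤M
    ... | w₁ , run₁ , R₁ , bd₁ , w₁≤ with simulateScript k R₁ bd₁ wp
    ... | σ′ , s′ , t , w , lo , run , R′ , bd′ , post , lo≤ , ≤hi , w≤ =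
      σ′ , s′ , _ , _ , lo , seq run₁ run , R′ , bd′ , post , ≤-trans lo≤ (m≤n+m t _) ,
      ≤-trans (+-mono-≤ (scale (costOf (varCell p ≔ ⌜ e ⌝)) 1≤X) ≤hi) (≤-reflexive (sym (*-distribʳ-+ X (costOf (varCell p ≔ ⌜ e ⌝)) (scriptFactor k)))) ,
      seq-peak (varCell p ≔ ⌜ e ⌝) ⟪ k ⟫script w₁≤ w≤
    simulateScript {ρ = ρ} (stage c k) R bd (fit , wp) with simulate ρ c ≤-refl (λ _ _ → refl) R bd wp
    ... | simulation run₁ R₁ bd₁ wp₁ lo₁ hi₁ w₁≤ with simulateScript k R₁ bd₁ wp₁
    ... | σ′ , s′ , t , w , lo , run , R′ , bd′ , post , lo≤ , ≤hi , w≤ =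
      σ′ , s′ , _ , _ , _ , seq run₁ run , R′ , bd′ , post , +-mono-≤ lo₁ lo≤ ,
      ≤-trans (+-mono-≤ (≤-trans hi₁ (time-fits c fit)) ≤hi) (≤-reflexive (sym (*-distribʳ-+ X (factor c) (scriptFactor k)))) ,
      seq-peak ⟪ c ⟫ ⟪ k ⟫script w₁≤ w≤

    simulateVerified : ∀ {p b σ ρ s} (k : Script p) {P : Store q → ℕ → Set} →
      Represents b p σ ρ s → Below M σ → Verified M X k ρ s P →
      Σ[ σ′ ∈ Memory ] Σ[ s′ ∈ Store q ] Σ[ t ∈ ℕ ] Σ[ w ∈ ℕ ] Σ[ lo ∈ ℕ ]
        (⟪ k ⟫script , σ ⇓ σ′ [ t , w ]) × (∃[ ρ′ ] Represents b 0 σ′ ρ′ s′) × Below M σ′ ×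
        P s′ lo × lo ≤ t × t ≤ scriptFactor k * X × w ≤ M ^ programDegree ⟪ k ⟫script
    simulateVerified k R bd (verified wp) = simulateScript k R bd wp

-- The encoded input in memory.

Holds : Memory → ℕ → List ℕ → Set
Holds f p []       = ⊤
Holds f p (x ∷ xs) = f p ≡ x × Holds f (suc p) xs

holds-++ : ∀ {f} p xs {ys} → Holds f p (xs ++ ys) → Holds f p xs × Holds f (p + length xs) ys
holds-++ {f} p []       {ys} h       = tt , subst (λ z → Holds f z ys) (sym (+-identityʳ p)) h
holds-++ {f} p (x ∷ xs) {ys} (e , h) with holds-++ (suc p) xs h
... | h₁ , h₂ = (e , h₁) , subst (λ z → Holds f z ys) (sym (+-suc p (length xs))) h₂

holds-suc : ∀ {f} p xs → Holds (f ∘ suc) p xs → Holds f (suc p) xs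
holds-suc p []       h       = tt
holds-suc p (x ∷ xs) (e , h) = e , holds-suc (suc p) xs h

holds-load : ∀ xs → Holds (load xs) 0 xs
holds-load []       = tt
holds-load (x ∷ xs) = refl , holds-suc 0 xs (holds-load xs)

holds-input : ∀ {n} (C : NonCancelingCircuit n) r k → Holds (input C r k) 4 (encodeGates (gates C))
holds-input C r k = holds-suc 3 xs (holds-suc 2 xs (holds-suc 1 xs (holds-suc 0 xs (holds-load xs))))
  where xs = encodeGates (gates C)

length-encodeGate : ∀ {n m} (g : Gate n m) → length (encodeGate g) ≡ suc (suc (fanIn g))
length-encodeGate (var i)         = refl
length-encodeGate (add (i ∷⁺ is)) = cong (suc ∘ suc ∘ suc) (length-map toℕ is)
length-encodeGate (mul (i ∷⁺ is)) = cong (suc ∘ suc ∘ suc) (length-map toℕ is)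

-- The encoding spends one cell more per gate than `gatesSize` counts. The program obtains `size C`
-- from this equation by subtraction.
length-encodeGates : ∀ {n m} (gs : Gates n m) → length (encodeGates gs) ≡ gatesSize gs + m
length-encodeGates ∅ = refl
length-encodeGates {m = suc m} (gs ▷ g) = begin
  length (encodeGates gs ++ encodeGate g)           ≡⟨ length-++ (encodeGates gs) ⟩
  length (encodeGates gs) + length (encodeGate g)   ≡⟨ cong₂ _+_ (length-encodeGates gs) (length-encodeGate g) ⟩
  gatesSize gs + m + suc (suc (fanIn g))            ≡⟨ l (gatesSize gs) m (suc (fanIn g)) ⟩
  gatesSize gs + suc (fanIn g) + suc m ∎
  where
  open ≡-Reasoning
  l : ∀ a m f → a + m + suc f ≡ a + f + suc m
  l = solve-∀

-- Finding the end of the input and moving it into the array layout.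

-- The prologue works on raw memory before any layout exists, so it needs Hoare-style rules of its
-- own.
record Runs (M : ℕ) (P : Program) (σ : Memory) (hi : ℕ) (Post : Memory → Set) : Set where
  constructor runs
  field
    {σ′} : Memory
    {t w} : ℕ
    run  : P , σ ⇓ σ′ [ t , w ]
    bd   : Below M σ′
    post : Post σ′
    t≤hi : t ≤ hi
    w≤   : w ≤ M ^ programDegree P

module RunRules {M : ℕ} (2≤M : 2 ≤ M) where

  up : ∀ {i j x} → i ≤ j → x ≤ M ^ i → x ≤ M ^ j
  up i≤j h = ≤-trans h (^-monoʳ-≤ M {{>-nonZero (≤-trans (s≤s z≤n) 2≤M)}} i≤j)

  assignCost : Exp → Exp → ℕ
  assignCost e₁ e₂ = suc (cost e₁ + cost e₂)

  runs-assign : ∀ {e₁ e₂ σ Post} → Below M σ → ⟦ e₂ ⟧exp σ ≤ M →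
    Post (σ [ ⟦ e₁ ⟧exp σ ↦ ⟦ e₂ ⟧exp σ ]) → Runs M (e₁ ≔ e₂) σ (assignCost e₁ e₂) Post
  runs-assign {e₁} {e₂} bd v≤M post = runs assign (below-write bd v≤M) post ≤-refl
    (⊔-lub (pow-ˡ {degree e₁} (degree e₂) (peak-≤ e₁)) (pow-ʳ (degree e₁) (peak-≤ e₂)))
    where open Degree 2≤M bd

  runs-seq : ∀ {P Q σ h h′ Mid Post} → Runs M P σ h Mid → (∀ {σ′} → Below M σ′ → Mid σ′ → Runs M Q σ′ h′ Post) →
    Runs M (P ⨾ Q) σ (h + h′) Post
  runs-seq {P} {Q} (runs r₁ bd₁ mid t₁ w₁) k with k bd₁ mid
  ... | runs r₂ bd₂ post t₂ w₂ = runs (seq r₁ r₂) bd₂ post (+-mono-≤ t₁ t₂)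
    (⊔-lub (up (m≤m+n (programDegree P) (programDegree Q)) w₁) (up (m≤n+m (programDegree Q) (programDegree P)) w₂))

  runs-cond-true : ∀ {e P Q σ h Post} → Below M σ → ⟦ e ⟧exp σ ≢ 0 → Runs M P σ h Post → Runs M (cond e P Q) σ (suc (cost e + h)) Post
  runs-cond-true {e} {P} {Q} bd n (runs r bd₁ post t w) = runs (cond-true n r) bd₁ post (s≤s (+-monoʳ-≤ (cost e) t))
    (⊔-lub (up (m≤m+n (degree e) _) (Degree.peak-≤ 2≤M bd e)) (up (≤-trans (m≤m+n (programDegree P) (programDegree Q)) (m≤n+m _ (degree e))) w))

  runs-cond-false : ∀ {e P Q σ h Post} → Below M σ → ⟦ e ⟧exp σ ≡ 0 → Runs M Q σ h Post → Runs M (cond e P Q) σ (suc (cost e + h)) Post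
  runs-cond-false {e} {P} {Q} bd n (runs r bd₁ post t w) = runs (cond-false n r) bd₁ post (s≤s (+-monoʳ-≤ (cost e) t))
    (⊔-lub (up (m≤m+n (degree e) _) (Degree.peak-≤ 2≤M bd e)) (up (≤-trans (m≤n+m (programDegree Q) (programDegree P)) (m≤n+m _ (degree e))) w))

  runs-while-true : ∀ {e P σ h h′ Mid Post} → Below M σ → ⟦ e ⟧exp σ ≢ 0 → Runs M P σ h Mid →
    (∀ {σ′} → Below M σ′ → Mid σ′ → Runs M (while e P) σ′ h′ Post) → Runs M (while e P) σ (suc (cost e + (h + h′))) Post
  runs-while-true {e} {P} bd n (runs r₁ bd₁ mid t₁ w₁) k with k bd₁ mid
  ... | runs r₂ bd₂ post t₂ w₂ = runs (while-true n r₁ r₂) bd₂ post (s≤s (+-monoʳ-≤ (cost e) (+-mono-≤ t₁ t₂)))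
    (⊔-lub (up (m≤m+n (degree e) (programDegree P)) (Degree.peak-≤ 2≤M bd e)) (⊔-lub (up (m≤n+m (programDegree P) (degree e)) w₁) w₂))

  runs-while-false : ∀ {e P σ Post} → Below M σ → ⟦ e ⟧exp σ ≡ 0 → Post σ → Runs M (while e P) σ (suc (cost e)) Post
  runs-while-false {e} {P} bd z post = runs (while-false z) bd post ≤-refl (up (m≤m+n (degree e) (programDegree P)) (Degree.peak-≤ 2≤M bd e))

  runs-weaken : ∀ {P σ h h′ Post Post′} → h ≤ h′ → (∀ {σ} → Post σ → Post′ σ) → Runs M P σ h Post → Runs M P σ h′ Post′
  runs-weaken h≤ f (runs r bd post t w) = runs r bd (f post) (≤-trans t h≤) w

module Prologue (q : ℕ) (inputArray gateArray : Fin q) (input≢gate : toℕ inputArray ≢ toℕ gateArray) where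
  open Compile q

  -- Before any cell is free, the end of the input has to be found. The first
  -- gate is a variable, so cell 4 is known to hold 0; while the gates are
  -- scanned it holds c + p W for the number c of gates passed and the
  -- position p, where W = 1 + the number of gates.
  W pointer count : Exp
  W       = mem (lit 3) ⊕ lit 1
  pointer = mem (lit 4) ⊘ W
  count   = mem (lit 4) ⊖ pointer ⊗ W

  advance : Exp → Program
  advance δ = lit 4 ≔ (count ⊕ lit 1) ⊕ (pointer ⊕ δ) ⊗ W

  scanTest : Exp
  scanTest = mem (lit 3) ⊖ count

  scanBody scan : Program
  scanBody = cond (mem pointer) (advance (lit 2 ⊕ mem (pointer ⊕ lit 1))) (advance (lit 2))
  scan     = while scanTest scanBody

  copyTest : Exp
  copyTest = base ⊖ mem base

  copyBody copy : Program
  copyBody = (base ⊕ (lit (suc (toℕ inputArray)) ⊕ mem base ⊗ lit Q) ≔ mem (mem base)) ⨾ (base ≔ mem base ⊕ lit 1)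
  copy     = while copyTest copyBody

  -- The gate count is saved before cell 3 becomes the base address, and cell 4 gets back its
  -- original 0 before the input is copied. The copying loop counts in the cell of variable 0, which
  -- therefore ends up holding the length of the input.
  prologue : Program
  prologue =
    -- Count 1 at position 6: the first gate, a variable, occupies cells 4 and 5.
    (lit 4 ≔ lit 1 ⊕ lit 6 ⊗ W) ⨾
    scan ⨾
    (pointer ⊕ lit (suc (toℕ gateArray)) ≔ mem (lit 3)) ⨾
    (lit 3 ≔ pointer) ⨾
    (lit 4 ≔ lit 0) ⨾
    (base ≔ lit 0) ⨾
    copy

  advanceCost scanCost assignsCost copyCost : ℕ
  advanceCost = suc (1 + cost ((count ⊕ lit 1) ⊕ (pointer ⊕ (lit 2 ⊕ mem (pointer ⊕ lit 1))) ⊗ W))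
  scanCost = suc (cost scanTest + (suc (cost (mem pointer) + advanceCost)))
  assignsCost = suc (cost (base ⊕ (lit (suc (toℕ inputArray)) ⊕ mem base ⊗ lit Q)) + cost (mem (mem base)))
    + suc (cost base + cost (mem base ⊕ lit 1))
  copyCost = suc (cost copyTest + assignsCost)

  module _ {n : ℕ} (C : NonCancelingCircuit n) (r k : ℕ) {M : ℕ} (2≤M : 2 ≤ M)
    (bd₀ : Below M (input C r k)) where

    open RunRules 2≤M

    private
      σ₀ : Memory
      σ₀ = input C r k
      m : ℕ
      m = suc (inner C)

    L : ℕ
    L = 4 + length (encodeGates (gates C))

    record Scanned (c p : ℕ) (σ : Memory) : Set where
      field
        packed : σ 4 ≡ c + p * (m + 1)
        others : ∀ a → a ≢ 4 → σ a ≡ σ₀ a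

    open Scanned

    pointer-of : ∀ {c p σ} → c ≤ m → σ 4 ≡ c + p * (m + 1) → σ 3 ≡ m → ⟦ pointer ⟧exp σ ≡ p
    pointer-of {c} {p} {σ} c≤m e₄ e₃ = trans (cong₂ _div_ e₄ (cong (_+ 1) e₃)) (div-digit p (≤-trans (s≤s c≤m) (≤-reflexive (+-comm 1 m))))

    module _ {c p σ} (c≤m : c ≤ m) (S : Scanned c p σ) where
      W-value : ⟦ W ⟧exp σ ≡ m + 1
      W-value = cong (_+ 1) (others S 3 λ ())
      pointer-value : ⟦ pointer ⟧exp σ ≡ p
      pointer-value = pointer-of {c} {p} {σ} c≤m (packed S) (others S 3 λ ())
      count-value : ⟦ count ⟧exp σ ≡ c
      count-value = trans (cong₂ _∸_ (packed S) (cong₂ _*_ pointer-value W-value)) (m+n∸n≡m c (p * (m + 1)))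

    module _ (hM : (m + 1) * suc L ≤ M) where

      packed-≤ : ∀ {c p} → c ≤ m → p ≤ L → c + p * (m + 1) ≤ M
      packed-≤ {c} {p} c≤m p≤L = ≤-trans (begin
        c + p * (m + 1)      ≤⟨ +-mono-≤ (≤-trans c≤m (m≤m+n m 1)) (*-monoˡ-≤ (m + 1) p≤L) ⟩
        (m + 1) + L * (m + 1) ≡⟨ *-comm (suc L) (m + 1) ⟩
        (m + 1) * suc L ∎) hM
        where open ≤-Reasoning

      runs-advance : ∀ {c p σ} δ v → c < m → p + v ≤ L → Scanned c p σ → Below M σ → ⟦ δ ⟧exp σ ≡ v →
        Runs M (advance δ) σ (suc (1 + cost ((count ⊕ lit 1) ⊕ (pointer ⊕ δ) ⊗ W))) (Scanned (suc c) (p + v))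
      runs-advance {c} {p} {σ} δ v c<m p≤ S bd δ≡ = runs-assign bd (subst (_≤ M) (sym value) (packed-≤ c<m p≤)) (record
        { packed = trans (written σ 4 _) value
        ; others = λ a a≢4 → trans (unwritten σ a≢4) (others S a a≢4) })
        where
        value : ⟦ (count ⊕ lit 1) ⊕ (pointer ⊕ δ) ⊗ W ⟧exp σ ≡ suc c + (p + v) * (m + 1)
        value = cong₂ _+_ (trans (cong (_+ 1) (count-value (<⇒≤ c<m) S)) (+-comm c 1))
          (cong₂ _*_ (cong₂ _+_ (pointer-value (<⇒≤ c<m) S) δ≡) (W-value (<⇒≤ c<m) S))

      runs-scanBody : ∀ {c p σ} (g : Gate n c) → c < m → 6 ≤ p → p + length (encodeGate g) ≤ L → Holds σ₀ p (encodeGate g) →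
        Scanned c p σ → Below M σ → Runs M scanBody σ (suc (cost (mem pointer) + advanceCost)) (Scanned (suc c) (p + length (encodeGate g)))
      runs-scanBody {c} {p} {σ} g c<m 6≤p p≤ h S bd = go g p≤ h
        where
        -- From position 6 on, no read meets the overwritten cell 4.
        at-p : ∀ i → σ (⟦ pointer ⟧exp σ + i) ≡ σ₀ (p + i)
        at-p i = trans (cong (λ z → σ (z + i)) (pointer-value (<⇒≤ c<m) S))
          (others S (p + i) λ e → case ≤-trans 6≤p (≤-trans (m≤m+n p i) (≤-reflexive e)) of λ { (s≤s (s≤s (s≤s (s≤s ())))) })
        tag : ⟦ mem pointer ⟧exp σ ≡ σ₀ p
        tag = trans (cong σ (sym (+-identityʳ _))) (trans (at-p 0) (cong σ₀ (+-identityʳ p)))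
        operands : ∀ l → σ₀ (suc p) ≡ l → σ₀ p ≢ 0 → p + suc (suc l) ≤ L →
          Runs M scanBody σ (suc (cost (mem pointer) + advanceCost)) (Scanned (suc c) (p + suc (suc l)))
        operands l e n p≤ = runs-cond-true bd (λ z → n (trans (sym tag) z))
          (runs-advance (lit 2 ⊕ mem (pointer ⊕ lit 1)) (suc (suc l)) c<m p≤ S bd
            (cong (2 +_) (trans (at-p 1) (trans (cong σ₀ (+-comm p 1)) e))))
        go : (g : Gate n c) → p + length (encodeGate g) ≤ L → Holds σ₀ p (encodeGate g) →
          Runs M scanBody σ (suc (cost (mem pointer) + advanceCost)) (Scanned (suc c) (p + length (encodeGate g)))
        go (var i) p≤ (e , _) = runs-weaken (s≤s (+-monoʳ-≤ (cost (mem pointer)) (lemma))) id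
          (runs-cond-false bd (trans tag e) (runs-advance (lit 2) 2 c<m p≤ S bd refl))
          where
          lemma : suc (1 + cost ((count ⊕ lit 1) ⊕ (pointer ⊕ lit 2) ⊗ W)) ≤ advanceCost
          lemma = ≤ᵇ⇒≤ _ _ tt
        go g@(add is) p≤ (e , e′ , _) rewrite length-encodeGate g = operands _ e′ (λ z → case trans (sym z) e of λ ()) p≤
        go g@(mul is) p≤ (e , e′ , _) rewrite length-encodeGate g = operands _ e′ (λ z → case trans (sym z) e of λ ()) p≤

      pos : ∀ {c} → Gates n c → ℕ
      pos gs = 4 + length (encodeGates gs)

      pos-▷ : ∀ {c} (gs : Gates n c) g → pos (gs ▷ g) ≡ pos gs + length (encodeGate g)
      pos-▷ gs g = cong (4 +_) (length-++ (encodeGates gs))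

      pos≥6 : ∀ {c} (gs : Gates n (suc c)) → 6 ≤ pos gs
      pos≥6 (gs ▷ g) = ≤-trans (≤-trans (s≤s (s≤s (s≤s (s≤s (≤-trans (s≤s (s≤s z≤n)) (≤-reflexive (sym (length-encodeGate g))))))))
        (+-monoˡ-≤ (length (encodeGate g)) (m≤m+n 4 (length (encodeGates gs))))) (≤-reflexive (sym (pos-▷ gs g)))

      -- Gate lists grow at the end whereas the loop proceeds from the front, so the induction takes
      -- the run from the current gate onwards as a continuation.
      runs-scan-prefix : ∀ {c h Post} (gs : Gates n (suc c)) → suc c ≤ m → pos gs ≤ L → Holds σ₀ 4 (encodeGates gs) →
        (∀ {σ} → Below M σ → Scanned (suc c) (pos gs) σ → Runs M scan σ h Post) →
        ∀ {σ} → Below M σ → Scanned 1 6 σ → Runs M scan σ (c * scanCost + h) Post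
      runs-scan-prefix (∅ ▷ var i) c≤m p≤L hold k bd S = k bd S
      runs-scan-prefix (∅ ▷ add (() ∷⁺ _)) c≤m p≤L hold k bd S
      runs-scan-prefix (∅ ▷ mul (() ∷⁺ _)) c≤m p≤L hold k bd S
      runs-scan-prefix {suc c} {h} {Post} (gs@(_ ▷ _) ▷ g) c≤m p≤L hold k bd S =
        runs-weaken (≤-reflexive (l₁ c scanCost h)) id
        (runs-scan-prefix gs (<⇒≤ c≤m) (≤-trans (m≤m+n _ _) p≤L′) (proj₁ (holds-++ 4 (encodeGates gs) hold)) step bd S)
        where
        l₁ : ∀ a b c → a * b + (b + c) ≡ suc a * b + c
        l₁ = solve-∀
        l₂ : ∀ a b c → suc (a + (b + c)) ≡ suc (a + b) + c
        l₂ = solve-∀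
        p≤L′ : pos gs + length (encodeGate g) ≤ L
        p≤L′ = subst (_≤ L) (pos-▷ gs g) p≤L
        step : ∀ {σ} → Below M σ → Scanned (suc c) (pos gs) σ → Runs M scan σ (scanCost + h) Post
        step {σ} bd S = runs-weaken (≤-reflexive (l₂ (cost scanTest) (suc (cost (mem pointer) + advanceCost)) h)) id
          (runs-while-true bd nonzero
            (runs-scanBody g c≤m (pos≥6 gs) p≤L′ (proj₂ (holds-++ 4 (encodeGates gs) hold)) S bd)
            λ {σ′} bd′ S′ → k bd′ (subst (λ z → Scanned (suc (suc c)) z σ′) (sym (pos-▷ gs g)) S′))
          where
          nonzero : ⟦ scanTest ⟧exp σ ≢ 0
          nonzero e = <⇒≱ c≤m (m∸n≡0⇒m≤n (trans (sym (cong₂ _∸_ (others S 3 λ ()) (count-value (<⇒≤ c≤m) S))) e))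

      runs-scan : ∀ {σ} → Below M σ → Scanned 1 6 σ → Runs M scan σ (inner C * scanCost + suc (cost scanTest)) (Scanned m L)
      runs-scan = runs-scan-prefix (gates C) ≤-refl ≤-refl (holds-input C r k) λ bd S →
        runs-while-false bd (trans (cong₂ _∸_ (others S 3 λ ()) (count-value ≤-refl S)) (n∸n≡0 m)) S

      L≤M : L ≤ M
      L≤M = ≤-trans (≤-trans (n≤1+n L) (m≤n*m (suc L) (m + 1) {{>-nonZero (m≤n+m 1 m)}})) hM

      -- Cell 3 is exempt as it already holds the base address; the gate count it contained is in
      -- `gateCell`.
      record Copied (j : ℕ) (σ : Memory) : Set where
        field
          atBase′  : σ 3 ≡ L
          counter  : σ L ≡ j
          source   : ∀ a → a < L → a ≢ 3 → σ a ≡ σ₀ a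
          copied   : ∀ a → a < j → a ≢ 3 → σ (cell L (suc (toℕ inputArray)) a) ≡ σ₀ a
          gateCell : σ (cell L (suc (toℕ gateArray)) 0) ≡ m

      open Copied

      3<L : 3 < L
      3<L = m≤m+n 4 _

      L≡cell : L ≡ cell L 0 0
      L≡cell = sym (+-identityʳ L)

      runs-copy : ∀ N j {σ} → j + N ≡ L → Below M σ → Copied j σ → Runs M copy σ (N * copyCost + suc (cost copyTest)) (Copied L)
      runs-copy zero j {σ} total bd S with trans (sym (+-identityʳ j)) total
      ... | refl = runs-while-false bd (trans (cong₂ _∸_ (atBase′ S) (trans (cong σ (atBase′ S)) (counter S))) (n∸n≡0 L)) S
      runs-copy (suc N) j {σ} total bd S = runs-weaken (≤-reflexive (l (cost copyTest) assignsCost (N * copyCost + suc (cost copyTest)))) id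
        (runs-while-true bd nonzero
          (runs-seq {Mid = Mid} (runs-assign bd (bd _) mid)
            λ {σ′} bd′ S′ → runs-assign bd′ (subst (_≤ M) (sym (next-value S′)) (≤-trans j<L L≤M)) (final S′))
          λ bd′ S′ → runs-copy N (suc j) (trans (sym (+-suc j N)) total) bd′ S′)
        where
        l : ∀ a b c → suc (a + (b + c)) ≡ suc (a + b) + c
        l = solve-∀
        j<L : j < L
        j<L = ≤-trans (m<m+n j z<s) (≤-reflexive total)
        counter′ : ⟦ mem base ⟧exp σ ≡ j
        counter′ = trans (cong σ (atBase′ S)) (counter S)
        nonzero : ⟦ copyTest ⟧exp σ ≢ 0
        nonzero e = <⇒≱ j<L (m∸n≡0⇒m≤n (trans (sym (cong₂ _∸_ (atBase′ S) counter′)) e))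
        Mid : Memory → Set
        Mid σ′ = Copied j σ′ × (j ≢ 3 → σ′ (cell L (suc (toℕ inputArray)) j) ≡ σ₀ j)
        target : ⟦ base ⊕ (lit (suc (toℕ inputArray)) ⊕ mem base ⊗ lit Q) ⟧exp σ ≡ cell L (suc (toℕ inputArray)) j
        target = cong₂ (λ u v → u + (suc (toℕ inputArray) + v * Q)) (atBase′ S) counter′
        <cell : ∀ {a} → a < L → ∀ r c → a ≢ cell L r c
        <cell a<L r c e = <⇒≱ a<L (≤-trans (m≤m+n L _) (≤-reflexive (sym e)))
        v = ⟦ mem (mem base) ⟧exp σ
        mid : Mid (σ [ ⟦ base ⊕ (lit (suc (toℕ inputArray)) ⊕ mem base ⊗ lit Q) ⟧exp σ ↦ v ])
        mid rewrite target = record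
          { atBase′ = trans (unwritten σ {v = v} (<cell 3<L (suc (toℕ inputArray)) j)) (atBase′ S)
          ; counter = trans (unwritten σ λ e → case proj₁ (cell-injective {L} {0} {0} {suc (toℕ inputArray)} {j} z<s (s≤s (toℕ<n inputArray)) (trans (sym L≡cell) e)) of λ ()) (counter S)
          ; source = λ a a<L a≢3 → trans (unwritten σ (<cell a<L (suc (toℕ inputArray)) j)) (source S a a<L a≢3)
          ; copied = λ a a<j a≢3 → trans (unwritten σ λ e → <⇒≢ a<j (proj₂ (cell-injective {L} {suc (toℕ inputArray)} {a} {suc (toℕ inputArray)} {j} (s≤s (toℕ<n inputArray)) (s≤s (toℕ<n inputArray)) e))) (copied S a a<j a≢3)
          ; gateCell = trans (unwritten σ λ e → input≢gate (sym (suc-injective (proj₁ (cell-injective {L} {suc (toℕ gateArray)} {0} {suc (toℕ inputArray)} {j} (s≤s (toℕ<n gateArray)) (s≤s (toℕ<n inputArray)) e))))) (gateCell S)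
          } , λ j≢3 → trans (written σ (cell L (suc (toℕ inputArray)) j) v) (trans (cong σ counter′) (source S j j<L j≢3))
        next-value : ∀ {σ′} → Mid σ′ → ⟦ mem base ⊕ lit 1 ⟧exp σ′ ≡ suc j
        next-value {σ′} (S′ , _) = trans (cong (_+ 1) (trans (cong σ′ (atBase′ S′)) (counter S′))) (+-comm j 1)
        final : ∀ {σ′} → Mid σ′ → Copied (suc j) (σ′ [ ⟦ base ⟧exp σ′ ↦ ⟦ mem base ⊕ lit 1 ⟧exp σ′ ])
        final {σ′} (S′ , new) rewrite next-value (S′ , new) | atBase′ S′ = record
          { atBase′ = trans (unwritten σ′ {v = suc j} (<⇒≢ 3<L)) (atBase′ S′)
          ; counter = written σ′ L (suc j)
          ; source = λ a a<L a≢3 → trans (unwritten σ′ (<⇒≢ a<L)) (source S′ a a<L a≢3)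
          ; copied = λ a a≤j a≢3 → trans (unwritten σ′ λ e → case proj₁ (cell-injective {L} {suc (toℕ inputArray)} {a} {0} {0} (s≤s (toℕ<n inputArray)) z<s (trans e L≡cell)) of λ ())
              (case m≤n⇒m<n∨m≡n (≤-pred a≤j) of λ { (inj₁ a<j) → copied S′ a a<j a≢3 ; (inj₂ refl) → new a≢3 })
          ; gateCell = trans (unwritten σ′ λ e → case proj₁ (cell-injective {L} {suc (toℕ gateArray)} {0} {0} {0} (s≤s (toℕ<n gateArray)) z<s (trans e L≡cell)) of λ ()) (gateCell S′)
          }

      prologueTime : ℕ
      prologueTime = assignCost (lit 4) (lit 1 ⊕ lit 6 ⊗ W) + ((inner C * scanCost + suc (cost scanTest)) +
        (assignCost (pointer ⊕ lit (suc (toℕ gateArray))) (mem (lit 3)) + (assignCost (lit 3) pointer + (assignCost (lit 4) (lit 0) +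
        (assignCost base (lit 0) + (L * copyCost + suc (cost copyTest)))))))

      first-tag : σ₀ 4 ≡ 0
      first-tag = tag (gates C) (holds-input C r k)
        where
        tag : ∀ {c} (gs : Gates n (suc c)) → Holds σ₀ 4 (encodeGates gs) → σ₀ 4 ≡ 0
        tag (∅ ▷ var i) (e , _) = e
        tag (∅ ▷ add (() ∷⁺ _)) _
        tag (∅ ▷ mul (() ∷⁺ _)) _
        tag (gs@(_ ▷ _) ▷ g) h = tag gs (proj₁ (holds-++ 4 (encodeGates gs) h))

      runs-prologue : Runs M prologue σ₀ prologueTime (Copied L)
      runs-prologue =
        runs-seq (runs-assign bd₀ (packed-≤ {1} {6} (s≤s z≤n) (pos≥6 (gates C)))
          (record { packed = refl ; others = λ a a≢4 → unwritten σ₀ a≢4 })) λ bd₁ S₁ →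
        runs-seq (runs-scan bd₁ S₁) λ bd₂ S₂ →
        runs-seq (runs-assign bd₂ (bd₂ 3) (stage₁ S₂)) λ bd₃ S₃ →
        runs-seq (runs-assign bd₃ (subst (_≤ M) (sym (pointer₁ S₃)) L≤M) (stage₂ S₃)) λ bd₄ S₄ →
        runs-seq (runs-assign bd₄ z≤n (stage₃ S₄)) λ bd₅ S₅ →
        runs-seq (runs-assign bd₅ z≤n (stage₄ S₅)) λ bd₆ S₆ →
        runs-copy L 0 refl bd₆ S₆
        where
        g : ℕ
        g = suc (toℕ gateArray)
        gc : ℕ
        gc = cell L g 0
        <gc : ∀ {a} → a < L → a ≢ gc
        <gc a<L e = <⇒≱ a<L (≤-trans (m≤m+n L _) (≤-reflexive (sym e)))
        4<L : 4 < L
        4<L = ≤-trans (n≤1+n 5) (pos≥6 (gates C))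
        Stage₁ Stage₂ Stage₃ : Memory → Set
        Stage₁ σ = σ 3 ≡ m × σ 4 ≡ m + L * (m + 1) × (∀ a → a < L → a ≢ 4 → σ a ≡ σ₀ a) × σ gc ≡ m
        Stage₂ σ = σ 3 ≡ L × (∀ a → a < L → a ≢ 4 → a ≢ 3 → σ a ≡ σ₀ a) × σ gc ≡ m
        Stage₃ σ = σ 3 ≡ L × (∀ a → a < L → a ≢ 3 → σ a ≡ σ₀ a) × σ gc ≡ m
        stage₁ : ∀ {σ} → Scanned m L σ → Stage₁ (σ [ ⟦ pointer ⊕ lit g ⟧exp σ ↦ σ 3 ])
        stage₁ {σ} S rewrite pointer-value ≤-refl S | sym (+-identityʳ g) =
          trans (unwritten σ {v = σ 3} (<gc 3<L)) (others S 3 λ ()) , trans (unwritten σ (<gc 4<L)) (packed S) ,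
          (λ a a<L a≢4 → trans (unwritten σ (<gc a<L)) (others S a a≢4)) , trans (written σ gc _) (others S 3 λ ())
        pointer₁ : ∀ {σ} → Stage₁ σ → ⟦ pointer ⟧exp σ ≡ L
        pointer₁ {σ} (e₃ , e₄ , _) = pointer-of {m} {L} {σ} ≤-refl e₄ e₃
        stage₂ : ∀ {σ} → Stage₁ σ → Stage₂ (σ [ 3 ↦ ⟦ pointer ⟧exp σ ])
        stage₂ {σ} S@(e₃ , e₄ , src , e) =
          pointer₁ S ,
          (λ a a<L a≢4 a≢3 → trans (unwritten σ a≢3) (src a a<L a≢4)) , trans (unwritten σ {v = ⟦ pointer ⟧exp σ} (≢-sym (<gc 3<L))) e
        stage₃ : ∀ {σ} → Stage₂ σ → Stage₃ (σ [ 4 ↦ 0 ])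
        stage₃ {σ} (e₃ , src , e) = e₃ , src′ , trans (unwritten σ (≢-sym (<gc 4<L))) e
          where
          src′ : ∀ a → a < L → a ≢ 3 → (σ [ 4 ↦ 0 ]) a ≡ σ₀ a
          src′ a a<L a≢3 with a ≟ 4
          ... | yes refl = sym first-tag
          ... | no a≢4 = trans (unwritten σ a≢4) (src a a<L a≢4 a≢3)
        stage₄ : ∀ {σ} → Stage₃ σ → Copied 0 (σ [ σ 3 ↦ 0 ])
        stage₄ {σ} (e₃ , src , e) rewrite e₃ = record
          { atBase′ = trans (unwritten σ {v = 0} (<⇒≢ 3<L)) e₃
          ; counter = written σ L 0
          ; source = λ a a<L a≢3 → trans (unwritten σ (<⇒≢ a<L)) (src a a<L a≢3)
          ; copied = λ a ()
          ; gateCell = trans (unwritten σ λ e → case proj₁ (cell-injective {L} {g} {0} {0} {0} (s≤s (toℕ<n gateArray)) z<s (trans e L≡cell)) of λ ()) e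
          }

-- The program: bins and weights of the variables.

q : ℕ
q = 25

inpA gatesA powA roundsA prodA prodB prodT dsA ansA wgtA foundA posA KA AA BA cwA keyA ptrA remA kindA opndA gnA tabA tmpA symA : Fin q
inpA    = # 0
gatesA  = # 1
powA    = # 2
roundsA = # 3
prodA   = # 4
prodB   = # 5
prodT   = # 6
dsA     = # 7
ansA    = # 8
wgtA    = # 9
foundA  = # 10
posA    = # 11
KA      = # 12
AA      = # 13
BA      = # 14
cwA     = # 15
keyA    = # 16
ptrA    = # 17
remA    = # 18
kindA   = # 19
opndA   = # 20
gnA     = # 21
tabA    = # 22
tmpA    = # 23
symA    = # 24

infixl 6 _+ᵗ_ _-ᵗ_
infixl 7 _*ᵗ_ _/ᵗ_ _%ᵗ_

_+ᵗ_ _-ᵗ_ _*ᵗ_ _/ᵗ_ _%ᵗ_ : ∀ {d} → Term q d → Term q d → Term q d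
_+ᵗ_ = op plus
_-ᵗ_ = op minus
_*ᵗ_ = op times
_/ᵗ_ = op over
a %ᵗ b = a -ᵗ (a /ᵗ b) *ᵗ b

the : ∀ {d} → Fin q → Term q d
the x = get x (num 0)

infix 4 _:=_

_:=_ : ∀ {p d} → Fin q → Term q d → Code q p d
x := e = set x (num 0) e

hashᵗ : ∀ {d} (U m a x : Term q d) → Term q d
hashᵗ U m a x = ((a *ᵗ x) %ᵗ (U *ᵗ m)) /ᵗ U

-- Variables: 0 L, 1 n, 2 k, 3 r, 4 size, 5 S, 6 N₀, 7 Hc, 8 Gb, 9 HA,
-- 10 D, 11 GD, 12 T, 13 Z, 14 H₀, 15 padding; counters: 16 a₀, 17 A, 18 B.
p : ℕ
p = 16

-- One unfolding of `run`. `cwA` holds the power of `r + 1` for the current bin instead of its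
-- number, so no exponentiation is left for the end.
symbolStep : Code q p 21
symbolStep = when (the foundA) nop
  ( (symA := the BA %ᵗ var (# 8)) ⨟
    (BA := the BA /ᵗ var (# 8)) ⨟
    when (the symA %ᵗ num 3)
      (when (the symA %ᵗ num 3 -ᵗ num 1)
        ((posA := num 0) ⨟ (KA := the KA /ᵗ num 4) ⨟ (AA := the AA /ᵗ var (# 7)))
        (posA := the posA +ᵗ the symA /ᵗ num 3))
      (when ((the posA -ᵗ cellᵗ) +ᵗ (num 1 +ᵗ cellᵗ -ᵗ (the posA +ᵗ the symA /ᵗ num 3)))
        ((cwA := (num 1 +ᵗ var (# 3)) *ᵗ the cwA) ⨟ (posA := the posA +ᵗ the symA /ᵗ num 3))
        (foundA := num 1)))
  where
  cellᵗ = hashᵗ (var (# 6)) (the KA *ᵗ num 24) (the AA %ᵗ var (# 7)) (the keyA)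

itemCode : Code q p 20
itemCode =
  (keyA := hashᵗ (var (# 1)) (var (# 6)) (var (# 16)) (var (# 19))) ⨟
  (foundA := num 0) ⨟ (posA := num 0) ⨟ (KA := var (# 2)) ⨟ (AA := var (# 17)) ⨟ (BA := var (# 18)) ⨟ (cwA := num 1) ⨟
  for (# 10) symbolStep ⨟
  set wgtA (var (# 19)) (var (# 12) +ᵗ the cwA)

module Decode (ρ : Env) (M : ℕ) where

  n   = ρ 1
  k   = ρ 2
  r   = ρ 3
  N₀  = ρ 6
  Hc  = ρ 7
  Gb  = ρ 8
  D   = ρ 10
  T   = ρ 12

  open Run N₀ Hc Gb

  finalBin : ℕ → ℕ
  finalBin i = run D 0 k (ρ 17) (ρ 18) 0 (hash n N₀ (ρ 16) i)

  module _ (0<n : 0 < n) (0<N₀ : 0 < N₀) (0<Gb : 0 < Gb)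
    (T≡ : suc r ^ suc D ≡ T)
    (hT : T + T ≤ M) (hpos : suc D * Gb ≤ M) (hN : N₀ ≤ M) (hk : k ≤ M) (h1 : 1 ≤ M) where

    -- The invariant is stated backwards: running the remaining symbols from the current registers
    -- yields the final bin. The bounds are there only to keep stored values below `M`.
    record Pending (fin y j : ℕ) (s : Store q) : Set where
      constructor pending
      field
        {b}     : ℕ
        found≡0 : s foundA 0 ≡ 0
        cw≡     : s cwA 0 ≡ suc r ^ b
        b≤j     : b ≤ j
        run≡    : run (D ∸ j) (s posA 0) (s KA 0) (s AA 0) (s BA 0) b y ≡ fin
        pos≤    : s posA 0 ≤ j * Gb
        K≤M     : s KA 0 ≤ M
        A≤M     : s AA 0 ≤ M
        B≤M     : s BA 0 ≤ M

    Progress : (fin y j : ℕ) → Store q → Set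
    Progress fin y j s = s keyA 0 ≡ y × ((s foundA 0 ≡ 1 × s cwA 0 ≡ suc r ^ fin) ⊎ Pending fin y j s)

    pow≤T : ∀ {b} → b ≤ suc D → suc r ^ b ≤ T
    pow≤T {b} b≤ = ≤-trans (^-monoʳ-≤ (suc r) b≤) (≤-reflexive T≡)

    Gb≤M : Gb ≤ M
    Gb≤M = ≤-trans (m≤m+n Gb (D * Gb)) hpos

    digit≤ : ∀ x → (x mod Gb) div 3 ≤ Gb
    digit≤ x = ≤-trans (div-≤ (x mod Gb) 3) (<⇒≤ (proj₂ (divmod x 0<Gb)))

    wp-symbolStep : ∀ {fin y j s i} → j < D → Progress fin y j s → WP M symbolStep (ρ [ 19 ↦ i ] [ 20 ↦ j ]) s (Progress fin y (suc j))
    wp-symbolStep {fin} {y} {j} {s} j<D (k≡ , inj₁ (f≡ , c≡)) = (λ _ → k≡ , inj₁ (f≡ , c≡)) , λ z → case trans (sym f≡) z of λ ()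
    wp-symbolStep {fin} {y} {j} {s} j<D (k≡ , inj₂ (pending {b} f≡ c≡ b≤ r≡ p≤ hK hA hB)) =
      (λ n → ⊥-elim (n f≡)) , λ _ →
      ≤-trans (<⇒≤ (proj₂ (divmod (s BA 0) 0<Gb))) Gb≤M ,
      ≤-trans (div-≤ (s BA 0) Gb) hB ,
      (λ lab≢0 → (λ lab≢1 → z≤n , ≤-trans (div-≤ _ 4) hK , ≤-trans (div-≤ _ Hc) hA ,
          (k≡ , inj₂ (pending {b = b} f≡ c≡ (≤-trans b≤ (n≤1+n j)) (trans (sym (obey-next lab lab≢1)) obey≡) z≤n (≤-trans (div-≤ _ 4) hK) (≤-trans (div-≤ _ Hc) hA) (≤-trans (div-≤ (s BA 0) Gb) hB))))
        , λ lab≡1 → pos′≤M ,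
          (k≡ , inj₂ (pending {b = b} f≡ c≡ (≤-trans b≤ (n≤1+n j)) (trans (sym (obey-skip lab lab≢0 lab≡1)) obey≡) pos′≤ hK hA (≤-trans (div-≤ (s BA 0) Gb) hB))))
      , λ lab≡0 → (λ out → cw′≤M , pos′≤M ,
          (k≡ , inj₂ (pending {b = suc b} f≡ (cong (suc r *_) c≡) (s≤s b≤) (trans (sym (obey-out lab lab≡0 out)) obey≡) pos′≤ hK hA (≤-trans (div-≤ (s BA 0) Gb) hB))))
        , λ in′ → h1 , (k≡ , inj₁ (refl , trans c≡ (cong (suc r ^_) (trans (sym (obey-in lab lab≡0 in′)) obey≡))))
      where
      f   = D ∸ suc j
      lab = (s BA 0 mod Gb) mod 3
      g   = (s BA 0 mod Gb) div 3
      B′  = s BA 0 div Gb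
      pos = s posA 0
      K   = s KA 0
      A   = s AA 0
      D∸j : D ∸ j ≡ suc f
      D∸j = trans (cong (_∸ j) (sym (m∸n+n≡m j<D))) (trans (cong (_∸ j) (+-suc f j)) (m+n∸n≡m (suc f) j))
      obey≡ : obey f lab g B′ pos K A b y ≡ fin
      obey≡ = trans (cong (λ z → run z pos K A (s BA 0) b y) (sym D∸j)) r≡
      pos′≤ : pos + g ≤ suc j * Gb
      pos′≤ = ≤-trans (+-mono-≤ p≤ (digit≤ (s BA 0))) (≤-reflexive (+-comm (j * Gb) Gb))
      pos′≤M : pos + g ≤ M
      pos′≤M = ≤-trans pos′≤ (≤-trans (*-monoˡ-≤ Gb (≤-trans j<D (n≤1+n D))) hpos)
      cw′≤M : suc r * s cwA 0 ≤ M
      cw′≤M = ≤-trans (≤-reflexive (cong (suc r *_) c≡)) (≤-trans (pow≤T {suc b} (s≤s (≤-trans b≤ (<⇒≤ j<D)))) (≤-trans (m≤m+n T T) hT))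
      cellVal : ℕ
      cellVal = hash N₀ (K * 24) (A mod Hc) (s keyA 0)
      obey-next : ∀ lab → lab ∸ 1 ≢ 0 → obey f lab g B′ pos K A b y ≡ run f 0 (K div 4) (A div Hc) B′ b y
      obey-next zero h = ⊥-elim (h refl)
      obey-next (suc zero) h = ⊥-elim (h refl)
      obey-next (suc (suc _)) h = refl
      obey-skip : ∀ lab → lab ≢ 0 → lab ∸ 1 ≡ 0 → obey f lab g B′ pos K A b y ≡ run f (pos + g) K A B′ b y
      obey-skip zero h e = ⊥-elim (h refl)
      obey-skip (suc zero) h e = refl
      cell≡ : outside pos g cellVal ≡ outside pos g (cellOf K A y)
      cell≡ = cong (λ z → outside pos g (hash N₀ (K * 24) (A mod Hc) z)) k≡
      obey-out : ∀ lab → lab ≡ 0 → outside pos g cellVal ≢ 0 → obey f lab g B′ pos K A b y ≡ run f (pos + g) K A B′ (suc b) y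
      obey-out _ refl h with outside pos g (cellOf K A y) | cell≡
      ... | zero  | e = ⊥-elim (h e)
      ... | suc _ | e = refl
      obey-in : ∀ lab → lab ≡ 0 → outside pos g cellVal ≡ 0 → obey f lab g B′ pos K A b y ≡ b
      obey-in _ refl h with outside pos g (cellOf K A y) | cell≡
      ... | zero  | e = refl
      ... | suc _ | e = case trans (sym h) e of λ ()

    wp-item : ∀ {i s} {P : Store q → Set} → i < n → ρ 17 ≤ M → ρ 18 ≤ M →
      (∀ s′ → s′ wgtA i ≡ T + suc r ^ finalBin i → (∀ a → a ≢ i → s′ wgtA a ≡ s wgtA a) → P s′) →
      WP M itemCode (ρ [ 19 ↦ i ]) s P
    wp-item {i} {s} {P} i<n hA hB post =
      <⇒≤ (≤-trans (div< {(ρ 16 * i) mod (n * N₀)} {n} {N₀} (≤-trans (proj₂ (divmod (ρ 16 * i) (*-mono-≤ 0<n 0<N₀))) (≤-reflexive (*-comm n N₀)))) hN) ,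
      z≤n , z≤n , hk , hA , hB , h1 ,
      wp-mono {M = M} loop {ρ [ 19 ↦ i ]} conclude
        (frame {M = M} loop wgtA refl {ρ [ 19 ↦ i ]}
          (wp-for {M = M} (# 10) symbolStep {ρ [ 19 ↦ i ]} (Progress (finalBin i) y)
            (refl , inj₂ (pending {b = 0} refl refl z≤n refl z≤n hk hA hB)) (λ j s′ j<D h → wp-symbolStep {j = j} {s = s′} {i = i} j<D h) (λ s′ h → h)))
      where
      loop : Code q p 20
      loop = for (# 10) symbolStep
      store : Code q p 20
      store = set wgtA (var (# 19)) (var (# 12) +ᵗ the cwA)
      y = hash n N₀ (ρ 16) i
      conclude : ∀ s′ → Progress (finalBin i) y D s′ × (∀ a → s′ wgtA a ≡ s wgtA a) → WP M store (ρ [ 19 ↦ i ]) s′ P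
      conclude s′ ((_ , pr) , same) =
        ≤-trans (+-monoʳ-≤ T (≤-trans (≤-reflexive cw-fin) (pow≤T (≤-trans (run-≤ D 0 k (ρ 17) (ρ 18) 0 y) (n≤1+n D))))) hT ,
        post (s′ [ wgtA ∙ i ↦ T + s′ cwA 0 ]) (trans (written (s′ wgtA) i (T + s′ cwA 0)) (cong (T +_) cw-fin)) λ a a≢i → trans (unwritten (s′ wgtA) {v = T + s′ cwA 0} a≢i) (same a)
        where
        cw-of : (s′ foundA 0 ≡ 1 × s′ cwA 0 ≡ suc r ^ finalBin i) ⊎ Pending (finalBin i) y D s′ → s′ cwA 0 ≡ suc r ^ finalBin i
        cw-of (inj₁ (_ , e)) = e
        cw-of (inj₂ (pending {b} _ e _ e′ _ _ _ _)) = trans e (cong (suc r ^_) (trans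
          (cong (λ z → run z (s′ posA 0) (s′ KA 0) (s′ AA 0) (s′ BA 0) b y) (sym (n∸n≡0 D))) e′))
        cw-fin : s′ cwA 0 ≡ suc r ^ finalBin i
        cw-fin = cw-of pr

-- The program: weight sets of the gates.

-- The set of weights below Z of the terms of gate g is kept as row g of a
-- table with rows of length Z. A gate with operands is handled in 1 + fan-in
-- steps, of which the first one sets up its row as ∅ for a sum and as {0}
-- for a product.
clearBody addBody copyBody sumsetBody : Code q p 21
shiftBody : Code q p 22

clearBody = set tabA (var (# 20) +ᵗ the gnA *ᵗ var (# 13)) (num 0)

addBody = when (get tabA (var (# 20) +ᵗ the opndA *ᵗ var (# 13)))
  (set tabA (var (# 20) +ᵗ (the gnA -ᵗ num 1) *ᵗ var (# 13)) (num 1)) nop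

-- The sumset is written to the row that held its first argument, so that argument is moved to
-- `tmpA`. The header has already advanced `gnA`, hence the `num 1` subtracted.
copyBody =
  when (get tabA (var (# 20) +ᵗ (the gnA -ᵗ num 1) *ᵗ var (# 13))) (set tmpA (var (# 20)) (num 1)) (set tmpA (var (# 20)) (num 0)) ⨟
  set tabA (var (# 20) +ᵗ (the gnA -ᵗ num 1) *ᵗ var (# 13)) (num 0)

-- The product serves as a conjunction: the operand contains the second counter, and the sum of both
-- counters stays below `Z`.
shiftBody = when (get tabA (var (# 21) +ᵗ the opndA *ᵗ var (# 13)) *ᵗ (var (# 13) -ᵗ (var (# 20) +ᵗ var (# 21))))
  (set tabA (var (# 20) +ᵗ var (# 21) +ᵗ (the gnA -ᵗ num 1) *ᵗ var (# 13)) (num 1)) nop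

shiftCode : Code q p 21
shiftCode = for (# 13) shiftBody

sumsetBody = when (get tmpA (var (# 20))) shiftCode nop

clearCode addCode mulCode copyCode sumsetCode headerCode operandCode stepCode : Code q p 20
clearCode  = for (# 13) clearBody
addCode    = for (# 13) addBody
copyCode   = for (# 13) copyBody
sumsetCode = for (# 13) sumsetBody
mulCode    = copyCode ⨟ sumsetCode

setupCode finishCode : Code q p 20
setupCode = when (the kindA)
  ((remA := get inpA (num 1 +ᵗ the ptrA)) ⨟
   when (the kindA -ᵗ num 1) (set tabA (the gnA *ᵗ var (# 13)) (num 1)) nop)
  (set tabA (get wgtA (get inpA (num 1 +ᵗ the ptrA)) +ᵗ the gnA *ᵗ var (# 13)) (num 1))
finishCode = (ptrA := num 2 +ᵗ the ptrA) ⨟ (gnA := num 1 +ᵗ the gnA)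

headerCode = clearCode ⨟ (kindA := get inpA (the ptrA)) ⨟ setupCode ⨟ finishCode

operandCode =
  (opndA := get inpA (the ptrA)) ⨟ (ptrA := num 1 +ᵗ the ptrA) ⨟ (remA := the remA -ᵗ num 1) ⨟
  when (the kindA -ᵗ num 1) mulCode addCode

-- A loop over the operands of one gate is not expressible, since the fan-in is not a parameter.
-- Instead one flat loop of `size C` steps serves all gates, with `remA` telling operands from
-- headers; this also makes the time linear in the size.
stepCode = when (the remA) operandCode headerCode

-- Correctness of the set operations.

written-at : ∀ σ {a b} v → a ≡ b → (σ [ a ↦ v ]) b ≡ v
written-at σ v refl = written σ _ v

row-injective : ∀ {Z z h z′ h′} → z < Z → z′ < Z → z + h * Z ≡ z′ + h′ * Z → z ≡ z′ × h ≡ h′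
row-injective {Z} {z} {h} {z′} {h′} z< z′< e =
  trans (sym (mod-digit h z<)) (trans (cong (_mod Z) e) (mod-digit h′ z′<)) ,
  trans (sym (div-digit h z<)) (trans (cong (_div Z) e) (div-digit h′ z′<))

Marks : ℕ → (ℕ → Set) → ℕ → Set
Marks x A z = (x ≢ 0 → A z) × (A z → x ≢ 0)

Sum : (ℕ → Set) → (ℕ → Set) → ℕ → Set
Sum A H z = ∃₂ λ x y → A x × H y × x + y ≡ z

module Table (ρ : Env) (M : ℕ) (1≤M : 1 ≤ M) where

  Z : ℕ
  Z = ρ 13

  cellAt : Store q → ℕ → ℕ → ℕ
  cellAt s g z = s tabA (z + g * Z)

  Row : Store q → ℕ → (ℕ → Set) → Set
  Row s g A = ∀ z → z < Z → Marks (cellAt s g z) A z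

  OtherRows : Store q → Store q → ℕ → Set
  OtherRows s s′ g = ∀ z h → z < Z → h ≢ g → cellAt s′ h z ≡ cellAt s h z

  -- 22 and 23 are `tabA` and `tmpA`, the only arrays that the set operations write.
  Same : Store q → Store q → Set
  Same s s′ = ∀ x → toℕ x ≢ 22 → toℕ x ≢ 23 → ∀ a → s′ x a ≡ s x a

  row-other : ∀ {s s′ g h A} → OtherRows s s′ g → h ≢ g → Row s h A → Row s′ h A
  row-other {s} {s′} {g} {h} {A} o h≢g R z z<Z = subst (λ x → Marks x A z) (sym (o z h z<Z h≢g)) (R z z<Z)

  module _ {s s₁ : Store q} {g z₀ v : ℕ} {idx : ℕ} (idx≡ : idx ≡ z₀ + g * Z) (z₀<Z : z₀ < Z) where

    private
      s₂ : Store q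
      s₂ = s₁ [ tabA ∙ idx ↦ v ]

    put-here : cellAt s₂ g z₀ ≡ v
    put-here = written-at (s₁ tabA) v idx≡

    put-elsewhere : ∀ {z} → z < Z → z ≢ z₀ → cellAt s₂ g z ≡ cellAt s₁ g z
    put-elsewhere z<Z z≢ = unwritten (s₁ tabA) λ e → z≢ (proj₁ (row-injective {Z} {_} {g} {_} {g} z<Z z₀<Z (trans e idx≡)))

    put-other : OtherRows s s₁ g → OtherRows s s₂ g
    put-other o z h z<Z h≢g = trans (unwritten (s₁ tabA) λ e → h≢g (proj₂ (row-injective {Z} {z} {h} {z₀} {g} z<Z z₀<Z (trans e idx≡)))) (o z h z<Z h≢g)

    put-same : Same s s₁ → Same s s₂
    put-same same x n₁ n₂ a = trans (unset s₁ {x} {tabA} (≡ᵇ-false n₁) a) (same x n₁ n₂ a)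

  clear-spec : ∀ {s g} → s gnA 0 ≡ g →
    WP M clearCode ρ s (λ s′ → (∀ z → z < Z → cellAt s′ g z ≡ 0) × OtherRows s s′ g × Same s s′)
  clear-spec {s} {g} gn≡ = wp-for {M = M} (# 13) clearBody {ρ} I
    ((λ z ()) , (λ _ _ _ _ → refl) , λ _ _ _ _ → refl)
    (λ j s₁ j<Z (zs , o , same) →
      let idx = cong (λ g → j + g * Z) (trans (same gnA (λ ()) (λ ()) 0) gn≡) in
      z≤n ,
      (λ z z≤j → case m≤n⇒m<n∨m≡n (≤-pred z≤j) of λ
        { (inj₂ refl) → put-here {s} {s₁} {g} idx j<Z
        ; (inj₁ z<j) → trans (put-elsewhere {s} {s₁} {g} idx j<Z (<-trans z<j j<Z) (<⇒≢ z<j)) (zs z z<j) }) ,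
      put-other {s} {s₁} {g} idx j<Z o , put-same {s} {s₁} {g} idx j<Z same)
    (λ s′ i → i)
    where
    I : ℕ → Store q → Set
    I j s′ = (∀ z → z < j → cellAt s′ g z ≡ 0) × OtherRows s s′ g × Same s s′

  add-spec : ∀ {s g o A H} → s gnA 0 ≡ suc g → s opndA 0 ≡ o → o ≢ g → Row s g A → Row s o H →
    WP M addCode ρ s (λ s′ → Row s′ g (λ z → A z ⊎ H z) × OtherRows s s′ g × Same s s′)
  add-spec {s} {g} {o} {A} {H} gn≡ op≡ o≢g RA RH = wp-for {M = M} (# 13) addBody {ρ} I
    ((λ z ()) , (λ _ _ _ → refl) , (λ _ _ _ _ → refl) , λ _ _ _ _ → refl)
    step (λ s′ (done , _ , o , same) → (λ z z<Z → done z z<Z z<Z) , o , same)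
    where
    I : ℕ → Store q → Set
    I j s′ = (∀ z → z < j → z < Z → Marks (cellAt s′ g z) (λ z → A z ⊎ H z) z)
      × (∀ z → j ≤ z → z < Z → cellAt s′ g z ≡ cellAt s g z) × OtherRows s s′ g × Same s s′
    step : ∀ j s₁ → j < Z → I j s₁ → WP M addBody (ρ [ 20 ↦ j ]) s₁ (I (suc j))
    step j s₁ j<Z (done , todo , oth , same) =
      (λ nz → 1≤M ,
        (λ z z≤j z<Z → case m≤n⇒m<n∨m≡n (≤-pred z≤j) of λ
          { (inj₂ refl) → (λ _ → inj₂ (proj₁ (RH j j<Z) (nz ∘ trans here≡))) , λ _ e → case trans (sym (put-here {s} {s₁} {g} idx j<Z)) e of λ ()
          ; (inj₁ z<j) → subst (λ x → Marks x (λ z → A z ⊎ H z) z) (sym (put-elsewhere {s} {s₁} {g} idx j<Z z<Z (<⇒≢ z<j))) (done z z<j z<Z) }) ,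
        (λ z j<z z<Z → trans (put-elsewhere {s} {s₁} {g} idx j<Z z<Z (≢-sym (<⇒≢ j<z))) (todo z (<⇒≤ j<z) z<Z)) ,
        put-other {s} {s₁} {g} idx j<Z oth , put-same {s} {s₁} {g} idx j<Z same) ,
      λ ez →
        (λ z z≤j z<Z → case m≤n⇒m<n∨m≡n (≤-pred z≤j) of λ
          { (inj₂ refl) → (λ nz → inj₁ (proj₁ (RA j j<Z) (nz ∘ trans (todo j ≤-refl j<Z)))) ,
              λ { (inj₁ a) e → proj₂ (RA j j<Z) a (trans (sym (todo j ≤-refl j<Z)) e)
                ; (inj₂ h) _ → proj₂ (RH j j<Z) h (trans (sym here≡) ez) }
          ; (inj₁ z<j) → done z z<j z<Z }) ,
        (λ z j<z z<Z → todo z (<⇒≤ j<z) z<Z) , oth , same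
      where
      idx : j + (s₁ gnA 0 ∸ 1) * Z ≡ j + g * Z
      idx = cong (λ g → j + (g ∸ 1) * Z) (trans (same gnA (λ ()) (λ ()) 0) gn≡)
      here≡ : s₁ tabA (j + s₁ opndA 0 * Z) ≡ cellAt s o j
      here≡ = trans (cong (λ o → s₁ tabA (j + o * Z)) (trans (same opndA (λ ()) (λ ()) 0) op≡)) (oth j o j<Z o≢g)

  TmpRow : Store q → (ℕ → Set) → Set
  TmpRow s A = ∀ z → z < Z → Marks (s tmpA z) A z

  copy-spec : ∀ {s g A} → s gnA 0 ≡ suc g → Row s g A →
    WP M copyCode ρ s (λ s′ → TmpRow s′ A × (∀ z → z < Z → cellAt s′ g z ≡ 0) × OtherRows s s′ g × Same s s′)
  copy-spec {s} {g} {A} gn≡ RA = wp-for {M = M} (# 13) copyBody {ρ} I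
    ((λ z ()) , (λ _ _ ()) , (λ _ _ _ → refl) , (λ _ _ _ _ → refl) , λ _ _ _ _ → refl)
    step (λ s′ (t , zs , _ , o , same) → (λ z z<Z → t z z<Z z<Z) , (λ z z<Z → zs z z<Z z<Z) , o , same)
    where
    I : ℕ → Store q → Set
    I j s′ = (∀ z → z < j → z < Z → Marks (s′ tmpA z) A z) × (∀ z → z < Z → z < j → cellAt s′ g z ≡ 0)
      × (∀ z → j ≤ z → z < Z → cellAt s′ g z ≡ cellAt s g z) × OtherRows s s′ g × Same s s′
    step : ∀ j s₁ → j < Z → I j s₁ → WP M copyBody (ρ [ 20 ↦ j ]) s₁ (I (suc j))
    step j s₁ j<Z (tmp , zs , todo , oth , same) =
      (λ nz → 1≤M , z≤n , next 1 ((λ _ → proj₁ (RA j j<Z) (nz ∘ trans here≡)) , λ _ ())) ,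
      λ ez → z≤n , z≤n , next 0 ((λ h → ⊥-elim (h refl)) , λ a _ → proj₂ (RA j j<Z) a (trans (sym here≡) ez))
      where
      idx : j + (s₁ gnA 0 ∸ 1) * Z ≡ j + g * Z
      idx = cong (λ g → j + (g ∸ 1) * Z) (trans (same gnA (λ ()) (λ ()) 0) gn≡)
      here≡ : s₁ tabA (j + (s₁ gnA 0 ∸ 1) * Z) ≡ cellAt s g j
      here≡ = trans (cong (s₁ tabA) idx) (todo j ≤-refl j<Z)
      next : ∀ v → Marks v A j → I (suc j) (s₁ [ tmpA ∙ j ↦ v ] [ tabA ∙ j + (s₁ gnA 0 ∸ 1) * Z ↦ 0 ])
      next v mk =
        (λ z z≤j z<Z → case m≤n⇒m<n∨m≡n (≤-pred z≤j) of λ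
          { (inj₂ refl) → subst (λ x → Marks x A j) (sym (written (s₁ tmpA) j v)) mk
          ; (inj₁ z<j) → subst (λ x → Marks x A z) (sym (unwritten (s₁ tmpA) {v = v} (<⇒≢ z<j))) (tmp z z<j z<Z) }) ,
        (λ z z<Z z≤j → case m≤n⇒m<n∨m≡n (≤-pred z≤j) of λ
          { (inj₂ refl) → put-here {s} {s₁′} {g} idx j<Z
          ; (inj₁ z<j) → trans (put-elsewhere {s} {s₁′} {g} idx j<Z z<Z (<⇒≢ z<j)) (zs z z<Z z<j) }) ,
        (λ z j<z z<Z → trans (put-elsewhere {s} {s₁′} {g} idx j<Z z<Z (≢-sym (<⇒≢ j<z))) (todo z (<⇒≤ j<z) z<Z)) ,
        put-other {s} {s₁′} {g} idx j<Z oth ,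
        put-same {s} {s₁′} {g} idx j<Z (λ x n₁ n₂ a → trans (unset s₁ {x} {tmpA} (≡ᵇ-false n₂) a) (same x n₁ n₂ a))
        where
        s₁′ : Store q
        s₁′ = s₁ [ tmpA ∙ j ↦ v ]

  -- Truncating the table at `Z` loses nothing: weights are natural numbers, so both summands of a
  -- sum below `Z` are below `Z`.
  shift-spec : ∀ {s g o u B H} → s gnA 0 ≡ suc g → s opndA 0 ≡ o → o ≢ g → Row s g B → Row s o H →
    WP M shiftCode (ρ [ 20 ↦ u ]) s
      (λ s′ → Row s′ g (λ z → B z ⊎ ∃[ y ] H y × u + y ≡ z) × OtherRows s s′ g × Same s s′ × (∀ a → s′ tmpA a ≡ s tmpA a))
  shift-spec {s} {g} {o} {u} {B} {H} gn≡ op≡ o≢g RB RH = wp-for {M = M} (# 13) shiftBody {ρ [ 20 ↦ u ]} I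
    ((λ z z<Z → (λ h → inj₁ (proj₁ (RB z z<Z) h)) , λ { (inj₁ b) → proj₂ (RB z z<Z) b }) ,
      (λ _ _ _ _ → refl) , (λ _ _ _ _ → refl) , λ _ → refl)
    step
    (λ s′ (R , o , same , tmp) → (λ z z<Z → (λ h → case proj₁ (R z z<Z) h of λ
        { (inj₁ b) → inj₁ b ; (inj₂ (y , _ , hy , e)) → inj₂ (y , hy , e) }) ,
      λ { (inj₁ b) → proj₂ (R z z<Z) (inj₁ b)
        ; (inj₂ (y , hy , e)) → proj₂ (R z z<Z) (inj₂ (y , ≤-<-trans (≤-trans (m≤n+m y u) (≤-reflexive e)) z<Z , hy , e)) }) , o , same , tmp)
    where
    B′ : ℕ → ℕ → Set
    B′ j z = B z ⊎ ∃[ y ] y < j × H y × u + y ≡ z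
    I : ℕ → Store q → Set
    I j s′ = Row s′ g (B′ j) × OtherRows s s′ g × Same s s′ × (∀ a → s′ tmpA a ≡ s tmpA a)
    step : ∀ j s₁ → j < Z → I j s₁ → WP M shiftBody (ρ [ 20 ↦ u ] [ 21 ↦ j ]) s₁ (I (suc j))
    step j s₁ j<Z (R , oth , same , tmp) =
      (λ nz →
        let hj  = proj₁ (RH j j<Z) λ e → nz (cong (_* (Z ∸ (u + j))) (trans here≡ e))
            u+j = m∸n≢0⇒n<m {Z} {u + j} λ e → nz (trans (cong (s₁ tabA (j + s₁ opndA 0 * Z) *_) e) (*-zeroʳ (s₁ tabA (j + s₁ opndA 0 * Z)))) in
        1≤M ,
        (λ z z<Z → case z ≟ u + j of λ
          { (yes refl) → (λ _ → inj₂ (j , ≤-refl , hj , refl)) , λ _ e → case trans (sym (put-here {s} {s₁} {g} idx u+j)) e of λ ()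
          ; (no z≢) → subst (λ x → Marks x (B′ (suc j)) z) (sym (put-elsewhere {s} {s₁} {g} idx u+j z<Z z≢)) (grow z z<Z λ _ e → z≢ (sym e)) }) ,
        put-other {s} {s₁} {g} idx u+j oth , put-same {s} {s₁} {g} idx u+j same , tmp) ,
      λ ez → (λ z z<Z → grow z z<Z λ hj e → proj₂ (RH j j<Z) hj (trans (sym here≡)
          (case m*n≡0⇒m≡0∨n≡0 (s₁ tabA (j + s₁ opndA 0 * Z)) ez of λ
            { (inj₁ e₀) → e₀ ; (inj₂ e₁) → ⊥-elim (<⇒≱ (subst (_< Z) (sym e) z<Z) (m∸n≡0⇒m≤n e₁)) }))) ,
        oth , same , tmp
      where
      idx : u + j + (s₁ gnA 0 ∸ 1) * Z ≡ u + j + g * Z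
      idx = cong (λ g → u + j + (g ∸ 1) * Z) (trans (same gnA (λ ()) (λ ()) 0) gn≡)
      here≡ : s₁ tabA (j + s₁ opndA 0 * Z) ≡ cellAt s o j
      here≡ = trans (cong (λ o → s₁ tabA (j + o * Z)) (trans (same opndA (λ ()) (λ ()) 0) op≡)) (oth j o j<Z o≢g)
      grow : ∀ z → z < Z → (H j → u + j ≢ z) → Marks (cellAt s₁ g z) (B′ (suc j)) z
      grow z z<Z not =
        (λ h → case proj₁ (R z z<Z) h of λ { (inj₁ b) → inj₁ b ; (inj₂ (y , y<j , hy , e)) → inj₂ (y , ≤-trans y<j (n≤1+n j) , hy , e) }) ,
        λ { (inj₁ b) → proj₂ (R z z<Z) (inj₁ b)
          ; (inj₂ (y , y≤j , hy , e)) → case m≤n⇒m<n∨m≡n (≤-pred y≤j) of λ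
              { (inj₁ y<j) → proj₂ (R z z<Z) (inj₂ (y , y<j , hy , e))
              ; (inj₂ refl) → ⊥-elim (not hy e) } }

  sumset-spec : ∀ {s g o A H} → s gnA 0 ≡ suc g → s opndA 0 ≡ o → o ≢ g → TmpRow s A →
    (∀ z → z < Z → cellAt s g z ≡ 0) → Row s o H →
    WP M sumsetCode ρ s (λ s′ → Row s′ g (Sum A H) × OtherRows s s′ g × Same s s′)
  sumset-spec {s} {g} {o} {A} {H} gn≡ op≡ o≢g RA zs RH = wp-for {M = M} (# 13) sumsetBody {ρ} I
    ((λ z z<Z → (λ h → ⊥-elim (h (zs z z<Z))) , λ { (_ , _ , () , _) }) , (λ _ _ _ _ → refl) , (λ _ _ _ _ → refl) , λ _ → refl)
    step
    (λ s′ (R , o , same , tmp) → (λ z z<Z → (λ h → let (x , y , _ , a , hy , e) = proj₁ (R z z<Z) h in x , y , a , hy , e) ,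
      λ (x , y , a , hy , e) → proj₂ (R z z<Z) (x , y , ≤-<-trans (≤-trans (m≤m+n x y) (≤-reflexive e)) z<Z , a , hy , e)) , o , same)
    where
    A′ : ℕ → ℕ → Set
    A′ u z = ∃₂ λ x y → x < u × A x × H y × x + y ≡ z
    I : ℕ → Store q → Set
    I u s′ = Row s′ g (A′ u) × OtherRows s s′ g × Same s s′ × (∀ a → s′ tmpA a ≡ s tmpA a)
    step : ∀ u s₁ → u < Z → I u s₁ → WP M sumsetBody (ρ [ 20 ↦ u ]) s₁ (I (suc u))
    step u s₁ u<Z (R , oth , same , tmp) =
      (λ nz → wp-mono {M = M} shiftCode {ρ [ 20 ↦ u ]} (λ s₂ (R₂ , oth₂ , same₂ , tmp₂) →
          (λ z z<Z → (λ h → case proj₁ (R₂ z z<Z) h of λ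
              { (inj₁ (x , y , x<u , a , hy , e)) → x , y , ≤-trans x<u (n≤1+n u) , a , hy , e
              ; (inj₂ (y , hy , e)) → u , y , ≤-refl , proj₁ (RA u u<Z) (nz ∘ trans (tmp u)) , hy , e }) ,
            λ (x , y , x≤u , a , hy , e) → case m≤n⇒m<n∨m≡n (≤-pred x≤u) of λ
              { (inj₁ x<u) → proj₂ (R₂ z z<Z) (inj₁ (x , y , x<u , a , hy , e))
              ; (inj₂ refl) → proj₂ (R₂ z z<Z) (inj₂ (y , hy , e)) }) ,
          (λ z h z<Z h≢g → trans (oth₂ z h z<Z h≢g) (oth z h z<Z h≢g)) ,
          (λ x n₁ n₂ a → trans (same₂ x n₁ n₂ a) (same x n₁ n₂ a)) , λ a → trans (tmp₂ a) (tmp a))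
        (shift-spec {s₁} {g} {o} {u} (trans (same gnA (λ ()) (λ ()) 0) gn≡) (trans (same opndA (λ ()) (λ ()) 0) op≡) o≢g R
          (row-other {s} {s₁} {g} {o} oth o≢g RH))) ,
      λ ez → (λ z z<Z → (λ h → let (x , y , x<u , a , hy , e) = proj₁ (R z z<Z) h in x , y , ≤-trans x<u (n≤1+n u) , a , hy , e) ,
          λ (x , y , x≤u , a , hy , e) → case m≤n⇒m<n∨m≡n (≤-pred x≤u) of λ
            { (inj₁ x<u) → proj₂ (R z z<Z) (x , y , x<u , a , hy , e)
            ; (inj₂ refl) → ⊥-elim (proj₂ (RA u u<Z) a (trans (sym (tmp u)) ez)) }) ,
        oth , same , tmp

  mul-spec : ∀ {s g o A H} → s gnA 0 ≡ suc g → s opndA 0 ≡ o → o ≢ g → Row s g A → Row s o H →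
    WP M mulCode ρ s (λ s′ → Row s′ g (Sum A H) × OtherRows s s′ g × Same s s′)
  mul-spec {s} {g} {o} gn≡ op≡ o≢g RA RH = wp-mono {M = M} copyCode {ρ}
    (λ s₁ (t , zs , oth , same) → wp-mono {M = M} sumsetCode {ρ}
      (λ s₂ (R , oth₂ , same₂) → R , (λ z h z<Z h≢g → trans (oth₂ z h z<Z h≢g) (oth z h z<Z h≢g)) ,
        λ x n₁ n₂ a → trans (same₂ x n₁ n₂ a) (same x n₁ n₂ a))
      (sumset-spec {s₁} {g} {o} (trans (same gnA (λ ()) (λ ()) 0) gn≡) (trans (same opndA (λ ()) (λ ()) 0) op≡) o≢g t zs
        (row-other {s} {s₁} {g} {o} oth o≢g RH)))
    (copy-spec {s} {g} gn≡ RA)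

-- Correctness of the evaluation of the circuit.

data Kind : Set where
  addition multiplication : Kind

tag : Kind → ℕ
tag addition     = 1
tag multiplication = 2

combine : Kind → (ℕ → Set) → (ℕ → Set) → ℕ → Set
combine addition     A H z = A z ⊎ H z
combine multiplication A H z = Sum A H z

neutral : Kind → ℕ → Set
neutral addition     z = ⊥
neutral multiplication z = z ≡ 0

module States (Z n : ℕ) (v inputs : ℕ → ℕ) where

  RowOf : Store q → ℕ → (ℕ → Set) → Set
  RowOf s g A = ∀ z → z < Z → Marks (s tabA (z + g * Z)) A z

  rowOf-cong : ∀ {s g A B} → (∀ z → A z → B z) → (∀ z → B z → A z) → RowOf s g A → RowOf s g B
  rowOf-cong f g R z z<Z = f z ∘ proj₁ (R z z<Z) , proj₂ (R z z<Z) ∘ g z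

  Rows : ∀ {m} → Vec (Poly n) m → Store q → Set
  Rows {m} fs s = ∀ i → RowOf s (toℕ i) (Hits (lookup fs i) v)

  Const : Store q → Set
  Const s = (∀ a → s inpA a ≡ inputs a) × (∀ i → i < n → s wgtA i ≡ v i)

  record Ready {m} (fs : Vec (Poly n) m) (ptr : ℕ) (s : Store q) : Set where
    constructor ready
    field
      ptr≡ : s ptrA 0 ≡ ptr
      rem≡ : s remA 0 ≡ 0
      gn≡  : s gnA 0 ≡ m
      rows : Rows fs s

  -- The state within gate `m`, with `len` operands to come; `gnA` is `suc m` because the header has
  -- already advanced it.
  record Busy {m} (fs : Vec (Poly n) m) (κ : Kind) (ptr len : ℕ) (A : ℕ → Set) (s : Store q) : Set where
    constructor busy
    field
      ptr≡  : s ptrA 0 ≡ ptr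
      rem≡  : s remA 0 ≡ len
      kind≡ : s kindA 0 ≡ tag κ
      gn≡   : s gnA 0 ≡ suc m
      row   : RowOf s m A
      rows  : Rows fs s

module Step (ρ : Env) (M : ℕ) (1≤M : 1 ≤ M) (n : ℕ) (v inputs : ℕ → ℕ)
  (v<Z : ∀ i → i < n → v i < ρ 13) (inputs≤M : ∀ a → inputs a ≤ M) (0<Z : 0 < ρ 13) where

  open States (ρ 13) n v inputs
  open Table ρ M 1≤M

  toℕ≢ : ∀ {m} (i : Fin m) → toℕ i ≢ m
  toℕ≢ i = <⇒≢ (toℕ<n i)

  operand-spec : ∀ {m} {fs : Vec (Poly n) m} κ {ptr len A s} i → suc ptr ≤ M → len ≤ M → inputs ptr ≡ toℕ i →
    Busy fs κ ptr (suc len) A s → Const s →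
    WP M stepCode ρ s (Busy fs κ (suc ptr) len (combine κ A (Hits (lookup fs i) v)))
  operand-spec {m} {fs} κ {ptr} {len} {A} {s} i ptr≤ len≤ in≡ptr (busy p≡ r≡ k≡ g≡ row rows) (in≡ , _) =
    (λ _ →
      ≤-trans (≤-reflexive (in≡ (s ptrA 0))) (inputs≤M (s ptrA 0)) ,
      ≤-trans (≤-reflexive (cong suc p≡)) ptr≤ ,
      ≤-trans (≤-reflexive (cong (_∸ 1) r≡)) len≤ ,
      body κ k≡) ,
    λ z → case trans (sym r≡) z of λ ()
    where
    s₃ : Store q
    s₃ = s [ opndA ∙ 0 ↦ s inpA (s ptrA 0) ] [ ptrA ∙ 0 ↦ suc (s ptrA 0) ] [ remA ∙ 0 ↦ s remA 0 ∸ 1 ]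
    op≡ : s₃ opndA 0 ≡ toℕ i
    op≡ = trans (in≡ (s ptrA 0)) (trans (cong inputs p≡) in≡ptr)
    after : ∀ κ → s kindA 0 ≡ tag κ → ∀ s′ → RowOf s′ m (combine κ A (Hits (lookup fs i) v)) × OtherRows s₃ s′ m × Same s₃ s′ →
      Busy fs κ (suc ptr) len (combine κ A (Hits (lookup fs i) v)) s′
    after κ k≡ s′ (R , oth , same) = busy
      (trans (same ptrA (λ ()) (λ ()) 0) (cong suc p≡)) (trans (same remA (λ ()) (λ ()) 0) (cong (_∸ 1) r≡))
      (trans (same kindA (λ ()) (λ ()) 0) k≡) (trans (same gnA (λ ()) (λ ()) 0) g≡)
      R (λ i → row-other {s₃} {s′} {m} {toℕ i} oth (toℕ≢ i) (rows i))
    body : ∀ κ → s kindA 0 ≡ tag κ → WP M (when (the kindA -ᵗ num 1) mulCode addCode) ρ s₃ (Busy fs κ (suc ptr) len (combine κ A (Hits (lookup fs i) v)))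
    body addition e = (λ nz → ⊥-elim (nz (cong (_∸ 1) e))) ,
      λ _ → wp-mono {M = M} addCode {ρ} (after addition e) (add-spec {s₃} {m} {toℕ i} g≡ op≡ (toℕ≢ i) row (rows i))
    body multiplication e = (λ _ → wp-mono {M = M} mulCode {ρ} (after multiplication e) (mul-spec {s₃} {m} {toℕ i} g≡ op≡ (toℕ≢ i) row (rows i))) ,
      λ z → case trans (sym (cong (_∸ 1) e)) z of λ ()

  module _ {m : ℕ} {fs : Vec (Poly n) m} {ptr : ℕ} {s : Store q} (ptr≤ : 2 + ptr ≤ M) (m≤ : suc m ≤ M) (R : Ready fs ptr s) (cst : Const s) where

    open Ready R

    private
      Cleared : Store q → Set
      Cleared s₁ = (∀ z → z < Z → cellAt s₁ m z ≡ 0) × OtherRows s s₁ m × Same s s₁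

      header : ∀ {Post} → (∀ s₁ → Cleared s₁ → WP M (setupCode ⨟ finishCode) ρ (s₁ [ kindA ∙ 0 ↦ s₁ inpA (s₁ ptrA 0) ]) Post) → WP M stepCode ρ s Post
      header k = (λ nz → ⊥-elim (nz rem≡)) , λ _ → wp-mono {M = M} clearCode {ρ}
        (λ s₁ c@(_ , _ , same) →
          ≤-trans (≤-reflexive (trans (same inpA (λ ()) (λ ()) _) (proj₁ cst _))) (inputs≤M _) , k s₁ c)
        (clear-spec {s} {m} gn≡)

      module _ {s₁ : Store q} (c : Cleared s₁) where
        same₁ : Same s s₁
        same₁ = proj₂ (proj₂ c)
        p₁ : s₁ ptrA 0 ≡ ptr
        p₁ = trans (same₁ ptrA (λ ()) (λ ()) 0) ptr≡
        g₁ : s₁ gnA 0 ≡ m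
        g₁ = trans (same₁ gnA (λ ()) (λ ()) 0) gn≡
        kind₁ : ∀ {x} → inputs ptr ≡ x → s₁ inpA (s₁ ptrA 0) ≡ x
        kind₁ e = trans (cong (s₁ inpA) p₁) (trans (same₁ inpA (λ ()) (λ ()) ptr) (trans (proj₁ cst ptr) e))
        arg₁ : ∀ {x} → inputs (suc ptr) ≡ x → s₁ inpA (suc (s₁ ptrA 0)) ≡ x
        arg₁ e = trans (cong (s₁ inpA ∘ suc) p₁) (trans (same₁ inpA (λ ()) (λ ()) (suc ptr)) (trans (proj₁ cst (suc ptr)) e))
        rows₁ : Rows fs s₁
        rows₁ i = row-other {s} {s₁} {m} {toℕ i} (proj₁ (proj₂ c)) (toℕ≢ i) (rows i)
        ptr≤₁ : 2 + s₁ ptrA 0 ≤ M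
        ptr≤₁ = ≤-trans (≤-reflexive (cong (2 +_) p₁)) ptr≤
        gn≤₁ : 1 + s₁ gnA 0 ≤ M
        gn≤₁ = ≤-trans (≤-reflexive (cong suc g₁)) m≤

    variable-spec : ∀ i → inputs ptr ≡ 0 → inputs (suc ptr) ≡ toℕ i →
      WP M stepCode ρ s (λ s′ → s′ ptrA 0 ≡ 2 + ptr × s′ remA 0 ≡ 0 × s′ gnA 0 ≡ suc m × RowOf s′ m (Hits (X i) v) × Rows fs s′)
    variable-spec i e₀ e₁ = header λ s₁ c →
      (λ nz → ⊥-elim (nz (kind₁ c e₀))) , λ _ → 1≤M , ptr≤₁ c , gn≤₁ c ,
      cong (2 +_) (p₁ c) , trans (same₁ c remA (λ ()) (λ ()) 0) rem≡ , cong suc (g₁ c) ,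
      (let idx : s₁ wgtA (s₁ inpA (suc (s₁ ptrA 0))) + s₁ gnA 0 * Z ≡ v (toℕ i) + m * Z
           idx = cong₂ (λ x y → x + y * Z) (trans (cong (s₁ wgtA) (arg₁ c e₁)) (trans (same₁ c wgtA (λ ()) (λ ()) _) (proj₂ cst (toℕ i) (toℕ<n i)))) (g₁ c)
           vi<Z = v<Z (toℕ i) (toℕ<n i) in
       λ z z<Z → case z ≟ v (toℕ i) of λ
         { (yes refl) → (λ _ → hits-X v i) , λ _ e → case trans (sym (put-here {s} {s₁} {m} idx vi<Z)) e of λ ()
         ; (no z≢) → (λ nz → ⊥-elim (nz (trans (put-elsewhere {s} {s₁} {m} idx vi<Z z<Z z≢) (proj₁ c z z<Z)))) ,
             λ h → ⊥-elim (z≢ (hits-X⁻ v i h)) }) ,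
      (let idx : s₁ wgtA (s₁ inpA (suc (s₁ ptrA 0))) + s₁ gnA 0 * Z ≡ v (toℕ i) + m * Z
           idx = cong₂ (λ x y → x + y * Z) (trans (cong (s₁ wgtA) (arg₁ c e₁)) (trans (same₁ c wgtA (λ ()) (λ ()) _) (proj₂ cst (toℕ i) (toℕ<n i)))) (g₁ c)
       in λ j → row-other {s} {s₁ [ tabA ∙ _ ↦ 1 ]} {m} {toℕ j} (put-other {s} {s₁} {m} idx (v<Z (toℕ i) (toℕ<n i)) (proj₁ (proj₂ c))) (toℕ≢ j) (rows j))

    operation-spec : ∀ κ {len} → len ≤ M → inputs ptr ≡ tag κ → inputs (suc ptr) ≡ len →
      WP M stepCode ρ s (Busy fs κ (2 + ptr) len (neutral κ))
    operation-spec addition len≤ e₀ e₁ = header λ s₁ c →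
      (λ _ → ≤-trans (≤-reflexive (arg₁ c e₁)) len≤ , (λ nz → ⊥-elim (nz (cong (_∸ 1) (kind₁ c e₀)))) ,
        λ _ → ptr≤₁ c , gn≤₁ c ,
        busy (cong (2 +_) (p₁ c)) (arg₁ c e₁) (kind₁ c e₀) (cong suc (g₁ c))
          (λ z z<Z → (λ nz → nz (proj₁ c z z<Z)) , λ ()) (rows₁ c)) ,
      λ z → case trans (sym (kind₁ c e₀)) z of λ ()
    operation-spec multiplication len≤ e₀ e₁ = header λ s₁ c →
      (λ _ → ≤-trans (≤-reflexive (arg₁ c e₁)) len≤ ,
        (λ _ → 1≤M , ptr≤₁ c , gn≤₁ c ,
          (let idx : s₁ gnA 0 * Z ≡ 0 + m * Z
               idx = cong (_* Z) (g₁ c) in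
          busy (cong (2 +_) (p₁ c)) (arg₁ c e₁) (kind₁ c e₀) (cong suc (g₁ c))
            (λ z z<Z → case z ≟ 0 of λ
              { (yes refl) → (λ _ → refl) , λ _ e → case trans (sym (put-here {s} {s₁} {m} idx 0<Z)) e of λ ()
              ; (no z≢) → (λ nz → ⊥-elim (nz (trans (put-elsewhere {s} {s₁} {m} idx 0<Z z<Z z≢) (proj₁ c z z<Z)))) , λ e → ⊥-elim (z≢ e) })
            (λ j → row-other {s} {s₁ [ tabA ∙ s₁ gnA 0 * Z ↦ 1 ]} {m} {toℕ j} (put-other {s} {s₁} {m} idx 0<Z (proj₁ (proj₂ c))) (toℕ≢ j) (rows j)))) ,
        λ z → case trans (sym (cong (_∸ 1) (kind₁ c e₀))) z of λ ()) ,
      λ z → case trans (sym (kind₁ c e₀)) z of λ ()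

wpLoop-++ : ∀ {q} {W : ℕ → Store q → (Store q → Set) → Set} →
  (∀ {j s P Q} → (∀ s → P s → Q s) → W j s P → W j s Q) →
  ∀ j a b {s P} → wpLoop W j a s (λ s′ → wpLoop W (j + a) b s′ P) → wpLoop W j (a + b) s P
wpLoop-++ {W = W} m j zero    b {s} {P} h = subst (λ z → wpLoop W z b s P) (+-identityʳ j) h
wpLoop-++ {W = W} m j (suc a) b {s} {P} h = m (λ s₁ h₁ → wpLoop-++ m (suc j) a b
  (wpLoop-mono m (suc j) a (λ s₂ → subst (λ z → wpLoop W z b s₂ P) (+-suc j a)) h₁)) h

module Circuit (ρ : Env) (M : ℕ) (1≤M : 1 ≤ M) {n : ℕ} (v inputs : ℕ → ℕ)
  (v<Z : ∀ i → i < n → v i < ρ 13) (inputs≤M : ∀ a → inputs a ≤ M) (0<Z : 0 < ρ 13) where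

  open States (ρ 13) n v inputs
  open Step using (operand-spec; variable-spec; operation-spec)

  W : ℕ → Store q → (Store q → Set) → Set
  W j s P = WP M stepCode (ρ [ 19 ↦ j ]) s P

  W-mono : ∀ {j s P Q} → (∀ s → P s → Q s) → W j s P → W j s Q
  W-mono {j} = wp-mono {M = M} stepCode {ρ [ 19 ↦ j ]}

  constant : ∀ {j s P} → Const s → W j s P → W j s (λ s′ → P s′ × Const s′)
  constant {j} {s} {P} (in≡ , w≡) h = W-mono {j} (λ s′ ((p , e₁) , e₂) → p , (λ a → trans (e₁ a) (in≡ a)) , λ i i<n → trans (e₂ i) (w≡ i i<n))
    (frame {M = M} stepCode wgtA refl {ρ [ 19 ↦ j ]} (frame {M = M} stepCode inpA refl {ρ [ 19 ↦ j ]} h))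

  -- A left fold, in the order of the steps, whereas `Union` and `Sumset` recurse to the right. The
  -- comparison therefore has to be proved for an arbitrary accumulator `A`.
  combineAll : ∀ {m} → Kind → Vec (Poly n) m → List (Fin m) → (ℕ → Set) → ℕ → Set
  combineAll κ fs []       A = A
  combineAll κ fs (i ∷ is) A = combineAll κ fs is (combine κ A (Hits (lookup fs i) v))

  operands-spec : ∀ {m} {fs : Vec (Poly n) m} κ is j {ptr A s} → ptr + length is ≤ M → Holds inputs ptr (List.map toℕ is) →
    Busy fs κ ptr (length is) A s → Const s →
    wpLoop W j (length is) s (λ s′ → Busy fs κ (ptr + length is) 0 (combineAll κ fs is A) s′ × Const s′)
  operands-spec κ [] j {ptr} {s = s} ptr≤ _ B c = subst (λ z → Busy _ κ z 0 _ s) (sym (+-identityʳ ptr)) B , c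
  operands-spec {fs = fs} κ (i ∷ is) j {ptr} {A} {s} ptr≤ (e , h) B c =
    W-mono {j} (λ s₁ (B₁ , c₁) → wpLoop-mono (λ {j} → W-mono {j}) (suc j) (length is)
        (λ s′ → subst (λ z → Busy fs κ z 0 (combineAll κ fs (i ∷ is) A) s′ × Const s′) (sym (+-suc ptr (length is))))
        (operands-spec κ is (suc j) ptr≤′ h B₁ c₁))
      (constant {j} c (operand-spec (ρ [ 19 ↦ j ]) M 1≤M n v inputs v<Z inputs≤M 0<Z κ i
        (≤-trans (m≤m+n (suc ptr) (length is)) ptr≤′) (≤-trans (m≤n+m (length is) (suc ptr)) ptr≤′) e B c))
    where
    ptr≤′ : suc ptr + length is ≤ M
    ptr≤′ = ≤-trans (≤-reflexive (sym (+-suc ptr (length is)))) ptr≤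

  combine-sum : ∀ {m} (fs : Vec (Poly n) m) is {A z} →
    (combineAll addition fs is A z → A z ⊎ Union v fs is z) × (A z ⊎ Union v fs is z → combineAll addition fs is A z)
  combine-sum fs [] = inj₁ , λ { (inj₁ a) → a }
  combine-sum fs (i ∷ is) {A} {z} =
    (λ h → case proj₁ ih h of λ { (inj₁ (inj₁ a)) → inj₁ a ; (inj₁ (inj₂ h)) → inj₂ (here h) ; (inj₂ u) → inj₂ (there u) }) ,
    λ { (inj₁ a) → proj₂ ih (inj₁ (inj₁ a)) ; (inj₂ (here h)) → proj₂ ih (inj₁ (inj₂ h)) ; (inj₂ (there u)) → proj₂ ih (inj₂ u) }
    where ih = combine-sum fs is {combine addition A (Hits (lookup fs i) v)} {z}

  combine-product : ∀ {m} (fs : Vec (Poly n) m) is {A z} →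
    (combineAll multiplication fs is A z → Sum A (Sumset v fs is) z) × (Sum A (Sumset v fs is) z → combineAll multiplication fs is A z)
  combine-product fs [] {A} {z} = (λ a → z , 0 , a , refl , +-identityʳ z) ,
    λ { (x , _ , a , refl , e) → subst A (trans (sym (+-identityʳ x)) e) a }
  combine-product fs (i ∷ is) {A} {z} =
    (λ h → let (_ , y , (x , x′ , a , hx , e) , s , e′) = proj₁ ih h in
       x , x′ + y , a , (x′ , y , hx , s , refl) , trans (sym (+-assoc x x′ y)) (trans (cong (_+ y) e) e′)) ,
    λ (x , _ , a , (x′ , y , hx , s , e) , e′) → proj₂ ih (x + x′ , y , (x , x′ , a , hx , refl) , s ,
       trans (+-assoc x x′ y) (trans (cong (x +_) e) e′))
    where ih = combine-product fs is {combine multiplication A (Hits (lookup fs i) v)} {z}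

  rows-▷ : ∀ {m} (gs : Gates n m) g {s} → Rows ⟦ gs ⟧gates s → RowOf s m (Hits (⟦ g ⟧gate ⟦ gs ⟧gates) v) → Rows ⟦ gs ▷ g ⟧gates s
  rows-▷ {m} gs g {s} rs r i with snoc i
  ... | oldIndex j rewrite toℕ-inject₁ j | lookup-old ⟦ gs ⟧gates (⟦ g ⟧gate ⟦ gs ⟧gates) j = rs j
  ... | newIndex   rewrite toℕ-fromℕ m   | lookup-new ⟦ gs ⟧gates (⟦ g ⟧gate ⟦ gs ⟧gates)   = r

  module _ {m : ℕ} (gs : Gates n m) where

    Done : (g : Gate n m) → ℕ → Store q → Set
    Done g ptr s = Ready ⟦ gs ▷ g ⟧gates ptr s × Const s

    operation : ∀ κ (g : Gate n m) is N j {ptr s} → N ≡ suc (length is) → encodeGate g ≡ tag κ ∷ length is ∷ List.map toℕ is →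
      (∀ z → combineAll κ ⟦ gs ⟧gates is (neutral κ) z → Hits (⟦ g ⟧gate ⟦ gs ⟧gates) v z) →
      (∀ z → Hits (⟦ g ⟧gate ⟦ gs ⟧gates) v z → combineAll κ ⟦ gs ⟧gates is (neutral κ) z) →
      suc m ≤ M → ptr + length (encodeGate g) ≤ M → Holds inputs ptr (encodeGate g) →
      Ready ⟦ gs ⟧gates ptr s → Const s → wpLoop W j N s (Done g (ptr + length (encodeGate g)))
    operation κ g is _ j {ptr} {s} refl enc f h m≤ ptr≤ hold R c rewrite enc | length-map toℕ is with hold
    ... | e₀ , e₁ , rest = W-mono {j} (λ s₁ (B₁ , c₁) → wpLoop-mono (λ {j} → W-mono {j}) (suc j) (length is)
        (λ s′ (busy p≡ r≡ _ g≡ row rows , c′) →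
          ready (trans p≡ len≡) r≡ g≡ (rows-▷ gs g {s′} rows (rowOf-cong {s′} {m} f h row)) , c′)
        (operands-spec κ is (suc j) (≤-trans (≤-reflexive len≡) ptr≤) rest B₁ c₁))
      (constant {j} c (operation-spec (ρ [ 19 ↦ j ]) M 1≤M n v inputs v<Z inputs≤M 0<Z
        (≤-trans (m≤m+n (2 + ptr) (length is)) (≤-trans (≤-reflexive len≡) ptr≤)) m≤ R c κ
        (≤-trans (m≤n+m (length is) (2 + ptr)) (≤-trans (≤-reflexive len≡) ptr≤)) e₀ e₁))
      where
      len≡ : 2 + ptr + length is ≡ ptr + suc (suc (length is))
      len≡ = sym (trans (+-suc ptr (suc (length is))) (cong suc (+-suc ptr (length is))))

    gate-spec : ∀ g j {ptr s} → suc m ≤ M → ptr + length (encodeGate g) ≤ M → Holds inputs ptr (encodeGate g) →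
      Ready ⟦ gs ⟧gates ptr s → Const s → wpLoop W j (suc (fanIn g)) s (Done g (ptr + length (encodeGate g)))
    gate-spec (var i) j {ptr} {s} m≤ ptr≤ (e₀ , e₁ , _) R c =
      W-mono {j} (λ s′ ((p≡ , r≡ , g≡ , row , rows) , c′) → ready (trans p≡ (+-comm 2 ptr)) r≡ g≡ (rows-▷ gs (var i) {s′} rows row) , c′)
        (constant {j} c (variable-spec (ρ [ 19 ↦ j ]) M 1≤M n v inputs v<Z inputs≤M 0<Z
          (≤-trans (≤-reflexive (+-comm 2 ptr)) ptr≤) m≤ R c i e₀ e₁))
    gate-spec g@(add (i ∷⁺ is)) j m≤ ptr≤ hold R c = operation addition g (i ∷ is) (suc (fanIn g)) j refl refl
      (λ z h → hits-add v ⟦ gs ⟧gates i is (case proj₁ (combine-sum ⟦ gs ⟧gates (i ∷ is)) h of λ { (inj₂ u) → u }))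
      (λ z h → proj₂ (combine-sum ⟦ gs ⟧gates (i ∷ is)) (inj₂ (hits-add⁻ v ⟦ gs ⟧gates i is h)))
      m≤ ptr≤ hold R c
    gate-spec g@(mul (i ∷⁺ is)) j m≤ ptr≤ hold R c = operation multiplication g (i ∷ is) (suc (fanIn g)) j refl refl
      (λ z h → case proj₁ (combine-product ⟦ gs ⟧gates (i ∷ is)) h of λ { (_ , y , refl , s , refl) → hits-mul v ⟦ gs ⟧gates i is s })
      (λ z h → proj₂ (combine-product ⟦ gs ⟧gates (i ∷ is)) (0 , z , refl , hits-mul⁻ v ⟦ gs ⟧gates i is h , refl))
      m≤ ptr≤ hold R c

  -- The flat loop is cut into stretches of `suc (fanIn g)` steps, one per gate, whose lengths add
  -- up to `gatesSize`.
  gates-spec : ∀ {m} (gs : Gates n m) j {s} → 4 + length (encodeGates gs) ≤ M → Holds inputs 4 (encodeGates gs) →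
    s ptrA 0 ≡ 4 → s remA 0 ≡ 0 → s gnA 0 ≡ 0 → Const s →
    wpLoop W j (gatesSize gs) s (λ s′ → Ready ⟦ gs ⟧gates (4 + length (encodeGates gs)) s′ × Const s′)
  gates-spec ∅ j L≤ hold p≡ r≡ g≡ c = ready p≡ r≡ g≡ (λ ()) , c
  gates-spec {suc m} (gs ▷ g) j L≤ hold p≡ r≡ g≡ c = wpLoop-++ (λ {j} → W-mono {j}) j (gatesSize gs) (suc (fanIn g))
    (wpLoop-mono (λ {j} → W-mono {j}) j (gatesSize gs)
      (λ s₁ (R₁ , c₁) → subst (λ z → wpLoop W (j + gatesSize gs) (suc (fanIn g)) s₁ (λ s′ → Ready ⟦ gs ▷ g ⟧gates z s′ × Const s′)) (sym len≡)
        (gate-spec gs g (j + gatesSize gs) m≤ (≤-trans (≤-reflexive (sym len≡)) L≤) (proj₂ (holds-++ 4 (encodeGates gs) hold)) R₁ c₁))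
      (gates-spec gs j (≤-trans (m≤m+n _ _) (≤-trans (≤-reflexive (sym len≡)) L≤)) (proj₁ (holds-++ 4 (encodeGates gs) hold)) p≡ r≡ g≡ c))
    where
    len≡ : 4 + length (encodeGates (gs ▷ g)) ≡ 4 + length (encodeGates gs) + length (encodeGate g)
    len≡ = cong (4 +_) (length-++ (encodeGates gs))
    m≤ : suc m ≤ M
    m≤ = ≤-trans (≤-trans (m≤n+m (suc m) (gatesSize (gs ▷ g))) (≤-trans (≤-reflexive (sym (length-encodeGates (gs ▷ g)))) (m≤n+m _ 4))) L≤

-- The exhaustive search over seeds.

-- `1 ∸ ((x ∸ y) + (y ∸ x))` is nonzero exactly if `x ≡ y`; the product with the table entry is a
-- conjunction.
checkBody : Code q p 20
checkBody = when
  (get tabA (var (# 19) +ᵗ var (# 2) *ᵗ var (# 12) +ᵗ (the gatesA -ᵗ num 1) *ᵗ var (# 13)) *ᵗ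
   (num 1 -ᵗ ((get dsA (var (# 19)) -ᵗ var (# 2)) +ᵗ (var (# 2) -ᵗ get dsA (var (# 19))))))
  (ansA := num 1) nop

weighCode circuitCode checkCode seedCode : Code q p 19
weighCode   = for (# 1) itemCode
circuitCode = (ptrA := num 4) ⨟ (remA := num 0) ⨟ (gnA := num 0) ⨟ for (# 4) stepCode
checkCode   = for (# 12) checkBody
seedCode    = weighCode ⨟ circuitCode ⨟ checkCode

digitBody : Code q p 17
digitBody = set dsA (var (# 16)) (get dsA (var (# 16) /ᵗ (num 1 +ᵗ var (# 3))) +ᵗ var (# 16) %ᵗ (num 1 +ᵗ var (# 3)))

searchB : Code q p 18
searchB = for (# 11) seedCode

searchA : Code q p 17
searchA = for (# 9) searchB

searchCode digitCode mainCode : Code q p 16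
searchCode = for (# 14) searchA
digitCode  = set dsA (num 0) (num 0) ⨟ for (# 12) digitBody
mainCode   = digitCode ⨟ (ansA := num 0) ⨟ searchCode

module Main {n : ℕ} (C : NonCancelingCircuit n) (k r R D : ℕ) (0<n : 0 < n) (0<k : 0 < k) (0<r : 0 < r)
  (k≤ : k ≤ 4 ^ R * r) (D≥ : 3 * k + 2 * r * R ≤ D * r) where

  module Det = Detect n k r R D 0<n 0<k 0<r k≤ D≥
  open Det using (N₀; Hc; Gb; T)

  Z : ℕ
  Z = suc k * T

  m : ℕ
  m = suc (inner C)

  f : Poly n
  f = ⟦ C ⟧

  Acc : ℕ → ℕ → ℕ → Set
  Acc a₀ A B = Det.Accepts a₀ A B f

  MD : Set
  MD = MonomialDetection f r k

  positive : Positive f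
  positive = subst Positive (sym (last≡lookup ⟦ gates C ⟧gates)) (positive-gates (gates C) (fromℕ (inner C)))

  record Facts (ρ : Env) : Set where
    field
      e₁  : ρ 1 ≡ n
      e₂  : ρ 2 ≡ k
      e₃  : ρ 3 ≡ r
      e₄  : ρ 4 ≡ size C
      e₆  : ρ 6 ≡ N₀
      e₇  : ρ 7 ≡ Hc
      e₈  : ρ 8 ≡ Gb
      e₉  : ρ 9 ≡ Hc ^ R
      e₁₀ : ρ 10 ≡ D
      e₁₁ : ρ 11 ≡ Gb ^ D
      e₁₂ : ρ 12 ≡ T
      e₁₃ : ρ 13 ≡ Z
      e₁₄ : ρ 14 ≡ n * N₀

  module Search (ρ : Env) (F : Facts ρ) (M : ℕ) (inputs : ℕ → ℕ)
    (1≤M : 1 ≤ M) (inputs≤M : ∀ a → inputs a ≤ M)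
    (hZ : Z ≤ M) (hpos : suc D * Gb ≤ M) (hN : N₀ ≤ M) (hk : k ≤ M) (hA : Hc ^ R ≤ M) (hB : Gb ^ D ≤ M)
    (hL : 4 + length (encodeGates (gates C)) ≤ M) (holds : Holds inputs 4 (encodeGates (gates C))) where

    open Facts F

    0<T : 0 < T
    0<T = m^n>0 (suc r) (suc D)

    2T≤Z : T + T ≤ Z
    2T≤Z = +-monoʳ-≤ T (≤-trans (≤-reflexive (sym (*-identityˡ T))) (*-monoˡ-≤ T 0<k))

    digits : ℕ → ℕ
    digits = digitSum (suc r) (suc D)

    record Base (s : Store q) : Set where
      constructor isBase
      field
        inputs≡ : ∀ a → s inpA a ≡ inputs a
        gates≡  : s gatesA 0 ≡ m
        ds≡     : ∀ u → u < T → s dsA u ≡ digits u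

    -- A positive answer is justified at once and never withdrawn. `N` is what is known while the
    -- answer is 0: none of the seeds and candidates tried so far accepts.
    Answer : Set → Store q → Set
    Answer N s = (s ansA 0 ≡ 1 × MD) ⊎ (s ansA 0 ≡ 0 × N)

    answer-map : ∀ {N N′ : Set} {a} → (N → N′) → (a ≡ 1 × MD) ⊎ (a ≡ 0 × N) → (a ≡ 1 × MD) ⊎ (a ≡ 0 × N′)
    answer-map f (inj₁ a)       = inj₁ a
    answer-map f (inj₂ (e , x)) = inj₂ (e , f x)

    answer-≡ : ∀ {N s s′} → s′ ansA 0 ≡ s ansA 0 → Answer N s → Answer N s′
    answer-≡ e (inj₁ (e₁ , x)) = inj₁ (trans e e₁ , x)
    answer-≡ e (inj₂ (e₁ , x)) = inj₂ (trans e e₁ , x)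

    module Seed (a₀ A B : ℕ) (A≤M : A ≤ M) (B≤M : B ≤ M) where

      ρ′ : Env
      ρ′ = ρ [ 16 ↦ a₀ ] [ 17 ↦ A ] [ 18 ↦ B ]

      v : ℕ → ℕ
      v = Det.itemWeightOf a₀ A B

      Weights : ℕ → Store q → Set
      Weights i s = ∀ i′ → i′ < i → s wgtA i′ ≡ v i′

      -- Bins are at most `D`, so a weight is below `T + T`, and this is at most `Z` since `k ≥ 1`.
      v<Z : ∀ i → i < n → v i < ρ′ 13
      v<Z i _ = ≤-trans (+-monoʳ-< T (^-monoʳ-< (suc r) (s≤s 0<r) (s≤s (Run.run-≤ N₀ Hc Gb D 0 k A B 0 _)))) (≤-trans 2T≤Z (≤-reflexive (sym e₁₃)))

      weigh-spec : ∀ s → WP M weighCode ρ′ s (Weights n)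
      weigh-spec s = wp-for {M = M} (# 1) itemCode {ρ′} Weights (λ _ ())
        (λ i s₁ i<n W → Decode.wp-item ρ′ M
          (subst (0 <_) (sym e₁) 0<n) (subst (0 <_) (sym e₆) z<s) (subst (0 <_) (sym e₈) z<s)
          (trans (cong₂ (λ x y → suc x ^ suc y) e₃ e₁₀) (sym e₁₂))
          (subst (λ z → z + z ≤ M) (sym e₁₂) (≤-trans 2T≤Z hZ))
          (subst₂ (λ x y → suc x * y ≤ M) (sym e₁₀) (sym e₈) hpos)
          (subst (_≤ M) (sym e₆) hN) (subst (_≤ M) (sym e₂) hk) 1≤M i<n A≤M B≤M
          λ s′ new old i′ i′≤i → case m≤n⇒m<n∨m≡n (≤-pred i′≤i) of λ
            { (inj₁ i′<i) → trans (old i′ (<⇒≢ i′<i)) (W i′ i′<i)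
            ; (inj₂ refl) → trans new (item≡ i) })
        λ s₁ W i i<n → W i (subst (i <_) (sym e₁) i<n)
        where
        item≡ : ∀ i → ρ′ 12 + suc (ρ′ 3) ^ Decode.finalBin ρ′ M i ≡ v i
        item≡ i rewrite e₁ | e₂ | e₃ | e₆ | e₇ | e₈ | e₁₀ | e₁₂ = refl

      module Cir = Circuit ρ′ M 1≤M {n} v inputs v<Z inputs≤M (subst (0 <_) (sym e₁₃) (≤-trans 0<T (≤-trans (m≤m+n T T) 2T≤Z)))
      open States (ρ′ 13) n v inputs

      circuit-spec : ∀ s → Const s → WP M circuitCode ρ′ s (λ s′ → Rows ⟦ gates C ⟧gates s′)
      circuit-spec s c = ≤-trans (≤-trans (m≤m+n 4 _) hL) ≤-refl , z≤n , z≤n ,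
        wpLoop-mono (λ {j} → Cir.W-mono {j}) 0 (ρ 4) (λ s′ (R , _) → Ready.rows R)
          (subst (λ z → wpLoop Cir.W 0 z s₁ (λ s′ → Ready ⟦ gates C ⟧gates (4 + length (encodeGates (gates C))) s′ × Const s′)) (sym e₄) (Cir.gates-spec (gates C) 0 {s₁} hL holds refl refl refl c))
        where
        s₁ : Store q
        s₁ = s [ ptrA ∙ 0 ↦ 4 ] [ remA ∙ 0 ↦ 0 ] [ gnA ∙ 0 ↦ 0 ]

      Hit : ℕ → Set
      Hit u = digits u ≡ k × Hits f v (k * T + u)

      check-spec : ∀ {N} s → Base s → Rows ⟦ gates C ⟧gates s → Answer N s →
        WP M checkCode ρ′ s (Answer (N × ¬ Acc a₀ A B))
      check-spec {N} s (isBase _ g≡ ds≡) rows ans = wp-for {M = M} (# 12) checkBody {ρ′} I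
        (answer-map (λ x → x , λ _ ()) ans , λ _ _ _ → refl) step
        λ s′ (a , _) → answer-map (λ (x , none) → x , λ (u , u<T , hit) → none u (subst (u <_) (sym e₁₂) u<T) hit) a
        where
        I : ℕ → Store q → Set
        I u s′ = Answer (N × (∀ u′ → u′ < u → ¬ Hit u′)) s′ × (∀ x → toℕ x ≢ 8 → ∀ a → s′ x a ≡ s x a)
        step : ∀ u s₁ → u < ρ′ 12 → I u s₁ → WP M checkBody (ρ′ [ 19 ↦ u ]) s₁ (I (suc u))
        step u s₁ u<ρ (a , same) =
          (λ nz → 1≤M , inj₁ (refl , Det.accepts-sound positive a₀ A B
              (u , u<T , ≡k (λ e → nz (trans (cong (s₁ tabA idx *_) e) (*-zeroʳ (s₁ tabA idx)))) ,
                subst (λ g → Hits g v (k * T + u)) (sym last≡)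
                  (subst (Hits (lookup ⟦ gates C ⟧gates (fromℕ (inner C))) v) (+-comm u (k * T))
                    (proj₁ row λ e → nz (cong (_* (1 ∸ ((s₁ dsA u ∸ ρ 2) + (ρ 2 ∸ s₁ dsA u)))) (trans here≡ e)))))) ,
            λ x x≢ b → trans (unset s₁ {x} {ansA} (≡ᵇ-false x≢) b) (same x x≢ b)) ,
          λ ez → answer-map (λ (x , none) → x , λ u′ u′≤u → case m≤n⇒m<n∨m≡n (≤-pred u′≤u) of λ
            { (inj₁ u′<u) → none u′ u′<u
            ; (inj₂ refl) → λ (d≡k , h) → case m*n≡0⇒m≡0∨n≡0 (s₁ tabA idx) ez of λ
                { (inj₁ e) → proj₂ row (subst (Hits (lookup ⟦ gates C ⟧gates (fromℕ (inner C))) v) (+-comm (k * T) u)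
                               (subst (λ g → Hits g v (k * T + u)) last≡ h)) (trans (sym here≡) e)
                ; (inj₂ e) → case trans (sym (cong (1 ∸_) (diff (trans ds₁ (trans d≡k (sym e₂)))))) e of λ () } }) a , same
          where
          u<T : u < T
          u<T = subst (u <_) e₁₂ u<ρ
          last≡ = last≡lookup ⟦ gates C ⟧gates
          idx : ℕ
          idx = u + ρ 2 * ρ 12 + (s₁ gatesA 0 ∸ 1) * ρ 13
          here≡ : s₁ tabA idx ≡ s tabA (u + k * T + toℕ (fromℕ (inner C)) * ρ 13)
          here≡ = trans (same tabA (λ ()) idx) (cong (s tabA) (cong₂ _+_ (cong (u +_) (cong₂ _*_ e₂ e₁₂))
            (cong (_* ρ 13) (trans (cong (_∸ 1) (trans (same gatesA (λ ()) 0) g≡)) (sym (toℕ-fromℕ (inner C)))))))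
          row : Marks (s tabA (u + k * T + toℕ (fromℕ (inner C)) * ρ 13)) (Hits (lookup ⟦ gates C ⟧gates (fromℕ (inner C))) v) (u + k * T)
          row = rows (fromℕ (inner C)) (u + k * T) (≤-trans (+-monoˡ-< (k * T) u<T) (≤-reflexive (sym e₁₃)))
          ds₁ : s₁ dsA u ≡ digits u
          ds₁ = trans (same dsA (λ ()) u) (ds≡ u u<T)
          diff : ∀ {x y} → x ≡ y → (x ∸ y) + (y ∸ x) ≡ 0
          diff {x} refl = cong₂ _+_ (n∸n≡0 x) (n∸n≡0 x)
          ≡k : 1 ∸ ((s₁ dsA u ∸ ρ 2) + (ρ 2 ∸ s₁ dsA u)) ≢ 0 → digits u ≡ k
          ≡k h = trans (sym ds₁) (trans (≤-antisym (m∸n≡0⇒m≤n (m+n≡0⇒m≡0 _ zero-diff)) (m∸n≡0⇒m≤n (m+n≡0⇒n≡0 (s₁ dsA u ∸ ρ 2) zero-diff))) e₂)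
            where
            zero-diff : (s₁ dsA u ∸ ρ 2) + (ρ 2 ∸ s₁ dsA u) ≡ 0
            zero-diff with (s₁ dsA u ∸ ρ 2) + (ρ 2 ∸ s₁ dsA u)
            ... | zero  = refl
            ... | suc x = ⊥-elim (h (0∸n≡0 x))

      seed-spec : ∀ {N} s → Base s → Answer N s → WP M seedCode ρ′ s (λ s′ → Base s′ × Answer (N × ¬ Acc a₀ A B) s′)
      seed-spec {N} s base@(isBase in≡ g≡ ds≡) ans =
        wp-mono {M = M} weighCode {ρ′} (λ s₁ ((((W , i₁) , g₁) , d₁) , a₁) →
          wp-mono {M = M} circuitCode {ρ′} (λ s₂ ((((R , i₂) , g₂) , d₂) , a₂) →
            let base₂ = isBase (λ a → trans (i₂ a) (trans (i₁ a) (in≡ a))) (trans (g₂ 0) (trans (g₁ 0) g≡))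
                          (λ u u<T → trans (d₂ u) (trans (d₁ u) (ds≡ u u<T))) in
            wp-mono {M = M} checkCode {ρ′} (λ s₃ (((Ans , i₃) , g₃) , d₃) →
                isBase (λ a → trans (i₃ a) (Base.inputs≡ base₂ a)) (trans (g₃ 0) (Base.gates≡ base₂)) (λ u u<T → trans (d₃ u) (Base.ds≡ base₂ u u<T)) , Ans)
              (frame {M = M} checkCode dsA refl {ρ′} (frame {M = M} checkCode gatesA refl {ρ′} (frame {M = M} checkCode inpA refl {ρ′}
                (check-spec {N} s₂ base₂ R (answer-≡ {N} {s} {s₂} (trans (a₂ 0) (a₁ 0)) ans))))))
            (frame {M = M} circuitCode ansA refl {ρ′} (frame {M = M} circuitCode dsA refl {ρ′} (frame {M = M} circuitCode gatesA refl {ρ′} (frame {M = M} circuitCode inpA refl {ρ′}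
              (circuit-spec s₁ ((λ a → trans (i₁ a) (in≡ a)) , W)))))))
          (frame {M = M} weighCode ansA refl {ρ′} (frame {M = M} weighCode dsA refl {ρ′} (frame {M = M} weighCode gatesA refl {ρ′} (frame {M = M} weighCode inpA refl {ρ′}
            (weigh-spec s)))))

    search-spec : ∀ s → Base s → s ansA 0 ≡ 0 → WP M searchCode ρ s (Answer (¬ MD))
    search-spec s base ans = wp-for {M = M} (# 14) searchA {ρ} I₀ (base , inj₂ (ans , λ _ ()))
      (λ a₀ s₁ _ (b₁ , x₁) → wp-for {M = M} (# 9) searchB {ρ [ 16 ↦ a₀ ]} (I₁ a₀)
        (b₁ , answer-map (λ N → N , λ _ ()) x₁)
        (λ A s₂ A< (b₂ , x₂) → wp-for {M = M} (# 11) seedCode {ρ [ 16 ↦ a₀ ] [ 17 ↦ A ]} (I₂ a₀ A)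
          (b₂ , answer-map (λ N → N , λ _ ()) x₂)
          (λ B s₃ B< (b₃ , x₃) → wp-mono {M = M} seedCode {ρ [ 16 ↦ a₀ ] [ 17 ↦ A ] [ 18 ↦ B ]}
            (λ s₄ (b₄ , x₄) → b₄ , answer-map (λ ((N , done) , none) → N , below done none) x₄)
            (Seed.seed-spec a₀ A B (≤-trans (<⇒≤ A<) (≤-trans (≤-reflexive e₉) hA)) (≤-trans (<⇒≤ B<) (≤-trans (≤-reflexive e₁₁) hB)) s₃ b₃ x₃))
          λ s₃ (b₃ , x₃) → b₃ , answer-map (λ ((N , done) , none) → N , below done none) x₃)
        λ s₂ (b₂ , x₂) → b₂ , answer-map (λ (N , none) → below N none) x₂)
      λ s₁ (_ , x) → answer-map (λ none md →
        let a₀ , a₀< , A , A< , B , B< , acc = Det.accepts-complete positive md in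
        none a₀ (subst (a₀ <_) (sym e₁₄) a₀<) A (subst (A <_) (sym e₉) A<) B (subst (B <_) (sym e₁₁) B<) acc) x
      where
      below : ∀ {P : ℕ → Set} {j} → (∀ i → i < j → P i) → P j → ∀ i → i < suc j → P i
      below h p i i≤j with m≤n⇒m<n∨m≡n (≤-pred i≤j)
      ... | inj₁ i<j  = h i i<j
      ... | inj₂ refl = p
      N₁ : ℕ → ℕ → Set
      N₁ a₀ A = ∀ B → B < ρ 11 → ¬ Acc a₀ A B
      N₀′ : ℕ → Set
      N₀′ a₀ = ∀ A → A < ρ 9 → N₁ a₀ A
      I₀ : ℕ → Store q → Set
      I₀ j s = Base s × Answer (∀ a₀ → a₀ < j → N₀′ a₀) s
      I₁ : ℕ → ℕ → Store q → Set
      I₁ a₀ j s = Base s × Answer ((∀ a → a < a₀ → N₀′ a) × (∀ A → A < j → N₁ a₀ A)) s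
      I₂ : ℕ → ℕ → ℕ → Store q → Set
      I₂ a₀ A j s = Base s × Answer (((∀ a → a < a₀ → N₀′ a) × (∀ A′ → A′ < A → N₁ a₀ A′)) × (∀ B → B < j → ¬ Acc a₀ A B)) s

    -- The table has no position bound, whereas `digitSum` does and lowers it in each recursive
    -- call. The invariant hence claims agreement for all `e` with `u < suc r ^ e`, where no digit
    -- is left over to be absorbed.
    digit-spec : ∀ s → WP M digitCode ρ s (λ s′ → ∀ u → u < T → s′ dsA u ≡ digits u)
    digit-spec s = z≤n , wp-for {M = M} (# 12) digitBody {ρ} I
      ((λ _ ()) , refl) step
      λ s′ (h , _) u u<T → trans (proj₁ (h u (subst (u <_) (sym e₁₂) u<T)) (suc D) u<T) refl
      where
      I : ℕ → Store q → Set
      I j s′ = (∀ u → u < j → (∀ e → u < suc r ^ e → s′ dsA u ≡ digitSum (suc r) e u) × s′ dsA u ≤ u) × s′ dsA 0 ≡ 0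
      ds0 : ∀ e → digitSum (suc r) e 0 ≡ 0
      ds0 = Digits.ds-0 r 0<r
      step : ∀ u s₁ → u < ρ 12 → I u s₁ → WP M digitBody (ρ [ 16 ↦ u ]) s₁ (I (suc u))
      step u s₁ u<ρ (h , z) = ≤-trans value≤u (≤-trans (<⇒≤ u<T) (≤-trans (m≤m+n T T) (≤-trans 2T≤Z hZ))) ,
        (λ u′ u′≤u → case m≤n⇒m<n∨m≡n (≤-pred u′≤u) of λ
          { (inj₁ u′<u) → let (eq , le) = h u′ u′<u
                              un = unwritten (s₁ dsA) {v = value} (<⇒≢ u′<u) in
              (λ e l → trans un (eq e l)) , ≤-trans (≤-reflexive un) le
          ; (inj₂ refl) → (λ e l → trans (written (s₁ dsA) u value) (correct e l)) , ≤-trans (≤-reflexive (written (s₁ dsA) u value)) value≤u }) ,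
        zero′
        where
        value : ℕ
        value = s₁ dsA (u div suc (ρ 3)) + u mod suc (ρ 3)
        u<T : u < T
        u<T = subst (u <_) e₁₂ u<ρ
        value≡ : value ≡ s₁ dsA (u div suc r) + u mod suc r
        value≡ = cong (λ z → s₁ dsA (u div suc z) + u mod suc z) e₃
        dm = divmod u {suc r} z<s
        half : ∀ {u} → u ≢ 0 → u div suc r < u
        half {zero} h = ⊥-elim (h refl)
        half {suc w} _ = div< (≤-trans (s≤s (m≤m*n (suc w) 1)) (≤-trans (≤-reflexive (+-comm 1 (suc w * 1))) (≤-trans (+-monoʳ-≤ (suc w * 1) (≤-trans 0<r (m≤n*m r (suc w)))) (≤-reflexive (sym (*-distribˡ-+ (suc w) 1 r))))))
        sub : (∀ e → u div suc r < suc r ^ e → s₁ dsA (u div suc r) ≡ digitSum (suc r) e (u div suc r)) × s₁ dsA (u div suc r) ≤ u div suc r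
        sub with u ≟ 0
        ... | yes refl = (λ e _ → trans z (sym (ds0 e))) , ≤-reflexive z
        ... | no u≢0   = h (u div suc r) (half u≢0)
        correct : ∀ e → u < suc r ^ e → value ≡ digitSum (suc r) e u
        correct zero    (s≤s z≤n) = trans value≡ (trans (+-identityʳ (s₁ dsA 0)) z)
        correct (suc e) l = trans value≡ (trans (cong (_+ u mod suc r) (proj₁ sub e (div< (≤-trans l (≤-reflexive (*-comm (suc r) (suc r ^ e)))))))
          (+-comm (digitSum (suc r) e (u div suc r)) (u mod suc r)))
        value≤u : value ≤ u
        value≤u = ≤-trans (≤-reflexive value≡) (≤-trans (+-monoˡ-≤ _ (≤-trans (proj₂ sub) (m≤m*n (u div suc r) (suc r))))
          (≤-reflexive (trans (+-comm (u div suc r * suc r) (u mod suc r)) (sym (proj₁ dm)))))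
        zero′ : (s₁ [ dsA ∙ u ↦ value ]) dsA 0 ≡ 0
        zero′ with u ≟ 0
        ... | yes refl = n≤0⇒n≡0 value≤u
        ... | no u≢0   = trans (unwritten (s₁ dsA) {v = value} (≢-sym u≢0)) z

    main-spec : ∀ s → (∀ a → s inpA a ≡ inputs a) → s gatesA 0 ≡ m → WP M mainCode ρ s (Answer (¬ MD))
    main-spec s in≡ g≡ = wp-mono {M = M} digitCode {ρ}
      (λ s₁ ((d , i) , g) → z≤n , search-spec (s₁ [ ansA ∙ 0 ↦ 0 ]) (isBase (λ a → trans (i a) (in≡ a)) (trans (g 0) g≡) d) refl)
      (frame {M = M} digitCode gatesA refl {ρ} (frame {M = M} digitCode inpA refl {ρ} (digit-spec s)))

open Compile q

-- The script that computes the parameters.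

-- `powA` and `prodA` follow `roundsA` as its powers of 4 and of `Hc`; nothing changes once `powA`
-- exceeds `S`.
roundBody : Code q 9 10
roundBody = when (num 1 +ᵗ var (# 5) -ᵗ the powA)
  ((powA := num 4 *ᵗ the powA) ⨟ (roundsA := num 1 +ᵗ the roundsA) ⨟ (prodA := var (# 7) *ᵗ the prodA)) nop

roundsCode : Code q 9 9
roundsCode = (powA := num 1) ⨟ (roundsA := num 0) ⨟ (prodA := num 1) ⨟ for (# 5) roundBody

powersBody : Code q 11 12
powersBody = (prodB := var (# 8) *ᵗ the prodB) ⨟ (prodT := (num 1 +ᵗ var (# 3)) *ᵗ the prodT)

powersCode : Code q 11 11
powersCode = (prodB := num 1) ⨟ (prodT := num 1) ⨟ for (# 10) powersBody

-- Idling for `Pad` iterations makes the running time at least the largest numbers computed, so that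
-- words of logarithmic length in the time can hold them.
padBody : Code q 16 17
padBody = nop

script₄ : Script 16
script₄ = stage mainCode $ stage (for (# 15) padBody) $ end

script₃′ script₃ : Script 11
script₃′ =
  bind (the prodB) $
  bind ((num 1 +ᵗ var (# 3)) *ᵗ the prodT) $
  bind ((num 1 +ᵗ var (# 2)) *ᵗ var (# 12)) $
  bind (var (# 1) *ᵗ var (# 6)) $
  bind (var (# 14) +ᵗ var (# 9) +ᵗ var (# 11) +ᵗ var (# 13) +ᵗ (num 1 +ᵗ var (# 10)) *ᵗ var (# 8) +ᵗ var (# 7)) $
  script₄

script₃ = stage powersCode script₃′

script₂′ script₂ : Script 9
script₂′ =
  bind (the prodA) $
  bind (num 3 *ᵗ (num 1 +ᵗ var (# 5)) +ᵗ num 2 *ᵗ the roundsA) $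
  script₃

script₂ = stage roundsCode script₂′

script : Script 1
script =
  bind (get inpA (num 0)) $
  bind (get inpA (num 2)) $
  -- The minimum of `r` and `k`: in degree `k` a larger bound on exponents means the same.
  bind (get inpA (num 1) -ᵗ (get inpA (num 1) -ᵗ var (# 2))) $
  -- `size C`: the input length without the four leading cells and the extra cell of each gate.
  bind (var (# 0) -ᵗ num 4 -ᵗ the gatesA) $
  bind (var (# 2) /ᵗ var (# 3)) $
  bind (num 1 +ᵗ var (# 2) *ᵗ var (# 2) *ᵗ num 6) $
  bind (var (# 6) *ᵗ (var (# 2) *ᵗ num 24)) $
  bind ((num 1 +ᵗ var (# 3) *ᵗ num 96) *ᵗ num 3) $
  script₂

-- The number of rounds and derived parameters.

-- rounds S S is the least R with S < 4 ^ R.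
rounds : (S j : ℕ) → ℕ
rounds S zero    = 0
rounds S (suc j) = if0 (suc S ∸ 4 ^ rounds S j) (rounds S j) (suc (rounds S j))

rounds-mono : ∀ S {i j} → i ≤ j → rounds S i ≤ rounds S j
rounds-mono S {j = zero}  z≤n = z≤n
rounds-mono S {i} {suc j} i≤ with m≤n⇒m<n∨m≡n i≤
... | inj₂ refl = ≤-refl
... | inj₁ i<   = ≤-trans (rounds-mono S (≤-pred i<)) (step (suc S ∸ 4 ^ rounds S j))
  where
  step : ∀ x → rounds S j ≤ if0 x (rounds S j) (suc (rounds S j))
  step zero    = ≤-refl
  step (suc _) = n≤1+n _

-- Any increase happens while the power is still at most `S`, so it overshoots by a factor of at
-- most 4.
rounds-≤ : ∀ S j → 0 < S → 4 ^ rounds S j ≤ 4 * S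
rounds-≤ S zero    0<S = ≤-trans 0<S (m≤m+n S _)
rounds-≤ S (suc j) 0<S with suc S ∸ 4 ^ rounds S j in eq
... | zero  = rounds-≤ S j 0<S
... | suc _ = *-monoʳ-≤ 4 (≤-pred (m∸n≢0⇒n<m {suc S} {4 ^ rounds S j} λ e → case trans (sym eq) e of λ ()))

rounds-> : ∀ S j → S < 4 ^ rounds S j ⊎ rounds S j ≡ j
rounds-> S zero    = inj₂ refl
rounds-> S (suc j) with suc S ∸ 4 ^ rounds S j in eq | rounds-> S j
... | zero  | _        = inj₁ (m∸n≡0⇒m≤n eq)
... | suc _ | inj₁ l   = case trans (sym eq) (m≤n⇒m∸n≡0 l) of λ ()
... | suc _ | inj₂ e   = inj₂ (cong suc e)

n<4^n : ∀ n → n < 4 ^ n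
n<4^n zero    = s≤s z≤n
n<4^n (suc n) = ≤-trans (s≤s (n<4^n n)) (≤-trans (+-monoˡ-≤ (4 ^ n) (m^n>0 4 n)) (+-monoʳ-≤ (4 ^ n) (m≤m+n (4 ^ n) _)))

rounds-enough : ∀ S → S < 4 ^ rounds S S
rounds-enough S with rounds-> S S
... | inj₁ l = l
... | inj₂ e = subst (λ z → S < 4 ^ z) (sym e) (n<4^n S)

module Numbers (r₀ k : ℕ) (0<k : 0 < k) (0<r₀ : 0 < r₀) where

  r S R D : ℕ
  r = r₀ ∸ (r₀ ∸ k)
  S = k div r
  R = rounds S S
  D = 3 * suc S + 2 * R

  r≤k : r ≤ k
  r≤k = m≤n+o⇒m∸n≤o r₀ (r₀ ∸ k) (≤-trans (m≤n+m∸n r₀ k) (≤-reflexive (+-comm k (r₀ ∸ k))))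

  r≤r₀ : r ≤ r₀
  r≤r₀ = m∸n≤m r₀ (r₀ ∸ k)

  0<r : 0 < r
  0<r with r₀ ≤? k
  ... | yes le = subst (λ z → 0 < r₀ ∸ z) (sym (m≤n⇒m∸n≡0 le)) 0<r₀
  ... | no ¬le = subst (0 <_) (sym (m∸[m∸n]≡n (<⇒≤ (≰⇒> ¬le)))) 0<k

  Sr≤k : S * r ≤ k
  Sr≤k = ≤-trans (m≤n+m (S * r) (k mod r)) (≤-reflexive (sym (proj₁ (divmod k 0<r))))

  k<Sr : k < suc S * r
  k<Sr = ≤-trans (s≤s (≤-reflexive (proj₁ (divmod k 0<r)))) (+-monoˡ-< (S * r) (proj₂ (divmod k 0<r)))

  0<S : 0 < S
  0<S = n≢0⇒n>0 λ e → <⇒≱ k<Sr (≤-trans (≤-reflexive (trans (cong (λ z → suc z * r) e) (+-identityʳ r))) r≤k)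

  S≤k : S ≤ k
  S≤k = ≤-trans (m≤m*n S r {{>-nonZero 0<r}}) Sr≤k

  0<R : 0 < R
  0<R = n≢0⇒n>0 λ e → <⇒≱ (rounds-enough S) (≤-trans (≤-reflexive (cong (4 ^_) e)) 0<S)

  k≤ : k ≤ 4 ^ R * r
  k≤ = ≤-trans (<⇒≤ k<Sr) (*-monoˡ-≤ r (rounds-enough S))

  D≥ : 3 * k + 2 * r * R ≤ D * r
  D≥ = ≤-trans (+-monoˡ-≤ (2 * r * R) (*-monoʳ-≤ 3 (<⇒≤ k<Sr))) (≤-reflexive (l S r R))
    where
    l : ∀ S r R → 3 * (suc S * r) + 2 * r * R ≡ (3 * suc S + 2 * R) * r
    l = solve-∀

  0<D : 0 < D
  0<D = s≤s z≤n

module Setup {n : ℕ} (C : NonCancelingCircuit n) (r₀ k r S R D : ℕ) (0<n : 0 < n) (0<k : 0 < k) (0<r : 0 < r)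
  (r-def : r₀ ∸ (r₀ ∸ k) ≡ r) (S-def : k div r ≡ S) (R-def : rounds S S ≡ R) (D-def : 3 * suc S + 2 * R ≡ D)
  (r≤r₀ : r ≤ r₀) (0<S : 0 < S) (S≤k : S ≤ k) (k≤ : k ≤ 4 ^ R * r) (D≥ : 3 * k + 2 * r * R ≤ D * r) where

  module Mn = Main C k r R D 0<n 0<k 0<r k≤ D≥
  open Mn using (MD; Z; m)
  open Mn.Det using (N₀; Hc; Gb; T)

  -- Used twice: as a summand of the bound on all stored numbers and as the length of the idle loop.
  Pad : ℕ
  Pad = n * N₀ + Hc ^ R + Gb ^ D + Z + suc D * Gb + Hc

  Final : Store q → ℕ → Set
  Final s lo = ((s ansA 0 ≡ 1 × MD) ⊎ (s ansA 0 ≡ 0 × ¬ MD)) × Pad ≤ lo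

  module _ (M X : ℕ) (inputs : ℕ → ℕ)
    (n≡ : inputs 0 ≡ n) (r≡ : inputs 1 ≡ r₀) (k≡ : inputs 2 ≡ k)
    (size≡ : length (encodeGates (gates C)) ∸ m ≡ size C)
    (holds : Holds inputs 4 (encodeGates (gates C)))
    (inputs≤M : ∀ a → inputs a ≤ M)
    (hPad : Pad ≤ M) (hn : n ≤ M) (hr : r₀ ≤ M) (hk : k ≤ M)
    (hL : 4 + length (encodeGates (gates C)) ≤ M)
    (fitRounds : S ≤ X) (fitPowers : D ≤ X) (fitPad : Pad ≤ X) (1≤X : 1 ≤ X)
    (fitMain : ∀ ρ → Mn.Facts ρ → Fits mainCode ρ X) where

    private
      hH : n * N₀ ≤ M
      hH = ≤-trans (≤-trans (m≤m+n _ _) (≤-trans (m≤m+n _ _) (≤-trans (m≤m+n _ _) (≤-trans (m≤m+n _ (suc D * Gb)) (m≤m+n _ Hc))))) hPad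
      hA : Hc ^ R ≤ M
      hA = ≤-trans (≤-trans (m≤n+m (Hc ^ R) (n * N₀)) (≤-trans (m≤m+n _ _) (≤-trans (m≤m+n _ _) (≤-trans (m≤m+n _ (suc D * Gb)) (m≤m+n _ Hc))))) hPad
      hB : Gb ^ D ≤ M
      hB = ≤-trans (≤-trans (m≤n+m (Gb ^ D) (n * N₀ + Hc ^ R)) (≤-trans (m≤m+n _ Z) (≤-trans (m≤m+n _ (suc D * Gb)) (m≤m+n _ Hc)))) hPad
      hZ : Z ≤ M
      hZ = ≤-trans (≤-trans (m≤n+m Z (n * N₀ + Hc ^ R + Gb ^ D)) (≤-trans (m≤m+n _ (suc D * Gb)) (m≤m+n _ Hc))) hPad
      hpos : suc D * Gb ≤ M
      hpos = ≤-trans (≤-trans (m≤n+m (suc D * Gb) (n * N₀ + Hc ^ R + Gb ^ D + Z)) (m≤m+n _ Hc)) hPad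
      hHc : Hc ≤ M
      hHc = ≤-trans (m≤n+m Hc (n * N₀ + Hc ^ R + Gb ^ D + Z + suc D * Gb)) hPad
      hT : T ≤ M
      hT = ≤-trans (m≤m+n T (k * T)) hZ
      hGb : Gb ≤ M
      hGb = ≤-trans (m≤m+n Gb (D * Gb)) hpos
      1≤M : 1 ≤ M
      1≤M = ≤-trans 0<n hn
      hD : D ≤ M
      hD = ≤-trans (≤-trans (n≤1+n D) (m≤m*n (suc D) Gb)) hpos
      hN : N₀ ≤ M
      hN = ≤-trans (m≤n*m N₀ n {{>-nonZero 0<n}}) hH
      4S≤M : 4 * S ≤ M
      4S≤M = ≤-trans (≤-trans (*-monoʳ-≤ 4 S≤k) (≤-trans (≤-reflexive (*-comm 4 k)) (≤-trans (*-monoʳ-≤ k (≤ᵇ⇒≤ 4 24 _)) (m≤n*m (k * 24) N₀)))) hHc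

    rounds≤R : ∀ j → j ≤ S → rounds S j ≤ R
    rounds≤R j j≤S = subst (rounds S j ≤_) R-def (rounds-mono S j≤S)

    rounds-spec : ∀ ρ s → ρ 5 ≡ S → ρ 7 ≡ Hc → WP M roundsCode ρ s (λ s′ → s′ roundsA 0 ≡ R × s′ prodA 0 ≡ Hc ^ R)
    rounds-spec ρ s e₅ e₇ = 1≤M , z≤n , 1≤M , wp-for {M = M} (# 5) roundBody {ρ} I (refl , refl , refl) step
      λ s₁ (_ , e , e′) → trans e (trans (cong (rounds S) e₅) R-def) , trans e′ (cong (Hc ^_) (trans (cong (rounds S) e₅) R-def))
      where
      I : ℕ → Store q → Set
      I j s′ = s′ powA 0 ≡ 4 ^ rounds S j × s′ roundsA 0 ≡ rounds S j × s′ prodA 0 ≡ Hc ^ rounds S j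
      step : ∀ j s₁ → j < ρ 5 → I j s₁ → WP M roundBody (ρ [ 9 ↦ j ]) s₁ (I (suc j))
      step j s₁ j<ρ (e₁ , e₂ , e₃) =
        (λ nz → let same = grow (suc S ∸ 4 ^ rounds S j) (λ e → nz (trans test e)) in
          ≤-trans (≤-reflexive (trans (cong (4 *_) e₁) (cong (4 ^_) (sym same)))) (≤-trans (rounds-≤ S (suc j) 0<S) 4S≤M) ,
          ≤-trans (≤-reflexive (trans (cong suc e₂) (sym same))) (≤-trans (rounds≤R (suc j) (≤-trans j<ρ (≤-reflexive e₅))) (≤-trans (<⇒≤ (n<4^n R)) (≤-trans (subst (λ z → 4 ^ z ≤ 4 * S) R-def (rounds-≤ S S 0<S)) 4S≤M))) ,
          ≤-trans (≤-reflexive (trans (cong₂ _*_ e₇ e₃) (cong (Hc ^_) (sym same)))) (≤-trans (^-monoʳ-≤ Hc {{>-nonZero 0<Hc}} (rounds≤R (suc j) (≤-trans j<ρ (≤-reflexive e₅)))) hA) ,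
          trans (cong (4 *_) e₁) (cong (4 ^_) (sym same)) , trans (cong suc e₂) (sym same) , trans (cong₂ _*_ e₇ e₃) (cong (Hc ^_) (sym same))) ,
        λ ez → let same = stay (suc S ∸ 4 ^ rounds S j) (trans (sym test) ez) in
          trans e₁ (cong (4 ^_) (sym same)) , trans e₂ (sym same) , trans e₃ (cong (Hc ^_) (sym same))
        where
        0<Hc : 0 < Hc
        0<Hc = *-mono-≤ (z<s {k * k * 6}) (*-mono-≤ 0<k (s≤s {0} {23} z≤n))
        test : suc (ρ 5) ∸ s₁ powA 0 ≡ suc S ∸ 4 ^ rounds S j
        test = cong₂ (λ x y → suc x ∸ y) e₅ e₁
        grow : ∀ x → x ≢ 0 → if0 x (rounds S j) (suc (rounds S j)) ≡ suc (rounds S j)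
        grow zero    h = ⊥-elim (h refl)
        grow (suc _) h = refl
        stay : ∀ x → x ≡ 0 → if0 x (rounds S j) (suc (rounds S j)) ≡ rounds S j
        stay zero    h = refl

    powers-spec : ∀ ρ s → ρ 3 ≡ r → ρ 8 ≡ Gb → ρ 10 ≡ D → WP M powersCode ρ s (λ s′ → s′ prodB 0 ≡ Gb ^ D × s′ prodT 0 ≡ suc r ^ D)
    powers-spec ρ s e₃ e₈ e₁₀ = 1≤M , 1≤M , wp-for {M = M} (# 10) powersBody {ρ} I (refl , refl) step
      λ s₁ (e , e′) → trans e (cong (Gb ^_) e₁₀) , trans e′ (cong (suc r ^_) e₁₀)
      where
      I : ℕ → Store q → Set
      I j s′ = s′ prodB 0 ≡ Gb ^ j × s′ prodT 0 ≡ suc r ^ j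
      step : ∀ j s₁ → j < ρ 10 → I j s₁ → WP M powersBody (ρ [ 11 ↦ j ]) s₁ (I (suc j))
      step j s₁ j<ρ (e , e′) =
        ≤-trans (≤-reflexive (cong₂ _*_ e₈ e)) (≤-trans (^-monoʳ-≤ Gb (≤-trans j<ρ (≤-reflexive e₁₀))) hB) ,
        ≤-trans (≤-reflexive (cong₂ _*_ (cong suc e₃) e′)) (≤-trans (^-monoʳ-≤ (suc r) (≤-trans j<ρ (≤-trans (≤-reflexive e₁₀) (n≤1+n D)))) hT) ,
        cong₂ _*_ e₈ e , cong₂ _*_ (cong suc e₃) e′

    Parameters₈ : Env → Set
    Parameters₈ ρ = ρ 1 ≡ n × ρ 2 ≡ k × ρ 3 ≡ r × ρ 4 ≡ size C × ρ 5 ≡ S × ρ 6 ≡ N₀ × ρ 7 ≡ Hc × ρ 8 ≡ Gb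

    Loaded : Store q → Set
    Loaded s = (∀ a → s inpA a ≡ inputs a) × s gatesA 0 ≡ m

    script₄-spec : ∀ ρ s → Mn.Facts ρ → ρ 15 ≡ Pad → Loaded s → Verified M X script₄ ρ s Final
    script₄-spec ρ s F e₁₅ (in≡ , m≡) =
      verified-stage (fitMain ρ F) $
      wp-mono {M = M} mainCode {ρ} (λ s₃ ans →
        verified (
        (1≤X , 1 , ≤-refl , ≤-trans (≤-reflexive (trans (*-identityʳ _) e₁₅)) fitPad) ,
        wp-for {M = M} (# 15) padBody {ρ} {s₃} {λ s → Final s (ρ 15 + 0)} (λ _ s → s ≡ s₃) refl (λ _ _ _ e → e)
          λ { s refl → ans , ≤-trans (≤-reflexive (sym e₁₅)) (m≤m+n (ρ 15) 0) }))
        (Mn.Search.main-spec ρ F M inputs 1≤M inputs≤M hZ hpos hN hk hA hB hL holds s in≡ m≡)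

    script₃-spec : ∀ ρ s → Parameters₈ ρ → ρ 9 ≡ Hc ^ R → ρ 10 ≡ D → Loaded s → Verified M X script₃ ρ s Final
    script₃-spec ρ s (e₁ , e₂ , e₃ , e₄ , e₅ , e₆ , e₇ , e₈) e₉ e₁₀ (in≡ , m≡) =
      verified-stage (1≤X , 1≤X , 1≤X , 1 , (≤-refl , ≤-refl) , ≤-trans (≤-reflexive (trans (*-identityʳ _) e₁₀)) fitPowers) $
      wp-mono {M = M} powersCode {ρ} after
        (frame {M = M} powersCode gatesA refl {ρ} (frame {M = M} powersCode inpA refl {ρ} (powers-spec ρ s e₃ e₈ e₁₀)))
      where
      after : ∀ s₂ → ((s₂ prodB 0 ≡ Gb ^ D × s₂ prodT 0 ≡ suc r ^ D) × (∀ a → s₂ inpA a ≡ s inpA a)) × (∀ a → s₂ gatesA a ≡ s gatesA a) →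
        Verified M X script₃′ ρ s₂ Final
      after s₂ (((B≡ , T≡) , i₂) , g₂) =
        verified-bind (≤-trans (≤-reflexive B≡) hB) $ verified-bind (≤-trans (≤-reflexive v₁₂) hT) $
        verified-bind (≤-trans (≤-reflexive v₁₃) hZ) $ verified-bind (≤-trans (≤-reflexive v₁₄) hH) $
        verified-bind (≤-trans (≤-reflexive v₁₅) hPad) $
        script₄-spec ρ₁₆ s₂ (record
            { e₁ = e₁ ; e₂ = e₂ ; e₃ = e₃ ; e₄ = e₄ ; e₆ = e₆ ; e₇ = e₇ ; e₈ = e₈
            ; e₉ = e₉ ; e₁₀ = e₁₀ ; e₁₁ = B≡ ; e₁₂ = v₁₂ ; e₁₃ = v₁₃ ; e₁₄ = v₁₄ })
          v₁₅ ((λ a → trans (i₂ a) (in≡ a)) , trans (g₂ 0) m≡)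
        where
        w₁₂ w₁₃ w₁₄ w₁₅ : ℕ
        w₁₂ = (1 + ρ 3) * s₂ prodT 0
        w₁₃ = (1 + ρ 2) * w₁₂
        w₁₄ = ρ 1 * ρ 6
        w₁₅ = w₁₄ + ρ 9 + s₂ prodB 0 + w₁₃ + (1 + ρ 10) * ρ 8 + ρ 7
        v₁₂ : w₁₂ ≡ T
        v₁₂ = cong₂ _*_ (cong suc e₃) T≡
        v₁₃ : w₁₃ ≡ Z
        v₁₃ = cong₂ _*_ (cong suc e₂) v₁₂
        v₁₄ : w₁₄ ≡ n * N₀
        v₁₄ = cong₂ _*_ e₁ e₆
        v₁₅ : w₁₅ ≡ Pad
        v₁₅ = cong₂ _+_ (cong₂ _+_ (cong₂ _+_ (cong₂ _+_ (cong₂ _+_ v₁₄ e₉) B≡) v₁₃) (cong₂ _*_ (cong suc e₁₀) e₈)) e₇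
        ρ₁₆ : Env
        ρ₁₆ = ρ [ 11 ↦ s₂ prodB 0 ] [ 12 ↦ w₁₂ ] [ 13 ↦ w₁₃ ] [ 14 ↦ w₁₄ ] [ 15 ↦ w₁₅ ]

    script₂-spec : ∀ ρ s → Parameters₈ ρ → Loaded s → Verified M X script₂ ρ s Final
    script₂-spec ρ s P@(e₁ , e₂ , e₃ , e₄ , e₅ , e₆ , e₇ , e₈) (in≡ , m≡) =
      verified-stage (1≤X , 1≤X , 1≤X , 1≤X , 1 , ((≤-refl , ≤-refl , ≤-refl) , ≤-refl) , ≤-trans (≤-reflexive (trans (*-identityʳ _) e₅)) fitRounds) $
      wp-mono {M = M} roundsCode {ρ} after
        (frame {M = M} roundsCode gatesA refl {ρ} (frame {M = M} roundsCode inpA refl {ρ} (rounds-spec ρ s e₅ e₇)))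
      where
      after : ∀ s₁ → ((s₁ roundsA 0 ≡ R × s₁ prodA 0 ≡ Hc ^ R) × (∀ a → s₁ inpA a ≡ s inpA a)) × (∀ a → s₁ gatesA a ≡ s gatesA a) →
        Verified M X script₂′ ρ s₁ Final
      after s₁ (((R≡ , A≡) , i₁) , g₁) =
        verified-bind (≤-trans (≤-reflexive A≡) hA) $ verified-bind (≤-trans (≤-reflexive v₁₀) hD) $
        script₃-spec (ρ [ 9 ↦ s₁ prodA 0 ] [ 10 ↦ 3 * (1 + ρ 5) + 2 * s₁ roundsA 0 ]) s₁ P A≡ v₁₀
          ((λ a → trans (i₁ a) (in≡ a)) , trans (g₁ 0) m≡)
        where
        v₁₀ : 3 * (1 + ρ 5) + 2 * s₁ roundsA 0 ≡ D
        v₁₀ = trans (cong₂ (λ a b → 3 * suc a + 2 * b) e₅ R≡) D-def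

    script-spec : ∀ ρ s → ρ 0 ≡ 4 + length (encodeGates (gates C)) → Loaded s → Verified M X script ρ s Final
    script-spec ρ s L≡ ld@(in≡ , m≡) =
      verified-bind (≤-trans (≤-reflexive v₁) hn) $ verified-bind (≤-trans (≤-reflexive v₂) hk) $
      verified-bind (≤-trans (≤-reflexive v₃) (≤-trans r≤r₀ hr)) $
      verified-bind (≤-trans (≤-trans (m∸n≤m (ρ 0 ∸ 4) (s gatesA 0)) (m∸n≤m (ρ 0) 4)) (≤-trans (≤-reflexive L≡) hL)) $
      verified-bind (≤-trans (≤-reflexive v₅) (≤-trans S≤k hk)) $
      verified-bind (≤-trans (≤-reflexive v₆) hN) $ verified-bind (≤-trans (≤-reflexive v₇) hHc) $
      verified-bind (≤-trans (≤-reflexive v₈) hGb) $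
      script₂-spec (ρ [ 1 ↦ s inpA 0 ] [ 2 ↦ s inpA 2 ] [ 3 ↦ w₃ ] [ 4 ↦ ρ 0 ∸ 4 ∸ s gatesA 0 ] [ 5 ↦ w₅ ] [ 6 ↦ w₆ ] [ 7 ↦ w₇ ] [ 8 ↦ w₈ ]) s
        (v₁ , v₂ , v₃ , trans (cong₂ (λ a b → a ∸ 4 ∸ b) L≡ m≡) size≡ , v₅ , v₆ , v₇ , v₈) ld
      where
      w₃ w₅ w₆ w₇ w₈ : ℕ
      w₃ = s inpA 1 ∸ (s inpA 1 ∸ s inpA 2)
      w₅ = s inpA 2 div w₃
      w₆ = 1 + s inpA 2 * s inpA 2 * 6
      w₇ = w₆ * (s inpA 2 * 24)
      w₈ = (1 + w₃ * 96) * 3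
      v₁ : s inpA 0 ≡ n
      v₁ = trans (in≡ 0) n≡
      v₂ : s inpA 2 ≡ k
      v₂ = trans (in≡ 2) k≡
      v₃ : w₃ ≡ r
      v₃ = trans (cong₂ (λ a b → a ∸ (a ∸ b)) (trans (in≡ 1) r≡) v₂) r-def
      v₅ : w₅ ≡ S
      v₅ = trans (cong₂ _div_ v₂ v₃) S-def
      v₆ : w₆ ≡ N₀
      v₆ = cong (λ k → suc (k * k * 6)) v₂
      v₇ : w₇ ≡ Hc
      v₇ = cong₂ (λ a b → a * (b * 24)) v₆ v₂
      v₈ : w₈ ≡ Gb
      v₈ = cong (λ r → suc (r * 96) * 3) v₃

-- Estimating the running time.

^-distrib-* : ∀ a b e → (a * b) ^ e ≡ a ^ e * b ^ e
^-distrib-* a b zero    = refl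
^-distrib-* a b (suc e) = trans (cong (a * b *_) (^-distrib-* a b e)) (l a b (a ^ e) (b ^ e))
  where
  l : ∀ a b x y → a * b * (x * y) ≡ a * x * (b * y)
  l = solve-∀

-- With `4 ^ R ≤ 4 * S` this becomes `3 * R ≤ S + 2`, which lets `12 * S` absorb `9 * R`. Equality
-- holds for `R` equal to 1 and 2.
12R≤4^R+8 : ∀ R → 12 * R ≤ 4 ^ R + 8
12R≤4^R+8 zero          = z≤n
12R≤4^R+8 (suc zero)    = ≤-refl
12R≤4^R+8 (suc (suc R)) = begin
  12 * suc (suc R)          ≡⟨ l₁ R ⟩
  12 + 12 * suc R           ≤⟨ +-mono-≤ (≤-trans (≤-reflexive (sym (*-identityʳ 12))) (*-monoʳ-≤ 12 (m^n>0 4 R))) (12R≤4^R+8 (suc R)) ⟩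
  12 * 4 ^ R + (4 * 4 ^ R + 8) ≡⟨ l₂ (4 ^ R) ⟩
  4 ^ suc (suc R) + 8 ∎
  where
  open ≤-Reasoning
  l₁ : ∀ R → 12 * suc (suc R) ≡ 12 + 12 * suc R
  l₁ = solve-∀
  l₂ : ∀ x → 12 * x + (4 * x + 8) ≡ 4 * (4 * x) + 8
  l₂ = solve-∀

RR≤4^R : ∀ R → R * R ≤ 4 ^ R
RR≤4^R R = ≤-trans (*-mono-≤ (<⇒≤ (n<2^n R)) (<⇒≤ (n<2^n R))) (≤-reflexive (sym (^-distrib-* 2 2 R)))
  where
  n<2^n : ∀ n → n < 2 ^ n
  n<2^n zero    = s≤s z≤n
  n<2^n (suc n) = ≤-trans (+-mono-≤ (m^n>0 2 n) (n<2^n n)) (≤-reflexive (cong (2 ^ n +_) (sym (+-identityʳ (2 ^ n)))))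

-- The number of steps is dominated by the product of the number of seeds
-- and the cost of testing one of them. The rounds contribute the factors
-- 2 ^ O(R ²) and r ^ (9 R), where 4 ^ R ≤ 4 S; they are absorbed as
-- R ² = O(S) and 9 R ≤ 3 S + 6.
module Volume (n k r S R D sz : ℕ) (0<n : 0 < n) (0<k : 0 < k) (0<r : 0 < r) (0<S : 0 < S)
  (r≤k : r ≤ k) (S≤k : S ≤ k) (k≤Sr : k ≤ suc S * r) (4^R≤4S : 4 ^ R ≤ 4 * S) (S<4^R : S < 4 ^ R)
  (D-def : 3 * suc S + 2 * R ≡ D)
  (N₀ Hc Gb Z : ℕ) (N₀≡ : N₀ ≡ suc (k * k * 6)) (Hc≡ : Hc ≡ N₀ * (k * 24)) (Gb≡ : Gb ≡ suc (r * 96) * 3)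
  (Z≡ : Z ≡ suc k * suc r ^ suc D) where

  open ≤-Reasoning

  seedTime volume : ℕ
  seedTime = n * (suc D * (sz * (Z * Z)))
  volume   = n * N₀ * (Hc ^ R * (Gb ^ D * seedTime))

  3R≤S+2 : 3 * R ≤ S + 2
  3R≤S+2 = *-cancelˡ-≤ 4 (begin
    4 * (3 * R)   ≡⟨ *-assoc 4 3 R ⟨
    12 * R        ≤⟨ 12R≤4^R+8 R ⟩
    4 ^ R + 8     ≤⟨ +-monoˡ-≤ 8 4^R≤4S ⟩
    4 * S + 8     ≡⟨ *-distribˡ-+ 4 S 2 ⟨
    4 * (S + 2) ∎)

  R≤S : R ≤ S
  R≤S = *-cancelˡ-≤ 3 (≤-trans 3R≤S+2 (≤-trans (+-monoʳ-≤ S (≤-trans (≤-reflexive (sym (*-identityʳ 2))) (*-monoʳ-≤ 2 0<S))) ≤-refl))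

  RR≤4S : R * R ≤ 4 * S
  RR≤4S = ≤-trans (RR≤4^R R) 4^R≤4S

  sucD≤9k : suc D ≤ 9 * k
  sucD≤9k = ≤-trans (begin
    suc D                          ≡⟨ cong suc D-def ⟨
    suc (3 * suc S + 2 * R)        ≤⟨ s≤s (+-monoʳ-≤ (3 * suc S) (*-monoʳ-≤ 2 R≤S)) ⟩
    suc (3 * suc S + 2 * S)        ≡⟨ l S ⟩
    5 * S + 4 * 1                  ≤⟨ +-monoʳ-≤ (5 * S) (*-monoʳ-≤ 4 0<S) ⟩
    5 * S + 4 * S                  ≡⟨ *-distribʳ-+ S 5 4 ⟨
    9 * S ∎) (*-monoʳ-≤ 9 S≤k)
    where
    l : ∀ S → suc (3 * suc S + 2 * S) ≡ 5 * S + 4 * 1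
    l = solve-∀

  -- `Hc ^ R` contains k^(3 R), which is not polynomial in `k`. Trading each `k` for `r` and a power
  -- of 2 leaves r^(3 R) and 2^O(R²), both of which can be absorbed.
  k≤2^ : k ≤ r * 2 ^ suc (2 * R)
  k≤2^ = ≤-trans k≤Sr (≤-trans (≤-reflexive (*-comm (suc S) r)) (*-monoʳ-≤ r (begin
    suc S         ≤⟨ S<4^R ⟩
    4 ^ R         ≡⟨ ^-*-assoc 2 2 R ⟩
    2 ^ (2 * R)   ≤⟨ m≤m+n _ _ ⟩
    2 ^ suc (2 * R) ∎)))

  N₀≤ : N₀ ≤ 7 * (k * k)
  N₀≤ = begin
    N₀                 ≡⟨ N₀≡ ⟩
    1 + k * k * 6      ≤⟨ +-monoˡ-≤ _ (*-mono-≤ 0<k 0<k) ⟩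
    k * k + k * k * 6  ≡⟨ l (k * k) ⟩
    7 * (k * k) ∎
    where
    l : ∀ x → x + x * 6 ≡ 7 * x
    l = solve-∀

  Hc≤ : Hc ≤ r ^ 3 * 2 ^ (6 * R + 11)
  Hc≤ = begin
    Hc                                   ≡⟨ Hc≡ ⟩
    N₀ * (k * 24)                        ≤⟨ *-monoˡ-≤ (k * 24) N₀≤ ⟩
    7 * (k * k) * (k * 24)               ≡⟨ l₁ 7 24 k ⟩
    -- 168 is the product of the 7 from `N₀≤` and the 24 from `Hc`.
    k * (k * k) * 168                    ≤⟨ *-mono-≤ (*-mono-≤ k≤2^ (*-mono-≤ k≤2^ k≤2^)) (≤ᵇ⇒≤ 168 256 tt) ⟩
    r * a * (r * a * (r * a)) * 2 ^ 8    ≡⟨ l₂ (2 ^ 8) a r ⟩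
    r * (r * (r * 1)) * (a * (a * (a * 1)) * 2 ^ 8)
      ≡⟨ cong (λ z → r ^ 3 * (z * 2 ^ 8)) (^-*-assoc 2 (suc (2 * R)) 3) ⟩
    r ^ 3 * (2 ^ (suc (2 * R) * 3) * 2 ^ 8)
      ≡⟨ cong (r ^ 3 *_) (^-distribˡ-+-* 2 (suc (2 * R) * 3) 8) ⟨
    r ^ 3 * 2 ^ (suc (2 * R) * 3 + 8)
      ≡⟨ cong (λ z → r ^ 3 * 2 ^ z) (l₃ R) ⟩
    r ^ 3 * 2 ^ (6 * R + 11) ∎
    where
    a = 2 ^ suc (2 * R)
    l₁ : ∀ c d k → c * (k * k) * (k * d) ≡ k * (k * k) * (c * d)
    l₁ = solve-∀
    l₂ : ∀ c a r → r * a * (r * a * (r * a)) * c ≡ r * (r * (r * 1)) * (a * (a * (a * 1)) * c)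
    l₂ = solve-∀
    l₃ : ∀ R → suc (2 * R) * 3 + 8 ≡ 6 * R + 11
    l₃ = solve-∀

  power : ∀ {x} b a e → x ≤ r ^ b * 2 ^ a → x ^ e ≤ r ^ (b * e) * 2 ^ (a * e)
  power {x} b a e h = begin
    x ^ e                        ≤⟨ ^-monoˡ-≤ e h ⟩
    (r ^ b * 2 ^ a) ^ e          ≡⟨ ^-distrib-* (r ^ b) (2 ^ a) e ⟩
    (r ^ b) ^ e * (2 ^ a) ^ e    ≡⟨ cong₂ _*_ (^-*-assoc r b e) (^-*-assoc 2 a e) ⟩
    r ^ (b * e) * 2 ^ (a * e) ∎

  Gb≤ : Gb ≤ r ^ 1 * 2 ^ 9
  Gb≤ = begin
    Gb                ≡⟨ Gb≡ ⟩
    (1 + r * 96) * 3  ≤⟨ *-monoˡ-≤ 3 (+-monoˡ-≤ (r * 96) 0<r) ⟩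
    (r + r * 96) * 3  ≡⟨ l 96 3 r ⟩
    r * 1 * 291       ≤⟨ *-monoʳ-≤ (r * 1) (≤ᵇ⇒≤ 291 512 tt) ⟩
    r ^ 1 * 2 ^ 9 ∎
    where
    l : ∀ c d r → (r + r * c) * d ≡ r * 1 * ((1 + c) * d)
    l = solve-∀

  Z≤ : Z ≤ k * 2 * (r ^ suc D * 2 ^ suc D)
  Z≤ = begin
    Z                                ≡⟨ Z≡ ⟩
    suc k * suc r ^ suc D            ≤⟨ *-mono-≤ (+-monoˡ-≤ k 0<k) (^-monoˡ-≤ (suc D) (+-monoˡ-≤ r 0<r)) ⟩
    (k + k) * (r + r) ^ suc D        ≡⟨ cong₂ (λ x y → x * y ^ suc D) (l k) (l r) ⟩
    k * 2 * (r * 2) ^ suc D          ≡⟨ cong (k * 2 *_) (^-distrib-* r 2 (suc D)) ⟩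
    k * 2 * (r ^ suc D * 2 ^ suc D) ∎
    where
    l : ∀ x → x + x ≡ x * 2
    l = solve-∀

  -- The contributions of `Hc ^ R`, of `Gb ^ D` and of the two factors `Z`. After `R ≤ S` and
  -- `R * R ≤ 4 * S` the coefficient is 33 + 24 + 33 = 90.
  exponent₂ : (6 * R + 11) * R + (9 * D + (suc D + suc D)) ≤ 90 * S + 35
  exponent₂ = begin
    (6 * R + 11) * R + (9 * D + (suc D + suc D))
      ≡⟨ cong (λ d → (6 * R + 11) * R + (9 * d + (suc d + suc d))) D-def ⟨
    (6 * R + 11) * R + (9 * (3 * suc S + 2 * R) + (suc (3 * suc S + 2 * R) + suc (3 * suc S + 2 * R)))
      ≡⟨ l₁ R S ⟩
    33 * R + 6 * (R * R) + (33 * S + 35)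
      ≤⟨ +-monoˡ-≤ _ (+-mono-≤ (*-monoʳ-≤ 33 R≤S) (*-monoʳ-≤ 6 RR≤4S)) ⟩
    33 * S + 6 * (4 * S) + (33 * S + 35)
      ≡⟨ l₂ S ⟩
    90 * S + 35 ∎
    where
    l₁ : ∀ R S → (6 * R + 11) * R + (9 * (3 * suc S + 2 * R) + (suc (3 * suc S + 2 * R) + suc (3 * suc S + 2 * R)))
      ≡ 33 * R + 6 * (R * R) + (33 * S + 35)
    l₁ = solve-∀
    l₂ : ∀ S → 33 * S + 6 * (4 * S) + (33 * S + 35) ≡ 90 * S + 35
    l₂ = solve-∀

  -- One `D` for the candidates, two for the table squared: `9 * S`, plus `9 * R` from the rounds.
  -- Bounding the latter by `3 * S + 6` yields the 12 of the theorem.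
  exponentᵣ : 3 * R + (1 * D + (suc D + suc D)) ≤ 12 * S + 17
  exponentᵣ = begin
    3 * R + (1 * D + (suc D + suc D))
      ≡⟨ cong (λ d → 3 * R + (1 * d + (suc d + suc d))) D-def ⟨
    3 * R + (1 * (3 * suc S + 2 * R) + (suc (3 * suc S + 2 * R) + suc (3 * suc S + 2 * R)))
      ≡⟨ l₁ R S ⟩
    3 * (3 * R) + (9 * S + 11)
      ≤⟨ +-monoˡ-≤ _ (*-monoʳ-≤ 3 3R≤S+2) ⟩
    3 * (S + 2) + (9 * S + 11)
      ≡⟨ l₂ S ⟩
    12 * S + 17 ∎
    where
    l₁ : ∀ R S → 3 * R + (1 * (3 * suc S + 2 * R) + (suc (3 * suc S + 2 * R) + suc (3 * suc S + 2 * R))) ≡ 3 * (3 * R) + (9 * S + 11)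
    l₁ = solve-∀
    l₂ : ∀ S → 3 * (S + 2) + (9 * S + 11) ≡ 12 * S + 17
    l₂ = solve-∀

  K₀ : ℕ
  K₀ = k * (k * (k * (k * k)))

  volume≤ : volume ≤ sz * k ^ 22 * n ^ 2 * (r ^ (12 * S) * 2 ^ (90 * S)) * (2 ^ 35 * 252)
  volume≤ = begin
    n * N₀ * (Hc ^ R * (Gb ^ D * (n * (suc D * (sz * (Z * Z))))))
      ≤⟨ *-mono-≤ (*-monoʳ-≤ n N₀≤) (*-mono-≤ (power 3 (6 * R + 11) R Hc≤) (*-mono-≤ (power 1 9 D Gb≤)
           (*-monoʳ-≤ n (*-mono-≤ sucD≤9k (*-monoʳ-≤ sz (*-mono-≤ Z≤ Z≤)))))) ⟩
    n * (7 * (k * k)) * (b₁ * a₁ * (b₂ * a₂ * (n * (9 * k * (sz * (k * 2 * (b₃ * a₃) * (k * 2 * (b₃ * a₃))))))))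
      ≡⟨ l₁ n k sz a₁ b₁ a₂ b₂ a₃ b₃ 7 9 2 ⟩
    sz * K₀ * (n * (n * 1)) * (b₁ * (b₂ * (b₃ * b₃))) * (a₁ * (a₂ * (a₃ * a₃))) * 252
      ≤⟨ *-monoˡ-≤ 252 (*-mono-≤ (*-monoʳ-≤ (sz * K₀ * (n * (n * 1)))
           (≤-trans (≤-reflexive collectᵣ) (^-monoʳ-≤ r {{>-nonZero 0<r}} exponentᵣ))) (≤-trans (≤-reflexive collect₂) (^-monoʳ-≤ 2 exponent₂))) ⟩
    sz * K₀ * (n * (n * 1)) * r ^ (12 * S + 17) * 2 ^ (90 * S + 35) * 252
      ≡⟨ cong₂ (λ x y → sz * K₀ * (n * (n * 1)) * y * x * 252) (^-distribˡ-+-* 2 (90 * S) 35) (^-distribˡ-+-* r (12 * S) 17) ⟩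
    sz * K₀ * (n * (n * 1)) * (r ^ (12 * S) * r ^ 17) * (2 ^ (90 * S) * 2 ^ 35) * 252
      -- The constant part of the exponent of `r` goes into the power of `k`; with the five factors
      -- in `K₀` this makes `k ^ 22`.
      ≤⟨ *-monoˡ-≤ 252 (*-monoˡ-≤ (2 ^ (90 * S) * 2 ^ 35) (*-monoʳ-≤ (sz * K₀ * (n * (n * 1))) (*-monoʳ-≤ (r ^ (12 * S)) (^-monoˡ-≤ 17 r≤k)))) ⟩
    sz * K₀ * (n * (n * 1)) * (r ^ (12 * S) * k ^ 17) * (2 ^ (90 * S) * 2 ^ 35) * 252
      ≡⟨ l₂ n k sz (2 ^ (90 * S)) (2 ^ 35) (r ^ (12 * S)) (k ^ 17) 252 ⟩
    sz * (k * (k * (k * (k * (k * k ^ 17))))) * (n * (n * 1)) * (r ^ (12 * S) * 2 ^ (90 * S)) * (2 ^ 35 * 252) ∎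
    where
    a₁ = 2 ^ ((6 * R + 11) * R)
    b₁ = r ^ (3 * R)
    a₂ = 2 ^ (9 * D)
    b₂ = r ^ (1 * D)
    a₃ = 2 ^ suc D
    b₃ = r ^ suc D
    collect : ∀ x d e f → x ^ d * (x ^ e * (x ^ f * x ^ f)) ≡ x ^ (d + (e + (f + f)))
    collect x d e f = sym (trans (^-distribˡ-+-* x d (e + (f + f))) (cong (x ^ d *_)
      (trans (^-distribˡ-+-* x e (f + f)) (cong (x ^ e *_) (^-distribˡ-+-* x f f)))))
    collect₂ : a₁ * (a₂ * (a₃ * a₃)) ≡ 2 ^ ((6 * R + 11) * R + (9 * D + (suc D + suc D)))
    collect₂ = collect 2 ((6 * R + 11) * R) (9 * D) (suc D)
    collectᵣ : b₁ * (b₂ * (b₃ * b₃)) ≡ r ^ (3 * R + (1 * D + (suc D + suc D)))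
    collectᵣ = collect r (3 * R) (1 * D) (suc D)
    l₁ : ∀ n k sz a₁ b₁ a₂ b₂ a₃ b₃ c d e → n * (c * (k * k)) * (b₁ * a₁ * (b₂ * a₂ * (n * (d * k * (sz * (k * e * (b₃ * a₃) * (k * e * (b₃ * a₃))))))))
      ≡ sz * (k * (k * (k * (k * k)))) * (n * (n * 1)) * (b₁ * (b₂ * (b₃ * b₃))) * (a₁ * (a₂ * (a₃ * a₃))) * (c * d * e * e)
    l₁ = solve-∀
    l₂ : ∀ n k sz x y u v c → sz * (k * (k * (k * (k * k)))) * (n * (n * 1)) * (u * v) * (x * y) * c
      ≡ sz * (k * (k * (k * (k * (k * v))))) * (n * (n * 1)) * (u * x) * (y * c)
    l₂ = solve-∀

timeConstant : ℕ → ℕ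
timeConstant K = K * (2 ^ 35 * 252 * 2 ^ 90)

-- If `r` was capped at `k`, the claimed exponent 12 k/r₀ may be too small for `r ^ (12 * S)`. Then
-- `S ≤ 1`, and the factor is at most `k ^ 12 * 2 ^ 90`, which accounts for the exponent 34 = 22 +
-- 12 and the last factor of the constant.
timeBound : ∀ {n} (C : NonCancelingCircuit n) K r₀ k r S t → 0 < n → 0 < k → 0 < r₀ → 0 < r →
  (r ≡ r₀) ⊎ (r ≡ k × k ≤ r₀) → S * r ≤ k →
  t ≤ size C * k ^ 22 * n ^ 2 * (r ^ (12 * S) * 2 ^ (90 * S)) * (2 ^ 35 * 252) * K →
  TimeBound (timeConstant K) 90 34 (λ _ → 0ℚ) C r₀ k t
timeBound {n} C K r₀ k r S t 0<n 0<k 0<r₀ 0<r r≡ Sr≤k t≤ =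
  -- For ε = 0 the numerator is 0 and the denominator 1.
  subst₂ (λ e e′ → t ^ e ≤ Y ^ e * r₀ ^ (12 * k) * 2 ^ e′) (sym (*-identityʳ r₀)) (sym (*-identityʳ (90 * k))) (go r≡)
  where
  open ≤-Reasoning
  c₁ c₂ Y Y′ V : ℕ
  c₁ = 2 ^ 35 * 252
  c₂ = 2 ^ 90
  Y  = timeConstant K * size C * k ^ 34 * n ^ 3 * suc ⌊log₂ n ⌋
  Y′ = K * (size C * k ^ 22 * n ^ 2 * c₁)
  V  = r ^ (12 * S) * 2 ^ (90 * S)
  t≤′ : t ≤ Y′ * V
  t≤′ = ≤-trans t≤ (≤-reflexive (l K c₁ (size C * k ^ 22 * n ^ 2) V))
    where
    l : ∀ k c x v → x * v * c * k ≡ k * (x * c) * v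
    l = solve-∀
  Y″ : ℕ
  Y″ = Y′ * (k ^ 12 * c₂)
  Y″≤Y : Y″ ≤ Y
  Y″≤Y = begin
    K * (size C * k ^ 22 * n ^ 2 * c₁) * (k ^ 12 * c₂)
      ≡⟨ l K c₁ c₂ (size C) (k ^ 22) (k ^ 12) (n ^ 2) ⟩
    K * (c₁ * c₂) * size C * (k ^ 22 * k ^ 12) * n ^ 2
      ≡⟨ cong (λ z → timeConstant K * size C * z * n ^ 2) (^-distribˡ-+-* k 22 12) ⟨
    timeConstant K * size C * k ^ 34 * n ^ 2
      ≤⟨ *-monoʳ-≤ (timeConstant K * size C * k ^ 34) (^-monoʳ-≤ n {{>-nonZero 0<n}} (n≤1+n 2)) ⟩
    timeConstant K * size C * k ^ 34 * n ^ 3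
      ≤⟨ m≤m*n (timeConstant K * size C * k ^ 34 * n ^ 3) (suc ⌊log₂ n ⌋) ⟩
    Y ∎
    where
    l : ∀ K c e s x y z → K * (s * x * z * c) * (y * e) ≡ K * (c * e) * s * (x * y) * z
    l = solve-∀
  Y′≤Y : Y′ ≤ Y
  Y′≤Y = ≤-trans (m≤m*n Y′ (k ^ 12 * c₂) {{>-nonZero (*-mono-≤ (m^n>0 k {{>-nonZero 0<k}} 12) (m^n>0 2 90))}}) Y″≤Y
  go : (r ≡ r₀) ⊎ (r ≡ k × k ≤ r₀) → t ^ r₀ ≤ Y ^ r₀ * r₀ ^ (12 * k) * 2 ^ (90 * k)
  go (inj₁ refl) = begin
    t ^ r                                                ≤⟨ ^-monoˡ-≤ r t≤′ ⟩
    (Y′ * V) ^ r                                         ≡⟨ ^-distrib-* Y′ V r ⟩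
    Y′ ^ r * V ^ r                                       ≡⟨ cong (Y′ ^ r *_) (^-distrib-* (r ^ (12 * S)) (2 ^ (90 * S)) r) ⟩
    Y′ ^ r * ((r ^ (12 * S)) ^ r * (2 ^ (90 * S)) ^ r)   ≡⟨ cong₂ (λ x y → Y′ ^ r * (x * y)) (^-*-assoc r (12 * S) r) (^-*-assoc 2 (90 * S) r) ⟩
    Y′ ^ r * (r ^ (12 * S * r) * 2 ^ (90 * S * r))       ≡⟨ *-assoc (Y′ ^ r) _ _ ⟨
    Y′ ^ r * r ^ (12 * S * r) * 2 ^ (90 * S * r)
      ≤⟨ *-mono-≤ (*-mono-≤ (^-monoˡ-≤ r Y′≤Y) (^-monoʳ-≤ r {{>-nonZero 0<r}} (bound 12))) (^-monoʳ-≤ 2 (bound 90)) ⟩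
    Y ^ r * r ^ (12 * k) * 2 ^ (90 * k) ∎
    where
    bound : ∀ c → c * S * r ≤ c * k
    bound c = ≤-trans (≤-reflexive (*-assoc c S r)) (*-monoʳ-≤ c Sr≤k)
  go (inj₂ (refl , k≤r₀)) = begin
    t ^ r₀      ≤⟨ ^-monoˡ-≤ r₀ (≤-trans t≤′ (≤-trans (*-monoʳ-≤ Y′ V≤) Y″≤Y)) ⟩
    Y ^ r₀      ≤⟨ m≤m*n (Y ^ r₀) (r₀ ^ (12 * k)) {{>-nonZero (m^n>0 r₀ {{>-nonZero 0<r₀}} (12 * k))}} ⟩
    Y ^ r₀ * r₀ ^ (12 * k)  ≤⟨ m≤m*n _ (2 ^ (90 * k)) {{>-nonZero (m^n>0 2 (90 * k))}} ⟩
    Y ^ r₀ * r₀ ^ (12 * k) * 2 ^ (90 * k) ∎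
    where
    S≤1 : S ≤ 1
    S≤1 = *-cancelʳ-≤ S 1 r {{>-nonZero 0<r}} (≤-trans Sr≤k (≤-reflexive (sym (*-identityˡ r))))
    V≤ : V ≤ r ^ 12 * c₂
    V≤ = *-mono-≤ (^-monoʳ-≤ r {{>-nonZero 0<r}} (*-monoʳ-≤ 12 S≤1)) (^-monoʳ-≤ 2 (*-monoʳ-≤ 90 S≤1))

-- The complete program and its resource bounds.

module P = Prologue q inpA gatesA (λ ())

answerTerm : Term q 0
answerTerm = the ansA

program : Program
program = P.prologue ⨾ (⟪ script ⟫script ⨾ (lit 0 ≔ ⌜ answerTerm ⌝))

assignCost : Exp → Exp → ℕ
assignCost e₁ e₂ = suc (cost e₁ + cost e₂)

prologueFactor totalFactor : ℕ
prologueFactor = assignCost (lit 4) (lit 1 ⊕ lit 6 ⊗ P.W) + ((P.scanCost + suc (cost P.scanTest)) +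
  (assignCost (P.pointer ⊕ lit (suc (toℕ gatesA))) (mem (lit 3)) + (assignCost (lit 3) P.pointer + (assignCost (lit 4) (lit 0) +
  (assignCost base (lit 0) + (6 * P.copyCost + suc (cost P.copyTest)))))))
totalFactor = prologueFactor + (6 * scriptFactor script + assignCost (lit 0) ⌜ answerTerm ⌝)

prologue-factor : ∀ a s t b c d e y u {i L V} → i ≤ V → L ≤ V * 6 → 1 ≤ V →
  a + ((i * s + t) + (b + (c + (d + (e + (L * y + u)))))) ≤ V * (a + ((s + t) + (b + (c + (d + (e + (6 * y + u)))))))
prologue-factor a s t b c d e y u {i} {L} {V} i≤ L≤ 1≤ = begin
  a + ((i * s + t) + (b + (c + (d + (e + (L * y + u))))))
    ≤⟨ +-mono-≤ (x a) (+-mono-≤ (+-mono-≤ (*-monoˡ-≤ s i≤) (x t)) (+-mono-≤ (x b) (+-mono-≤ (x c) (+-mono-≤ (x d) (+-mono-≤ (x e)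
         (+-mono-≤ (*-monoˡ-≤ y L≤) (x u))))))) ⟩
  a * V + ((V * s + t * V) + (b * V + (c * V + (d * V + (e * V + (V * 6 * y + u * V))))))
    ≡⟨ l a s t b c d e 6 y u V ⟩
  V * (a + ((s + t) + (b + (c + (d + (e + (6 * y + u))))))) ∎
  where
  open ≤-Reasoning
  x : ∀ a → a ≤ a * V
  x a = m≤m*n a V {{>-nonZero 1≤}}
  l : ∀ a s t b c d e z y u V → a * V + ((V * s + t * V) + (b * V + (c * V + (d * V + (e * V + (V * z * y + u * V))))))
    ≡ V * (a + ((s + t) + (b + (c + (d + (e + (z * y + u)))))))
  l = solve-∀

total-factor : ∀ a b c {t₁ t₂ V} → t₁ ≤ V * a → t₂ ≤ b * (V * 6) → 1 ≤ V → t₁ + (t₂ + c) ≤ V * (a + (6 * b + c))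
total-factor a b c {t₁} {t₂} {V} h₁ h₂ 1≤ = ≤-trans (+-mono-≤ h₁ (+-mono-≤ h₂ (m≤m*n c V {{>-nonZero 1≤}}))) (≤-reflexive (l a b c 6 V))
  where
  l : ∀ a b c d V → V * a + (b * (V * d) + c * V) ≡ V * (a + (d * b + c))
  l = solve-∀

record Solved {n : ℕ} (C : NonCancelingCircuit n) (r k M d lo hi : ℕ) : Set where
  constructor solved
  field
    {t w}   : ℕ
    decides : program Decides MonomialDetection ⟦ C ⟧ r k from input C r k [ t , w ]
    w≤M^d   : w ≤ M ^ d
    lo≤time : lo ≤ t
    time≤hi : t ≤ hi

wordDegree : ℕ
wordDegree = programDegree (P.prologue ⨾ (⟪ script ⟫script ⨾ (lit 0 ≔ ⌜ answerTerm ⌝)))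

wordExponent : ℕ
wordExponent = 5 * wordDegree

words-fit : ∀ d {e M B w} → e ≡ 5 * d → w ≤ M ^ d → M ≤ B ^ 5 → w ≤ B ^ e
words-fit d {B = B} e≡ w≤ M≤ = ≤-trans w≤ (≤-trans (^-monoˡ-≤ d M≤) (≤-reflexive (trans (^-*-assoc B 5 d) (cong (B ^_) (sym e≡)))))

-- The left side is at most `16 * B * B`, and `4 ≤ B` lets two further factors `B` absorb the 16.
word-size : ∀ {B a b c} → 4 ≤ B → a ≤ B → b ≤ B * 7 → c ≤ B + 2 → a * b + c ≤ B ^ 5
word-size {B} {a} {b} {c} 4≤B a≤ b≤ c≤ = begin
  a * b + c                ≤⟨ +-mono-≤ (*-mono-≤ a≤ b≤) c≤ ⟩
  B * (B * 7) + (B + 2)    ≤⟨ +-mono-≤ (*-monoʳ-≤ B (*-monoʳ-≤ B (≤ᵇ⇒≤ 7 14 tt))) (+-monoʳ-≤ B (≤-trans (≤ᵇ⇒≤ 2 4 tt) 4≤B)) ⟩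
  B * (B * 14) + (B + B)   ≤⟨ +-monoʳ-≤ (B * (B * 14)) (≤-trans (≤-reflexive (l₀ B)) (*-monoʳ-≤ B (*-monoˡ-≤ 2 (≤-trans (≤ᵇ⇒≤ 1 4 tt) 4≤B)))) ⟩
  B * (B * 14) + B * (B * 2) ≡⟨ l₁ B 14 2 ⟩
  B * (B * 16)             ≤⟨ *-monoʳ-≤ B (*-monoʳ-≤ B (≤-trans (*-mono-≤ 4≤B 4≤B) (m≤m*n (B * B) (B * 1) {{>-nonZero (≤-trans (≤-trans (≤ᵇ⇒≤ 1 4 tt) 4≤B) (≤-reflexive (sym (*-identityʳ B))))}}))) ⟩
  B * (B * (B * B * (B * 1))) ≡⟨ l₂ B ⟩
  B ^ 5 ∎
  where
  open ≤-Reasoning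
  l₀ : ∀ B → B + B ≡ B * (1 * 2)
  l₀ = solve-∀
  l₁ : ∀ B c d → B * (B * c) + B * (B * d) ≡ B * (B * (c + d))
  l₁ = solve-∀
  l₂ : ∀ B → B * (B * (B * B * (B * 1))) ≡ B * (B * (B * (B * (B * 1))))
  l₂ = solve-∀

-- The first gate has no earlier gates as operands and fan-in is nonzero, so it is a variable.
gates⇒variables : ∀ {n m} → Gates n (suc m) → 0 < n
gates⇒variables {suc n} _ = z<s
gates⇒variables {zero} (gs@(_ ▷ _) ▷ g) = gates⇒variables gs
gates⇒variables {zero} (∅ ▷ var ())
gates⇒variables {zero} (∅ ▷ add (() ∷⁺ _))
gates⇒variables {zero} (∅ ▷ mul (() ∷⁺ _))

gates≤size : ∀ {n m} (gs : Gates n m) → m ≤ gatesSize gs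
gates≤size ∅ = z≤n
gates≤size {m = suc m} (gs ▷ g) = ≤-trans (≤-reflexive (+-comm 1 m)) (+-mono-≤ (gates≤size gs) (s≤s z≤n))

load-below : ∀ {M} xs → ListAll.All (_≤ M) xs → Below M (load xs)
load-below []       _        a       = z≤n
load-below (x ∷ xs) (p ∷ _)  zero    = p
load-below (x ∷ xs) (_ ∷ ps) (suc a) = load-below xs ps a

encodeGate-below : ∀ {n m M} (g : Gate n m) → n ≤ M → m ≤ M → length (encodeGate g) ≤ M → 2 ≤ M → ListAll.All (_≤ M) (encodeGate g)
encodeGate-below (var i) n≤ m≤ l≤ 2≤ = z≤n ∷ ≤-trans (<⇒≤ (toℕ<n i)) n≤ ∷ []
encodeGate-below (add (i ∷⁺ is)) n≤ m≤ l≤ 2≤ = ≤-trans (n≤1+n 1) 2≤ ∷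
  ≤-trans (≤-trans (≤-reflexive (cong suc (sym (length-map toℕ is)))) (≤-trans (n≤1+n _) (n≤1+n _))) l≤ ∷
  ≤-trans (<⇒≤ (toℕ<n i)) m≤ ∷ map⁺ (ListAll.universal (λ j → ≤-trans (<⇒≤ (toℕ<n j)) m≤) is)
encodeGate-below (mul (i ∷⁺ is)) n≤ m≤ l≤ 2≤ = 2≤ ∷
  ≤-trans (≤-trans (≤-reflexive (cong suc (sym (length-map toℕ is)))) (≤-trans (n≤1+n _) (n≤1+n _))) l≤ ∷
  ≤-trans (<⇒≤ (toℕ<n i)) m≤ ∷ map⁺ (ListAll.universal (λ j → ≤-trans (<⇒≤ (toℕ<n j)) m≤) is)

encodeGates-below : ∀ {n m M} (gs : Gates n m) → n ≤ M → length (encodeGates gs) ≤ M → 2 ≤ M → ListAll.All (_≤ M) (encodeGates gs)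
encodeGates-below ∅ n≤ l≤ 2≤ = []
encodeGates-below {M = M} (gs ▷ g) n≤ l≤ 2≤ = ++⁺
  (encodeGates-below gs n≤ l₁ 2≤)
  (encodeGate-below g n≤ (≤-trans (m≤n+m _ (gatesSize gs)) (≤-trans (≤-reflexive (sym (length-encodeGates gs))) l₁))
    (≤-trans (m≤n+m _ (length (encodeGates gs))) l≤′) 2≤)
  where
  l≤′ : length (encodeGates gs) + length (encodeGate g) ≤ M
  l≤′ = ≤-trans (≤-reflexive (sym (length-++ (encodeGates gs)))) l≤
  l₁ : length (encodeGates gs) ≤ M
  l₁ = ≤-trans (m≤m+n _ _) l≤′

holds-cong : ∀ {f g} p xs → (∀ a → p ≤ a → a < p + length xs → g a ≡ f a) → Holds f p xs → Holds g p xs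
holds-cong p []       h hold       = hold
holds-cong p (x ∷ xs) h (e , hold) = trans (h p ≤-refl (m<m+n p z<s)) e ,
  holds-cong (suc p) xs (λ a p<a a< → h a (<⇒≤ p<a) (≤-trans a< (≤-reflexive (sym (+-suc p (length xs)))))) hold

part≤sum : ∀ {n r r′} {μ : Vec ℕ n} → (∀ {x} → x ≤ sum μ → x ≤ r → x ≤ r′) → All (_≤ r) μ → All (_≤ r′) μ
part≤sum {μ = []}    h []       = []
part≤sum {μ = x ∷ μ} h (p ∷ ps) = h (m≤m+n x (sum μ)) p ∷ part≤sum (λ l → h (≤-trans l (m≤n+m (sum μ) x))) ps

module _ {n : ℕ} (C : NonCancelingCircuit n) (r₀ k : ℕ) (0<k : 0 < k) (0<r₀ : 0 < r₀) where

  open Numbers r₀ k 0<k 0<r₀ using (r; r≤k; r≤r₀; 0<r)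

  private
    0<n : 0 < n
    0<n = gates⇒variables (gates C)

  cap : (r₀ ≤ k × r ≡ r₀) ⊎ (r ≡ k × k ≤ r₀)
  cap with r₀ ≤? k
  ... | yes le = inj₁ (le , cong (r₀ ∸_) (m≤n⇒m∸n≡0 le))
  ... | no ¬le = inj₂ (m∸[m∸n]≡n (<⇒≤ (≰⇒> ¬le)) , <⇒≤ (≰⇒> ¬le))

  -- No exponent of a monomial of degree `k` exceeds `k`.
  cap-detection : ∀ {f : Poly n} → MonomialDetection f r₀ k → MonomialDetection f r k
  cap-detection (μ , nz , deg , small) = μ , nz , deg , part≤sum (λ {x} x≤ x≤r₀ → below (≤-trans x≤ (≤-reflexive deg)) x≤r₀ cap) small
    where
    below : ∀ {x} → x ≤ k → x ≤ r₀ → (r₀ ≤ k × r ≡ r₀) ⊎ (r ≡ k × k ≤ r₀) → x ≤ r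
    below x≤k x≤r₀ (inj₁ (_ , e)) = ≤-trans x≤r₀ (≤-reflexive (sym e))
    below x≤k x≤r₀ (inj₂ (e , _)) = ≤-trans x≤k (≤-reflexive (sym e))

  uncap-detection : ∀ {f : Poly n} → MonomialDetection f r k → MonomialDetection f r₀ k
  uncap-detection (μ , nz , deg , small) = μ , nz , deg , part≤sum (λ _ x≤r → ≤-trans x≤r r≤r₀) small

  module _ (S R D : ℕ) (S≡ : k div r ≡ S) (R≡ : rounds S S ≡ R) (D≡ : 3 * suc S + 2 * R ≡ D)
    (0<S : 0 < S) (S≤k : S ≤ k) (Sr≤k′ : S * r ≤ k) (k<Sr′ : k < suc S * r)
    (S<4^R : S < 4 ^ R) (4^R≤4S : 4 ^ R ≤ 4 * S)
    (k≤′ : k ≤ 4 ^ R * r) (D≥′ : 3 * k + 2 * r * R ≤ D * r) where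

    module St = Setup C r₀ k r S R D 0<n 0<k 0<r refl S≡ R≡ D≡ r≤r₀ 0<S S≤k k≤′ D≥′
    open St using (Pad)
    open St.Mn using (Z; m)
    open St.Mn.Det using (N₀; Hc; Gb; T)

    module V = Volume n k r S R D (size C) 0<n 0<k 0<r 0<S r≤k S≤k (<⇒≤ k<Sr′) 4^R≤4S S<4^R D≡
      N₀ Hc Gb Z refl refl refl refl
    open V using (seedTime; volume)

    L : ℕ
    L = 4 + length (encodeGates (gates C))

    budget : ℕ
    budget = volume * 6

    private
      0<size : 0 < size C
      0<size = pos (gates C)
        where
        pos : ∀ {c} (gs : Gates n (suc c)) → 0 < gatesSize gs
        pos (gs ▷ g) = ≤-trans (s≤s z≤n) (m≤n+m (suc (fanIn g)) (gatesSize gs))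

      0<T : 0 < T
      0<T = m^n>0 (suc r) (suc D)
      0<Z : 0 < Z
      0<Z = ≤-trans 0<T (m≤m+n T (k * T))
      0<Hc : 0 < Hc
      0<Hc = *-mono-≤ (z<s {k * k * 6}) (*-mono-≤ 0<k (s≤s {0} {23} z≤n))
      0<ZZ : 0 < Z * Z
      0<ZZ = *-mono-≤ 0<Z 0<Z
      Z≤ZZ : Z ≤ Z * Z
      Z≤ZZ = m≤m*n Z Z {{>-nonZero 0<Z}}
      sZZ≤ : size C * (Z * Z) ≤ suc D * (size C * (Z * Z))
      sZZ≤ = m≤n*m _ (suc D)
      ZZ≤ : Z * Z ≤ suc D * (size C * (Z * Z))
      ZZ≤ = ≤-trans (m≤n*m (Z * Z) (size C) {{>-nonZero 0<size}}) sZZ≤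
      0<sZZ : 0 < size C * (Z * Z)
      0<sZZ = *-mono-≤ 0<size 0<ZZ
      ≤seed : ∀ {x} → x ≤ suc D * (size C * (Z * Z)) → x ≤ seedTime
      ≤seed h = ≤-trans h (m≤n*m _ n {{>-nonZero 0<n}})
      0<seed : 0 < seedTime
      0<seed = ≤seed (≤-trans 0<ZZ ZZ≤)
      0<HcR : 0 < Hc ^ R
      0<HcR = m^n>0 Hc {{>-nonZero 0<Hc}} R
      0<GbD : 0 < Gb ^ D
      0<GbD = m^n>0 Gb D
      0<H : 0 < n * N₀
      0<H = *-mono-≤ 0<n (z<s {k * k * 6})
      B₁ B₂ : ℕ
      B₁ = Gb ^ D * seedTime
      B₂ = Hc ^ R * B₁
      0<B₁ : 0 < B₁
      0<B₁ = *-mono-≤ 0<GbD 0<seed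
      0<B₂ : 0 < B₂
      0<B₂ = *-mono-≤ 0<HcR 0<B₁
      0<volume : 0 < volume
      0<volume = *-mono-≤ 0<H 0<B₂
      ≤volume : ∀ {x} → x ≤ B₁ → x ≤ volume
      ≤volume h = ≤-trans h (≤-trans (m≤n*m B₁ (Hc ^ R) {{>-nonZero 0<HcR}}) (m≤n*m B₂ (n * N₀) {{>-nonZero 0<H}}))
      seed≤B₁ : seedTime ≤ B₁
      seed≤B₁ = m≤n*m seedTime (Gb ^ D) {{>-nonZero 0<GbD}}
      volume≤budget : volume ≤ budget
      volume≤budget = m≤m*n volume 6
      sucD≤seed : suc D ≤ seedTime
      sucD≤seed = ≤seed (m≤m*n (suc D) (size C * (Z * Z)) {{>-nonZero 0<sZZ}})
      size≤volume : size C ≤ volume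
      size≤volume = ≤volume (≤-trans (≤seed (≤-trans (m≤m*n (size C) (Z * Z) {{>-nonZero 0<ZZ}}) sZZ≤)) seed≤B₁)
      T≤Z : T ≤ Z
      T≤Z = m≤m+n T (k * T)
      0<R : 0 < R
      0<R = n≢0⇒n>0 λ e → <⇒≱ S<4^R (≤-trans (≤-reflexive (cong (4 ^_) e)) 0<S)
      0<D : 0 < D
      0<D = subst (0 <_) D≡ (s≤s z≤n)
      x≤x^ : ∀ x e → 0 < x → 0 < e → x ≤ x ^ e
      x≤x^ x e 0<x 0<e = ≤-trans (≤-reflexive (sym (*-identityʳ x))) (^-monoʳ-≤ x {{>-nonZero 0<x}} 0<e)
      pad-parts : ∀ {a b c d e f x} → a ≤ x → b ≤ x → c ≤ x → d ≤ x → e ≤ x → f ≤ x → a + b + c + d + e + f ≤ x * 6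
      pad-parts {x = x} a b c d e f = ≤-trans (+-mono-≤ (+-mono-≤ (+-mono-≤ (+-mono-≤ (+-mono-≤ a b) c) d) e) f) (≤-reflexive (l x))
        where
        l : ∀ x → x + x + x + x + x + x ≡ x * 6
        l = solve-∀
      Pad≤budget : Pad ≤ budget
      Pad≤budget = pad-parts
        (m≤m*n (n * N₀) B₂ {{>-nonZero 0<B₂}})
        (≤-trans (m≤m*n (Hc ^ R) B₁ {{>-nonZero 0<B₁}}) (m≤n*m B₂ (n * N₀) {{>-nonZero 0<H}}))
        (≤volume (m≤m*n (Gb ^ D) seedTime {{>-nonZero 0<seed}}))
        (≤volume (≤-trans (≤seed (≤-trans Z≤ZZ ZZ≤)) seed≤B₁))
        (≤volume (≤-trans (*-mono-≤ sucD≤seed (x≤x^ Gb D z<s 0<D)) (≤-reflexive (*-comm seedTime (Gb ^ D)))))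
        (≤-trans (≤-trans (x≤x^ Hc R 0<Hc 0<R) (m≤m*n (Hc ^ R) B₁ {{>-nonZero 0<B₁}})) (m≤n*m B₂ (n * N₀) {{>-nonZero 0<H}}))

      1≤budget : 1 ≤ budget
      1≤budget = ≤-trans 0<volume volume≤budget

    fitMain : ∀ ρ → St.Mn.Facts ρ → Fits mainCode ρ budget
    fitMain ρ F =
      (1≤budget , 1≤budget , 1 , ≤-refl , as e₁₂ (≤-trans (≤-trans (≤-reflexive (*-identityʳ T)) T≤Z) (≤-trans (≤volume (≤-trans (≤seed (≤-trans Z≤ZZ ZZ≤)) seed≤B₁)) volume≤budget))) ,
      1≤budget ,
      (1≤budget , B₂ ,
        (0<B₂ , B₁ ,
          (0<B₁ , seedTime ,
            (weighFits , circuitFits , checkFits) ,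
            as e₁₁ ≤-refl) ,
          as e₉ ≤-refl) ,
        as e₁₄ volume≤budget)
      where
      open St.Mn.Facts F
      as : ∀ {a b y x} → a ≡ b → b * y ≤ x → a * y ≤ x
      as refl h = h
      0<sD : 0 < suc D
      0<sD = z<s
      weighFits : Fits weighCode ρ seedTime
      weighFits = 0<seed , suc D ,
        (0<sD , 0<sD , 0<sD , 0<sD , 0<sD , 0<sD , 0<sD ,
          (0<sD , 1 , (≤-refl , ≤-refl , ≤-refl , (((≤-refl , ≤-refl , ≤-refl) , ≤-refl) , ((≤-refl , ≤-refl) , ≤-refl))) ,
            as e₁₀ (≤-trans (≤-reflexive (*-identityʳ D)) (n≤1+n D))) ,
          0<sD) ,
        as e₁ (*-monoʳ-≤ n (m≤m*n (suc D) (size C * (Z * Z)) {{>-nonZero 0<sZZ}}))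
      z : 1 ≤ Z * Z
      z = 0<ZZ
      Z1≤ : ρ 13 * 1 ≤ Z * Z
      Z1≤ = as e₁₃ (≤-trans (≤-reflexive (*-identityʳ Z)) Z≤ZZ)
      -- The sumset of two rows dominates a step; all other work on rows is linear in `Z`.
      stepFits : Fits stepCode ρ (Z * Z)
      stepFits =
        (z , z , z ,
          ((z , 1 , ((≤-refl , ≤-refl) , ≤-refl) , Z1≤) ,
           (z , Z , ((0<Z , 1 , (≤-refl , ≤-refl) , as e₁₃ (≤-reflexive (*-identityʳ Z))) , 0<Z) , as e₁₃ ≤-refl)) ,
          (z , 1 , (≤-refl , ≤-refl) , Z1≤)) ,
        ((z , 1 , ≤-refl , Z1≤) , z , ((z , (z , z)) , z) , z , z)
      circuitFits : Fits circuitCode ρ seedTime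
      circuitFits = 0<seed , 0<seed , 0<seed ,
        (0<seed , Z * Z , stepFits , as e₄ (≤seed sZZ≤))
      checkFits : Fits checkCode ρ seedTime
      checkFits = 0<seed , 1 , (≤-refl , ≤-refl) , as e₁₂ (≤-trans (≤-trans (≤-reflexive (*-identityʳ T)) T≤Z) (≤seed (≤-trans Z≤ZZ ZZ≤)))

    L≡ : L ≡ 4 + (size C + m)
    L≡ = cong (4 +_) (length-encodeGates (gates C))

    m≤size : m ≤ size C
    m≤size = gates≤size (gates C)

    L≤6 : L ≤ volume * 6
    L≤6 = begin
      L                              ≡⟨ L≡ ⟩
      4 + (size C + m)               ≤⟨ +-mono-≤ (≤-trans (≤-reflexive (sym (*-identityʳ 4))) (*-monoʳ-≤ 4 0<size)) (+-monoʳ-≤ (size C) m≤size) ⟩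
      4 * size C + (size C + size C) ≡⟨ l′ (size C) ⟩
      size C * 6                     ≤⟨ *-monoˡ-≤ 6 size≤volume ⟩
      volume * 6 ∎
      where
      open ≤-Reasoning
      l′ : ∀ x → 4 * x + (x + x) ≡ x * 6
      l′ = solve-∀

    module _ (M : ℕ) (2≤M : 2 ≤ M) (hn : n ≤ M) (hr : r₀ ≤ M) (hk : k ≤ M) (hPad : Pad ≤ M) (hM : (m + 1) * suc L ≤ M) where

      private
       hL : L ≤ M
       hL = ≤-trans (≤-trans (n≤1+n L) (m≤n*m (suc L) (m + 1) {{>-nonZero (m≤n+m 1 m)}})) hM
       hm : m ≤ M
       hm = ≤-trans (≤-trans (m≤m+n m 1) (m≤m*n (m + 1) (suc L))) hM

      bd₀ : Below M (input C r₀ k)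
      bd₀ = load-below _ (hn ∷ hr ∷ hk ∷ hm ∷ encodeGates-below (gates C) hn (≤-trans (m≤n+m _ 4) hL) 2≤M)

      finishRun : Runs M P.prologue (input C r₀ k) (P.prologueTime C r₀ k 2≤M bd₀ hM) (P.Copied C r₀ k 2≤M bd₀ hM L) →
        Solved C r₀ k M wordDegree Pad (volume * totalFactor)
      finishRun (runs {σ₁} {t₁} {w₁} run₁ bd₁ cp t₁≤ w₁≤) = conclude (simulateVerified 2≤M 1≤budget {1} {L} {σ₁} {λ _ → L} {s₀} script {St.Final} rep bd₁ spec)
        where
        open P.Copied cp
        s₀ : Store q
        s₀ x a = σ₁ (cell L (suc (toℕ x)) a)
        rep : Represents L 1 σ₁ (λ _ → L) s₀
        rep = record
          { 3<b = m≤m+n 4 _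
          ; atBase = atBase′
          ; vars = λ { zero _ → trans (cong σ₁ (+-identityʳ L)) counter ; (suc _) (s≤s ()) }
          ; arrays = λ _ _ → refl }
        loaded : ∀ a → a < L → a ≢ 3 → s₀ inpA a ≡ input C r₀ k a
        loaded = copied
        spec : Verified M budget script (λ _ → L) s₀ St.Final
        spec = St.script-spec M budget (s₀ inpA) (loaded 0 (s≤s z≤n) λ ()) (loaded 1 (s≤s (s≤s z≤n)) λ ()) (loaded 2 (s≤s (s≤s (s≤s z≤n))) λ ())
          (trans (cong (_∸ m) (length-encodeGates (gates C))) (m+n∸n≡m (size C) m))
          (holds-cong 4 (encodeGates (gates C)) (λ a 4≤a a<L → loaded a a<L (≢-sym (<⇒≢ 4≤a))) (holds-input C r₀ k))
          (λ a → bd₁ _) hPad hn hr hk hL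
          (≤-trans S≤k (≤-trans k≤Z (≤-trans (≤volume (≤-trans (≤seed (≤-trans Z≤ZZ ZZ≤)) seed≤B₁)) volume≤budget)))
          (≤-trans (n≤1+n D) (≤-trans sucD≤seed (≤-trans (≤volume seed≤B₁) volume≤budget)))
          Pad≤budget 1≤budget fitMain (λ _ → L) s₀ refl ((λ _ → refl) , gateCell)
          where
          k≤Z : k ≤ Z
          k≤Z = ≤-trans (n≤1+n k) (m≤m*n (suc k) T {{>-nonZero 0<T}})
        conclude : Σ[ σ′ ∈ Memory ] Σ[ s′ ∈ Store q ] Σ[ t ∈ ℕ ] Σ[ w ∈ ℕ ] Σ[ lo ∈ ℕ ]
          (⟪ script ⟫script , σ₁ ⇓ σ′ [ t , w ]) × (∃[ ρ′ ] Represents L 0 σ′ ρ′ s′) × Below M σ′ ×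
          St.Final s′ lo × lo ≤ t × t ≤ scriptFactor script * budget × w ≤ M ^ programDegree ⟪ script ⟫script →
          Solved C r₀ k M wordDegree Pad (volume * totalFactor)
        conclude (σ₂ , s₂ , t₂ , w₂ , lo , run₂ , (ρ₂ , R₂) , bd₂ , (ans , Pad≤) , lo≤ , t₂≤ , w₂≤) =
          solved (_ , seq run₁ (seq run₂ assign) , decide ans)
          (to-degree (seq-peak P.prologue (⟪ script ⟫script ⨾ (lit 0 ≔ ⌜ answerTerm ⌝)) w₁≤
            (seq-peak ⟪ script ⟫script (lit 0 ≔ ⌜ answerTerm ⌝) w₂≤ (assign-peak bd₂ (lit 0) ⌜ answerTerm ⌝))))
          (≤-trans Pad≤ (≤-trans lo≤ (≤-trans (m≤m+n t₂ _) (m≤n+m _ t₁))))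
          (total-factor prologueFactor (scriptFactor script) (assignCost (lit 0) ⌜ answerTerm ⌝) (≤-trans t₁≤ prologue≤) t₂≤ 0<volume)
          where
          open Simulate 2≤M using (seq-peak; assign-peak)
          to-degree : ∀ {w} → w ≤ M ^ programDegree (P.prologue ⨾ (⟪ script ⟫script ⨾ (lit 0 ≔ ⌜ answerTerm ⌝))) → w ≤ M ^ wordDegree
          to-degree {w} = subst (λ d → w ≤ M ^ d) degree≡
            where
            degree≡ : programDegree (P.prologue ⨾ (⟪ script ⟫script ⨾ (lit 0 ≔ ⌜ answerTerm ⌝))) ≡ wordDegree
            degree≡ = refl
          value : ⟦ ⌜ answerTerm ⌝ ⟧exp σ₂ ≡ s₂ ansA 0
          value = term-value R₂ answerTerm
          decide : (s₂ ansA 0 ≡ 1 × MonomialDetection ⟦ C ⟧ r k) ⊎ (s₂ ansA 0 ≡ 0 × ¬ MonomialDetection ⟦ C ⟧ r k) →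
            (⟦ ⌜ answerTerm ⌝ ⟧exp σ₂ ≡ 1 × MonomialDetection ⟦ C ⟧ r₀ k) ⊎ (⟦ ⌜ answerTerm ⌝ ⟧exp σ₂ ≡ 0 × ¬ MonomialDetection ⟦ C ⟧ r₀ k)
          decide (inj₁ (e , md)) = inj₁ (trans value e , uncap-detection {⟦ C ⟧} md)
          decide (inj₂ (e , ¬md)) = inj₂ (trans value e , λ md → ¬md (cap-detection {⟦ C ⟧} md))
          prologue≤ : P.prologueTime C r₀ k 2≤M bd₀ hM ≤ volume * prologueFactor
          prologue≤ = prologue-factor (assignCost (lit 4) (lit 1 ⊕ lit 6 ⊗ P.W)) P.scanCost (suc (cost P.scanTest))
            (assignCost (P.pointer ⊕ lit (suc (toℕ gatesA))) (mem (lit 3))) (assignCost (lit 3) P.pointer) (assignCost (lit 4) (lit 0))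
            (assignCost base (lit 0)) P.copyCost (suc (cost P.copyTest))
            (≤-trans (≤-trans (n≤1+n (inner C)) m≤size) size≤volume) L≤6 0<volume

      runProgram : Solved C r₀ k M wordDegree Pad (volume * totalFactor)
      runProgram = finishRun (P.runs-prologue C r₀ k 2≤M bd₀ hM)

    solve-instance : ∃[ t ] ∃[ w ] program Decides MonomialDetection ⟦ C ⟧ r₀ k from input C r₀ k [ t , w ]
      × WordsFit wordExponent C r₀ k t w × TimeBound (timeConstant totalFactor) 90 34 (λ _ → 0ℚ) C r₀ k t
    solve-instance = finish (runProgram M 2≤M hn hr hk hPad hM)
      where
      M : ℕ
      -- The product covers the packed pair of the prologue, the other summands cover the input
      -- values and the parameters, and the 2 ensures `2 ≤ M`.
      M = (m + 1) * suc L + (n + (r₀ + (k + (Pad + 2))))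
      r≤M : Pad + 2 ≤ M
      r≤M = ≤-trans (≤-trans (m≤n+m (Pad + 2) k) (≤-trans (m≤n+m _ r₀) (m≤n+m _ n))) (m≤n+m _ ((m + 1) * suc L))
      hPad : Pad ≤ M
      hPad = ≤-trans (m≤m+n Pad 2) r≤M
      2≤M : 2 ≤ M
      2≤M = ≤-trans (m≤n+m 2 Pad) r≤M
      hn : n ≤ M
      hn = ≤-trans (m≤m+n n _) (m≤n+m _ ((m + 1) * suc L))
      hr : r₀ ≤ M
      hr = ≤-trans (≤-trans (m≤m+n r₀ _) (m≤n+m _ n)) (m≤n+m _ ((m + 1) * suc L))
      hk : k ≤ M
      hk = ≤-trans (≤-trans (≤-trans (m≤m+n k _) (m≤n+m _ r₀)) (m≤n+m _ n)) (m≤n+m _ ((m + 1) * suc L))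
      hM : (m + 1) * suc L ≤ M
      hM = m≤m+n _ _
      sucL≤ : suc L ≤ size C * 7
      sucL≤ = ≤-trans (≤-reflexive (cong suc L≡)) (≤-trans (+-mono-≤ {5} {5 * size C} (≤-trans (≤-reflexive (sym (*-identityʳ 5))) (*-monoʳ-≤ 5 0<size)) (+-monoʳ-≤ (size C) m≤size))
        (≤-reflexive (l (size C))))
        where
        l : ∀ x → 5 * x + (x + x) ≡ x * 7
        l = solve-∀
      finish : Solved C r₀ k M wordDegree Pad (volume * totalFactor) →
        ∃[ t ] ∃[ w ] program Decides MonomialDetection ⟦ C ⟧ r₀ k from input C r₀ k [ t , w ]
          × WordsFit wordExponent C r₀ k t w × TimeBound (timeConstant totalFactor) 90 34 (λ _ → 0ℚ) C r₀ k t
      finish (solved {t} {w} dec w≤ Pad≤t t≤) = t , w , dec ,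
        words-fit wordDegree {wordExponent} {M} {B} refl w≤ M≤B^5 ,
        timeBound C totalFactor r₀ k r S t 0<n 0<k 0<r₀ 0<r (⊎.map₁ proj₂ cap) Sr≤k′ (≤-trans t≤ (*-monoˡ-≤ totalFactor V.volume≤))
        where
        B : ℕ
        B = size C + n + r₀ + k + t
        size+n≤B : size C + n ≤ B
        size+n≤B = ≤-trans (m≤m+n (size C + n) r₀) (≤-trans (m≤m+n _ k) (m≤m+n _ t))
        4≤B : 4 ≤ B
        4≤B = ≤-trans (+-mono-≤ (+-mono-≤ (+-mono-≤ 0<size 0<n) 0<r₀) 0<k) (m≤m+n _ t)
        tail≤B : n + (r₀ + (k + (Pad + 2))) ≤ B + 2
        tail≤B = ≤-trans (≤-reflexive (l n r₀ k Pad 2)) (+-monoˡ-≤ 2 (+-mono-≤ (+-monoˡ-≤ k (+-monoˡ-≤ r₀ (m≤n+m n (size C)))) Pad≤t))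
          where
          l : ∀ a b c d e → a + (b + (c + (d + e))) ≡ a + b + c + d + e
          l = solve-∀
        M≤B^5 : M ≤ B ^ 5
        M≤B^5 = word-size {B} {m + 1} {suc L} {n + (r₀ + (k + (Pad + 2)))} 4≤B (≤-trans (+-mono-≤ m≤size 0<n) size+n≤B)
          (≤-trans sucL≤ (*-monoˡ-≤ 7 (≤-trans (m≤m+n (size C) n) size+n≤B))) tail≤B

  solve-all : ∃[ t ] ∃[ w ] program Decides MonomialDetection ⟦ C ⟧ r₀ k from input C r₀ k [ t , w ]
    × WordsFit wordExponent C r₀ k t w × TimeBound (timeConstant totalFactor) 90 34 (λ _ → 0ℚ) C r₀ k t
  solve-all = solve-instance Nm.S Nm.R Nm.D refl refl refl Nm.0<S Nm.S≤k Nm.Sr≤k Nm.k<Sr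
    (rounds-enough Nm.S) (rounds-≤ Nm.S Nm.S Nm.0<S) Nm.k≤ Nm.D≥
    where module Nm = Numbers r₀ k 0<k 0<r₀

theorem3 :
  ∃[ P ] ∃[ A ] ∃[ c ] ∃[ d ] ∃[ e ] ∃[ ε ]
    (IsLittleO1 ε ×
     (∀ {n : ℕ} (C : NonCancelingCircuit n) (r k : ℕ) .{{_ : NonZero r}} .{{_ : NonZero k}} →
        ∃[ t ] ∃[ w ]
          (P Decides MonomialDetection ⟦ C ⟧ r k from input C r k [ t , w ]
           × WordsFit e C r k t w
           × TimeBound A c d ε C r k t)))
theorem3 = program , timeConstant totalFactor , 90 , 34 , wordExponent , (λ _ → 0ℚ) ,
  ((λ _ → ℚ.≤-refl) , λ δ 0<δ → 0 , λ _ _ → 0<δ) ,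
  λ C r k → solve-all C r k (n≢0⇒n>0 (≢-nonZero⁻¹ k)) (n≢0⇒n>0 (≢-nonZero⁻¹ r))
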